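{- Let $m\ge2$ be an integer. In the word RAM model with word size $w\ge2\log m$, any array $A[1..m']$ of $m'\le m$ positive integers such that $\sum_{i=1}^{m'}A[i]=O(m\log m)$ can be preprocessed in $O(m)$ time so that range counting queries on $A$ can be answered in $O(1)$ time.
   Context: $\log$ is base 2. The word RAM has $w$-bit words, with standard bitwise and arithmetic operations in $O(1)$ time. Range counting query on an array $A[1..m']$: given $j\in\{0,\dots,m'\}$ and an integer $v\ge0$, return $|\{i\in\{1,\dots,j\}:A[i]\ge v\}|$. The hypothesis on the sum means $\sum_{i=1}^{m'}A[i]\le c_0\,m\log m$ for a fixed constant $c_0$; the constants hidden in the $O(m)$ and $O(1)$ bounds may depend on $c_0$ but not on $m$, $m'$, $A$, or $w$. -}

module Defs where

open import Data.Bool using (Bool; true; false; not; _∧_; _∨_; _xor_; if_then_else_)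
open import Data.Fin using (Fin; toℕ; finToFun; funToFin)
open import Data.Fin.Properties using (2↔Bool)
open import Data.List using (List; []; _∷_; length; take; filter; lookup)
open import Data.Nat using (ℕ; zero; suc; _+_; _*_; _∸_; _^_; _/_; _%_; _≤_; _≤?_; _<ᵇ_; _≡ᵇ_)
open import Data.Nat.DivMod using (_mod_)
open import Data.Nat.Properties using (m^n≢0)
open import Data.Product using (Σ-syntax; ∃-syntax; _×_; _,_)
open import Data.Unit using (⊤)
open import Data.Vec.Functional using (Vector; updateAt)
open import Function using (const)
open import Function.Bundles using (Inverse)
open import Relation.Binary.PropositionalEquality using (_≡_)

infix 4 _≤_·log₂_ _≥_·log₂_

-- x ≤ c · log₂ m, exponentiated so that no real numbers are needed
-- (an exact equivalence for m ≥ 1).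
_≤_·log₂_ : ℕ → ℕ → ℕ → Set
x ≤ c ·log₂ m = 2 ^ x ≤ m ^ c

-- x ≥ c · log₂ m, likewise.
_≥_·log₂_ : ℕ → ℕ → ℕ → Set
x ≥ c ·log₂ m = m ^ c ≤ 2 ^ x

rangeCount : List ℕ → ℕ → ℕ → ℕ
rangeCount A j v = length (filter (v ≤?_) (take j A))

------------------------------------------------------------------------
-- Words

-- A w-bit word is identified with the unsigned integer it denotes.
Word : ℕ → Set
Word w = Fin (2 ^ w)

word : ∀ w → ℕ → Word w
word w n = _mod_ n (2 ^ w) {{m^n≢0 2 w}}

-- `finToFun` splits a word into its binary digits, most significant first.
bits : ∀ w → Word w → Fin w → Bool
bits w x i = Inverse.to 2↔Bool (finToFun x i)

fromBits : ∀ w → (Fin w → Bool) → Word w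
fromBits w f = funToFin (λ i → Inverse.from 2↔Bool (f i))

infixl 7 _/₀_ _%₀_

-- Division and remainder, with value 0 when the divisor is 0.
_/₀_ _%₀_ : ℕ → ℕ → ℕ
x /₀ zero      = 0
x /₀ d@(suc _) = x / d
x %₀ zero      = 0
x %₀ d@(suc _) = x % d

data BinOp : Set where
  add sub mul div mod bitand bitor bitxor shl shr : BinOp

-- Arithmetic is modulo 2 ^ w.
⟦_⟧ᵒ : BinOp → ∀ w → Word w → Word w → Word w
⟦ add ⟧ᵒ    w x y = word w (toℕ x + toℕ y)
⟦ sub ⟧ᵒ    w x y = word w (toℕ x + (2 ^ w ∸ toℕ y))
⟦ mul ⟧ᵒ    w x y = word w (toℕ x * toℕ y)
⟦ div ⟧ᵒ    w x y = word w (toℕ x /₀ toℕ y)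
⟦ mod ⟧ᵒ    w x y = word w (toℕ x %₀ toℕ y)
⟦ bitand ⟧ᵒ w x y = fromBits w (λ i → bits w x i ∧ bits w y i)
⟦ bitor ⟧ᵒ  w x y = fromBits w (λ i → bits w x i ∨ bits w y i)
⟦ bitxor ⟧ᵒ w x y = fromBits w (λ i → bits w x i xor bits w y i)
⟦ shl ⟧ᵒ    w x y = word w (toℕ x * 2 ^ toℕ y)
⟦ shr ⟧ᵒ    w x y = word w (toℕ x /₀ 2 ^ toℕ y)

------------------------------------------------------------------------
-- Word RAM programs

-- Programs do not mention w, so one program runs at every word size.
-- A program text names only finitely many of the registers.
Reg : Set
Reg = ℕ

data Operand : Set where
  reg : Reg → Operand
  lit : ℕ → Operand                 -- literals are reduced modulo 2 ^ w

data Expr : Set where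
  val  : Operand → Expr
  comp : Operand → Expr             -- bitwise complement
  bin  : BinOp → Operand → Operand → Expr
  load : Operand → Expr             -- contents of the memory cell addressed

data Test : Set where
  less equal : Operand → Operand → Test

infixr 4 _⨟_
infix  5 _≔_

data Program : Set where
  skip   : Program
  _≔_    : Reg → Expr → Program
  store  : Operand → Operand → Program   -- address, contents
  _⨟_    : Program → Program → Program
  ifte   : Test → Program → Program → Program
  while  : Test → Program → Program

-- Memory has one cell for each of the 2 ^ w addresses that fit in a word.
record State (w : ℕ) : Set where
  constructor state
  field
    regs : Reg → Word w
    mem  : Vector (Word w) (2 ^ w)

open State public

setReg : ∀ {w} → Reg → Word w → State w → State w
setReg r x σ = state (λ r′ → if r ≡ᵇ r′ then x else regs σ r′) (mem σ)

setMem : ∀ {w} → Word w → Word w → State w → State w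
setMem a x σ = state (regs σ) (updateAt (mem σ) a (const x))

⟦_⟧ᵃ : Operand → ∀ {w} → State w → Word w
⟦ reg r ⟧ᵃ     σ = regs σ r
⟦ lit n ⟧ᵃ {w} σ = word w n

⟦_⟧ᵉ : Expr → ∀ {w} → State w → Word w
⟦ val a ⟧ᵉ          σ = ⟦ a ⟧ᵃ σ
⟦ comp a ⟧ᵉ     {w} σ = fromBits w (λ i → not (bits w (⟦ a ⟧ᵃ σ) i))
⟦ bin op a b ⟧ᵉ {w} σ = ⟦ op ⟧ᵒ w (⟦ a ⟧ᵃ σ) (⟦ b ⟧ᵃ σ)
⟦ load a ⟧ᵉ         σ = mem σ (⟦ a ⟧ᵃ σ)

⟦_⟧ᵗ : Test → ∀ {w} → State w → Bool
⟦ less a b ⟧ᵗ  σ = toℕ (⟦ a ⟧ᵃ σ) <ᵇ toℕ (⟦ b ⟧ᵃ σ)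
⟦ equal a b ⟧ᵗ σ = toℕ (⟦ a ⟧ᵃ σ) ≡ᵇ toℕ (⟦ b ⟧ᵃ σ)

-- ⟨ P , σ ⟩⇓[ t ] σ′ : run from σ, P halts in σ′ after exactly t unit-cost
-- steps. Every assignment, store, skip and evaluation of a test costs 1.
infix 3 ⟨_,_⟩⇓[_]_

data ⟨_,_⟩⇓[_]_ {w : ℕ} : Program → State w → ℕ → State w → Set where
  skip⇓   : ∀ {σ} → ⟨ skip , σ ⟩⇓[ 1 ] σ
  assign⇓ : ∀ {σ r e} → ⟨ r ≔ e , σ ⟩⇓[ 1 ] setReg r (⟦ e ⟧ᵉ σ) σ
  store⇓  : ∀ {σ a b} → ⟨ store a b , σ ⟩⇓[ 1 ] setMem (⟦ a ⟧ᵃ σ) (⟦ b ⟧ᵃ σ) σ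
  seq⇓    : ∀ {σ σ′ σ″ P Q s t} →
            ⟨ P , σ ⟩⇓[ s ] σ′ → ⟨ Q , σ′ ⟩⇓[ t ] σ″ →
            ⟨ P ⨟ Q , σ ⟩⇓[ s + t ] σ″
  then⇓   : ∀ {σ σ′ b P Q t} → ⟦ b ⟧ᵗ σ ≡ true →
            ⟨ P , σ ⟩⇓[ t ] σ′ → ⟨ ifte b P Q , σ ⟩⇓[ suc t ] σ′
  else⇓   : ∀ {σ σ′ b P Q t} → ⟦ b ⟧ᵗ σ ≡ false →
            ⟨ Q , σ ⟩⇓[ t ] σ′ → ⟨ ifte b P Q , σ ⟩⇓[ suc t ] σ′
  stop⇓   : ∀ {σ b P} → ⟦ b ⟧ᵗ σ ≡ false → ⟨ while b P , σ ⟩⇓[ 1 ] σ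
  loop⇓   : ∀ {σ σ′ σ″ b P s t} → ⟦ b ⟧ᵗ σ ≡ true →
            ⟨ P , σ ⟩⇓[ s ] σ′ → ⟨ while b P , σ′ ⟩⇓[ t ] σ″ →
            ⟨ while b P , σ ⟩⇓[ suc (s + t) ] σ″

------------------------------------------------------------------------
-- Input and output conventions

-- The array occupies cells 0 , … , m′ ∸ 1; m and m′ are in registers 0 and 1.
-- All other cells and registers are uninitialised (arbitrary). As a cell holds
-- one word, there is such a state only if every entry of A is below 2 ^ w.
record Holds {w : ℕ} (m : ℕ) (A : List ℕ) (σ : State w) : Set where
  field
    m-in-r0  : toℕ (regs σ 0) ≡ m
    m′-in-r1 : toℕ (regs σ 1) ≡ length A
    A-in-mem : ∀ i → toℕ (mem σ (word w (toℕ i))) ≡ lookup A i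

-- A prefix length j ∈ {0 , … , m′} and a threshold v.
Query : ℕ → List ℕ → Set
Query w A = Fin (suc (length A)) × Word w

-- j and v are placed in registers 0 and 1; the answer is left in register 0.
ask : ∀ {w A} → Query w A → State w → State w
ask {w} (j , v) σ = setReg 1 v (setReg 0 (word w (toℕ j)) σ)

-- From σ, the queries are answered one after another, each in at most d steps
-- and each starting in the state the preceding one left behind.
Answers : ∀ {w} → Program → ℕ → (A : List ℕ) → State w → List (Query w A) → Set
Answers P d A σ [] = ⊤
Answers {w} P d A σ (q@(j , v) ∷ qs) =
  Σ[ σ′ ∈ State w ] ∃[ t ]
    (⟨ P , ask {A = A} q σ ⟩⇓[ t ] σ′)
    × t ≤ d
    × toℕ (regs σ′ 0) ≡ rangeCount A (toℕ j) (toℕ v)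
    × Answers P d A σ′ qs

{-# OPTIONS --safe #-}
-- Write L = ⌊log₂ m⌋. Since Σ ⌊A[i] / L⌋ = O(m), there is room to list, for
-- every u, the excesses x - u * L of the elements x ≥ u * L, capped at L. All
-- these lists are concatenated into one array D, so that for v = u * L + o with
-- o < L the query (j , v) counts the entries ≥ o in an interval of D.
--
-- The right end of the interval depends on u and j. Let k be the bit length of
-- u. The elements x for which ⌊x / L⌋ has bit length at least k include all
-- those ≥ u * L, and a table F gives the right end for u and each prefix of the
-- list of these elements. An element x takes part for at most 1 + 2 ⌊x / L⌋
-- values of u, so F has size O(m). The length of the prefix is the number of
-- i ≤ j for which ⌊A[i] / L⌋ has bit length at least k: again a count of entries
-- ≥ k in an interval of D, if D starts with these bit lengths.
--
-- Entries of D are O(L). For each threshold o = O(L), the bit vector [ D[x] ≥ o ]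
-- is stored in blocks of L bits, together with the number of ones from each block
-- on; this takes O(m) words. As L-bit words are at most m, a table of population
-- counts finishes a count of ones in O(1) time.
--
-- The tables need O(m) cells, and m² are available. This fails only for m below
-- a constant, and then a query may scan A.
module Submission where

open import Defs
open import Data.Bool using (Bool; true; false; T; if_then_else_; _∧_)
open import Data.Empty using (⊥; ⊥-elim)
open import Data.Fin using (Fin; zero; suc; toℕ)
open import Data.Fin.Properties using (toℕ-fromℕ<; toℕ<n; toℕ-injective)
open import Data.List using (List; []; _∷_; length; take; map; filterᵇ; filter; _++_; [_]; lookup; applyUpTo)
open import Data.List.Properties using (++-assoc; ++-identityʳ; length-++; length-applyUpTo)
open import Data.List.Relation.Unary.All using (All; []; _∷_)
open import Data.Nat
open import Data.Nat.DivMod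
open import Data.Nat.ListAction using (sum)
open import Data.Nat.Properties
open import Data.Nat.Solver using (module +-*-Solver)
open import Data.Product using (Σ-syntax; ∃-syntax; _×_; _,_; proj₁; proj₂)
open import Data.Unit using (⊤; tt)
open import Data.Vec.Functional using (updateAt)
open import Data.Vec.Functional.Properties using (updateAt-updates; updateAt-minimal)
open import Function using (const; _∘_; _$_; case_of_)
open import Relation.Binary.Definitions using (tri<; tri≈; tri>)
open import Relation.Binary.PropositionalEquality hiding ([_])
open import Relation.Nullary using (yes; no; ¬_; contradiction)

-- The obstacle is circular. A table over all positions j and all O(m) thresholds is too large,
-- while a table over the exact list of elements ≥ u * L needs the position of j in that list, which
-- is the query itself. Rounding u to its bit length breaks the circle: only O(L) different lists
-- have to be located, few enough thresholds for the narrow rank structure, so that one structure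
-- serves both steps of a query. To fill the bit vectors in linear time, only the bits [D[x] = o]
-- are set one by one. The bits [D[x] ≥ o] then arise row by row, with a single addition for each
-- word, from [D[x] = o] + [D[x] ≥ o + 1]. Words can overflow and memory starts with arbitrary
-- contents, so the programs are written in a small language over the natural numbers, whose rules
-- demand that every intermediate value fits. With stride Z and nine arrays this requires 9 * Z ≤ 2
-- ^ w for the addresses and Z * L < 2 ^ w for the suffix sums. Both follow from 9 * Z * L ≤ m², the
-- inequality that separates large from small m.

≤ᵇ-true : ∀ {x y} → x ≤ y → (x ≤ᵇ y) ≡ true
≤ᵇ-true {x} {y} p with x ≤ᵇ y in eq
... | true  = refl
... | false = ⊥-elim (subst T eq (≤⇒≤ᵇ p))

≤ᵇ-false : ∀ {x y} → y < x → (x ≤ᵇ y) ≡ false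
≤ᵇ-false {x} {y} p with x ≤ᵇ y in eq
... | false = refl
... | true  = contradiction (<-≤-trans p (≤ᵇ⇒≤ x y (subst T (sym eq) tt))) (<-irrefl refl)

<ᵇ-true : ∀ {x y} → x < y → (x <ᵇ y) ≡ true
<ᵇ-true p = ≤ᵇ-true p

<ᵇ-false : ∀ {x y} → y ≤ x → (x <ᵇ y) ≡ false
<ᵇ-false p = ≤ᵇ-false (s≤s p)

≡ᵇ-true : ∀ {x y} → x ≡ y → (x ≡ᵇ y) ≡ true
≡ᵇ-true {zero}  refl = refl
≡ᵇ-true {suc x} refl = ≡ᵇ-true {x} refl

≡ᵇ-false : ∀ {x y} → x ≢ y → (x ≡ᵇ y) ≡ false
≡ᵇ-false {x} {y} x≢y with x ≡ᵇ y in eq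
... | false = refl
... | true  = contradiction (≡ᵇ⇒≡ x y (subst T (sym eq) tt)) x≢y

ind : Bool → ℕ
ind true  = 1
ind false = 0

ind≤1 : ∀ b → ind b ≤ 1
ind≤1 true  = ≤-refl
ind≤1 false = z≤n

nth : ∀ {X : Set} → X → List X → ℕ → X
nth d []       _       = d
nth d (x ∷ xs) zero    = x
nth d (x ∷ xs) (suc n) = nth d xs n

put : ∀ {X : Set} → List X → ℕ → X → List X
put []       _       y = []
put (x ∷ xs) zero    y = y ∷ xs
put (x ∷ xs) (suc n) y = x ∷ put xs n y

module _ {X : Set} where

  length-put : (xs : List X) (n : ℕ) (y : X) → length (put xs n y) ≡ length xs
  length-put []       n       y = refl
  length-put (x ∷ xs) zero    y = refl
  length-put (x ∷ xs) (suc n) y = cong suc (length-put xs n y)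

  nth-put : ∀ d (xs : List X) n y → n < length xs → nth d (put xs n y) n ≡ y
  nth-put d (x ∷ xs) zero    y p       = refl
  nth-put d (x ∷ xs) (suc n) y (s≤s p) = nth-put d xs n y p

  nth-put-≢ : ∀ d (xs : List X) n k y → n ≢ k → nth d (put xs n y) k ≡ nth d xs k
  nth-put-≢ d []       n       k       y n≢k = refl
  nth-put-≢ d (x ∷ xs) zero    zero    y n≢k = contradiction refl n≢k
  nth-put-≢ d (x ∷ xs) zero    (suc k) y n≢k = refl
  nth-put-≢ d (x ∷ xs) (suc n) zero    y n≢k = refl
  nth-put-≢ d (x ∷ xs) (suc n) (suc k) y n≢k = nth-put-≢ d xs n k y (n≢k ∘ cong suc)

upd : (ℕ → ℕ) → ℕ → ℕ → ℕ → ℕ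
upd f i y j = if i ≡ᵇ j then y else f j

upd-≡ : ∀ f i y → upd f i y i ≡ y
upd-≡ f i y with i ≡ᵇ i in eq
... | true  = refl
... | false = ⊥-elim (subst T eq (≡⇒≡ᵇ i i refl))

upd-≢ : ∀ f i y j → i ≢ j → upd f i y j ≡ f j
upd-≢ f i y j i≢j with i ≡ᵇ j in eq
... | true  = ⊥-elim (i≢j (≡ᵇ⇒≡ i j (subst T (sym eq) tt)))
... | false = refl

[q*n+x]/n≡q : ∀ q n {x} .{{_ : NonZero n}} → x < n → (q * n + x) / n ≡ q
[q*n+x]/n≡q q n {x} x<n = begin
  (q * n + x) / n       ≡⟨ +-distrib-/ (q * n) x small ⟩
  q * n / n + x / n     ≡⟨ cong₂ _+_ (m*n/n≡m q n) (m<n⇒m/n≡0 x<n) ⟩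
  q + 0                 ≡⟨ +-identityʳ q ⟩
  q                     ∎
  where
  open ≡-Reasoning
  small : q * n % n + x % n < n
  small = subst (λ z → z + x % n < n) (sym (m*n%n≡0 q n)) (m%n<n x n)

[q*n+x]%n≡x : ∀ q n {x} .{{_ : NonZero n}} → x < n → (q * n + x) % n ≡ x
[q*n+x]%n≡x q n {x} x<n =
  trans (cong (_% n) (+-comm (q * n) x)) (trans ([m+kn]%n≡m%n x q n) (m<n⇒m%n≡m x<n))

-- Expressions and commands, and their translation to word RAM programs

infixl 6 _⊕_ _⊖_
infixl 7 _⊗_ _⊘_ _⊙_
infixl 8 _≫_
infix  9 _⟦_⟧

data Exp : Set where
  var  : Reg → Exp
  num  : ℕ → Exp
  op   : BinOp → Exp → Exp → Exp
  _⟦_⟧ : ℕ → Exp → Exp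

_⊕_ _⊖_ _⊗_ _⊘_ _⊙_ _≫_ : Exp → Exp → Exp
_⊕_ = op add
_⊖_ = op sub
_⊗_ = op mul
_⊘_ = op div
_⊙_ = op mod
_≫_ = op shr

pow2 : Exp → Exp
pow2 e = op shl (num 1) e

-- Registers below this bound hold program variables, those from it on are
-- scratch space for the evaluation of expressions.
numVars : ℕ
numVars = 17

strideReg : Reg
strideReg = 2

address : ℕ → Exp → Exp
address q e = num q ⊗ var strideReg ⊕ e

-- The registers from `k` on act as a stack: a left operand waits in `k` while the right one is
-- computed from `suc k` on.
compile : Exp → Reg → Program
compile (var r)      k = k ≔ val (reg r)
compile (num n)      k = k ≔ val (lit n)
compile (op o e₁ e₂) k = compile e₁ k ⨟ compile e₂ (suc k) ⨟ k ≔ bin o (reg k) (reg (suc k))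
compile (q ⟦ e ⟧)    k = ((k ≔ val (lit q)) ⨟ (suc k ≔ val (reg strideReg)) ⨟ (k ≔ bin mul (reg k) (reg (suc k))))
                         ⨟ compile e (suc k)
                         ⨟ (k ≔ bin add (reg k) (reg (suc k)))
                         ⨟ k ≔ load (reg k)

-- The sums are nested as the sequencing in `compile` is, so that derivations have this step count
-- by computation.
cost : Exp → ℕ
cost (var r)      = 1
cost (num n)      = 1
cost (op o e₁ e₂) = cost e₁ + (cost e₂ + 1)
cost (q ⟦ e ⟧)    = 3 + (cost e + 2)

infixr 4 _⨾_
infix 5 _←_ _⟦_⟧←_
infix 3 test_<_then_else_ while_<_repeat_

-- A loop compares two variables, because the machine repeats only the bare test before each round
-- and would not recompute an expression.
data Cmd : Set where
  pass                 : Cmd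
  _←_                  : Reg → Exp → Cmd
  _⟦_⟧←_               : ℕ → Exp → Exp → Cmd
  _⨾_                  : Cmd → Cmd → Cmd
  test_<_then_else_    : Exp → Exp → Cmd → Cmd → Cmd
  while_<_repeat_      : Reg → Reg → Cmd → Cmd

code : Cmd → Program
code pass                        = skip
code (r ← e)                     = compile e numVars ⨟ r ≔ val (reg numVars)
code (q ⟦ i ⟧← e)                = compile (address q i) numVars ⨟ compile e (suc numVars)
                                   ⨟ store (reg numVars) (reg (suc numVars))
code (c ⨾ d)                     = code c ⨟ code d
code (test e₁ < e₂ then c else d) = compile e₁ numVars ⨟ compile e₂ (suc numVars)
                                   ⨟ ifte (less (reg numVars) (reg (suc numVars))) (code c) (code d)
code (while a < b repeat c)      = while (less (reg a) (reg b)) (code c)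

-- An abstract machine with unbounded registers and separate arrays

record AState : Set where
  constructor ⟪_,_,_⟫
  field
    vars   : List ℕ
    arrays : List (ℕ → ℕ)
    clock  : ℕ

open AState

var# : AState → ℕ → ℕ
var# s = nth 0 (vars s)

array# : AState → ℕ → ℕ → ℕ
array# s = nth (const 0) (arrays s)

evalOp : BinOp → ℕ → ℕ → ℕ
evalOp add x y = x + y
evalOp sub x y = x ∸ y
evalOp mul x y = x * y
evalOp div x y = x /₀ y
evalOp mod x y = x %₀ y
evalOp shl x y = x * 2 ^ y
evalOp shr x y = x /₀ 2 ^ y
evalOp _   x y = 0

eval : Exp → AState → ℕ
eval (var r)      s = var# s r
eval (num n)      s = n
eval (op o e₁ e₂) s = evalOp o (eval e₁ s) (eval e₂ s)
eval (q ⟦ e ⟧)    s = array# s q (eval e s)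

-- Variables and arrays are kept in lists so that updates of a state written out in full compute,
-- and untouched entries need no argument.
setVar : ℕ → ℕ → AState → AState
setVar r v ⟪ rs , as , t ⟫ = ⟪ put rs r v , as , t ⟫

setCell : ℕ → ℕ → ℕ → AState → AState
setCell q i v ⟪ rs , as , t ⟫ = ⟪ rs , put as q (upd (nth (const 0) as q) i v) , t ⟫

tick : ℕ → AState → AState
tick c ⟪ rs , as , t ⟫ = ⟪ rs , as , c + t ⟫

/₀-≤ : ∀ x y → x /₀ y ≤ x
/₀-≤ x zero    = z≤n
/₀-≤ x (suc y) = m/n≤m x (suc y)

%₀-≤ : ∀ x y → x %₀ y ≤ x
%₀-≤ x zero    = z≤n
%₀-≤ x (suc y) = m%n≤m x (suc y)

-- Correctness of the translation, and rules for proving runs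

module Simulation (w Z : ℕ) where

  -- Conditions under which word arithmetic agrees with `evalOp`. Quotients, remainders and right
  -- shifts cannot overflow; the bitwise operations, which `evalOp` does not model, are excluded.
  SafeOp : BinOp → ℕ → ℕ → Set
  SafeOp add x y = x + y < 2 ^ w
  SafeOp sub x y = y ≤ x
  SafeOp mul x y = x * y < 2 ^ w
  SafeOp div x y = ⊤
  SafeOp mod x y = ⊤
  SafeOp shl x y = x * 2 ^ y < 2 ^ w
  SafeOp shr x y = ⊤
  SafeOp _   x y = ⊥

  Safe : Exp → AState → Set
  Safe (var r)      s = T (r <ᵇ numVars)
  Safe (num n)      s = n < 2 ^ w
  Safe (op o e₁ e₂) s = Safe e₁ s × Safe e₂ s × SafeOp o (eval e₁ s) (eval e₂ s)
  Safe (q ⟦ e ⟧)    s = T (q <ᵇ length (arrays s)) × var# s strideReg ≡ Z × Safe e s × eval e s < Z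

  infix 4 _≈_

  -- Array `q` starts at cell `q * Z`, so array 0 lies where the input is. Registers from `numVars`
  -- on are unconstrained, which makes scratch work invisible.
  record _≈_ (σ : State w) (s : AState) : Set where
    field
      vars-length : length (vars s) ≡ numVars
      vars-eq     : ∀ r → r < numVars → toℕ (regs σ r) ≡ var# s r
      space       : length (arrays s) * Z ≤ 2 ^ w
      cells-eq    : ∀ q x → q < length (arrays s) → x < Z →
                    toℕ (mem σ (word w (q * Z + x))) ≡ array# s q x

  open _≈_

  toℕ-word : ∀ n → n < 2 ^ w → toℕ (word w n) ≡ n
  toℕ-word n n<W = trans (toℕ-fromℕ< _) (m<n⇒m%n≡m {{m^n≢0 2 w}} n<W)

  word-toℕ : ∀ x → word w (toℕ x) ≡ x
  word-toℕ x = toℕ-injective (toℕ-word (toℕ x) (toℕ<n x))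

  op-correct : ∀ o (a b : Word w) → SafeOp o (toℕ a) (toℕ b) →
               toℕ (⟦ o ⟧ᵒ w a b) ≡ evalOp o (toℕ a) (toℕ b)
  op-correct add a b p = toℕ-word _ p
  op-correct sub a b p = begin
    toℕ (word w (x + (W ∸ y)))     ≡⟨ toℕ-fromℕ< _ ⟩
    (x + (W ∸ y)) % W              ≡⟨ cong (_% W) eq ⟩
    (x ∸ y + W) % W                ≡⟨ [m+n]%n≡m%n (x ∸ y) W ⟩
    (x ∸ y) % W                    ≡⟨ m<n⇒m%n≡m (≤-<-trans (m∸n≤m x y) (toℕ<n a)) ⟩
    x ∸ y                          ∎
    where
    open ≡-Reasoning
    W = 2 ^ w
    x = toℕ a
    y = toℕ b
    instance
      W≢0 : NonZero W
      W≢0 = m^n≢0 2 w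
    eq : x + (W ∸ y) ≡ x ∸ y + W
    eq = trans (sym (+-∸-assoc x (<⇒≤ (toℕ<n b)))) (trans (cong (_∸ y) (+-comm x W))
           (trans (+-∸-assoc W p) (+-comm W (x ∸ y))))
  op-correct mul a b p = toℕ-word _ p
  op-correct div a b p = toℕ-word _ (≤-<-trans (/₀-≤ (toℕ a) (toℕ b)) (toℕ<n a))
  op-correct mod a b p = toℕ-word _ (≤-<-trans (%₀-≤ (toℕ a) (toℕ b)) (toℕ<n a))
  op-correct shl a b p = toℕ-word _ p
  op-correct shr a b p = toℕ-word _ (≤-<-trans (/₀-≤ (toℕ a) (2 ^ toℕ b)) (toℕ<n a))

  setReg-≡ : ∀ r x (σ : State w) → regs (setReg r x σ) r ≡ x
  setReg-≡ r x σ with r ≡ᵇ r in eq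
  ... | true  = refl
  ... | false = ⊥-elim (subst T eq (≡⇒≡ᵇ r r refl))

  setReg-≢ : ∀ r x (σ : State w) r′ → r ≢ r′ → regs (setReg r x σ) r′ ≡ regs σ r′
  setReg-≢ r x σ r′ r≢r′ with r ≡ᵇ r′ in eq
  ... | true  = ⊥-elim (r≢r′ (≡ᵇ⇒≡ r r′ (subst T (sym eq) tt)))
  ... | false = refl

  infix 4 _⊑[_]_

  _⊑[_]_ : State w → ℕ → State w → Set
  σ ⊑[ k ] σ′ = mem σ′ ≡ mem σ × (∀ r → r < k → regs σ′ r ≡ regs σ r)

  ⊑-trans : ∀ {σ₁ σ₂ σ₃ k l} → k ≤ l → σ₁ ⊑[ k ] σ₂ → σ₂ ⊑[ l ] σ₃ → σ₁ ⊑[ k ] σ₃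
  ⊑-trans k≤l (p , f) (q , g) =
    trans q p , λ r r<k → trans (g r (<-≤-trans r<k k≤l)) (f r r<k)

  ⊑-setReg : ∀ r x (σ : State w) → σ ⊑[ r ] setReg r x σ
  ⊑-setReg r x σ = refl , λ r′ r′<r → setReg-≢ r x σ r′ (λ eq → <-irrefl (sym eq) r′<r)

  ≈-⊑ : ∀ {σ σ′ s k} → numVars ≤ k → σ ⊑[ k ] σ′ → σ ≈ s → σ′ ≈ s
  ≈-⊑ n≤k (m≡ , r≡) σ≈s = record
    { vars-length = vars-length σ≈s
    ; vars-eq     = λ r r< → trans (cong toℕ (r≡ r (<-≤-trans r< n≤k))) (vars-eq σ≈s r r<)
    ; space       = space σ≈s
    ; cells-eq    = λ q x q< x< → trans (cong (λ f → toℕ (f _)) m≡) (cells-eq σ≈s q x q< x<)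
    }

  address-bound : ∀ {q x l} → q < l → x < Z → l * Z ≤ 2 ^ w → q * Z + x < 2 ^ w
  address-bound {q} {x} {l} q<l x<Z l*Z≤W = begin-strict
    q * Z + x   <⟨ +-monoʳ-< (q * Z) x<Z ⟩
    q * Z + Z   ≡⟨ +-comm (q * Z) Z ⟩
    suc q * Z   ≤⟨ *-monoˡ-≤ Z q<l ⟩
    l * Z       ≤⟨ l*Z≤W ⟩
    2 ^ w       ∎
    where open ≤-Reasoning

  compile-correct : ∀ e k σ s → numVars ≤ k → σ ≈ s → Safe e s →
    Σ[ σ′ ∈ State w ] (⟨ compile e k , σ ⟩⇓[ cost e ] σ′) × σ ⊑[ k ] σ′ × toℕ (regs σ′ k) ≡ eval e s
  compile-correct (var r) k σ s n≤k σ≈s safe =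
    _ , assign⇓ , ⊑-setReg k _ σ ,
    trans (cong toℕ (setReg-≡ k _ σ)) (vars-eq σ≈s r (<ᵇ⇒< r numVars safe))
  compile-correct (num n) k σ s n≤k σ≈s safe =
    _ , assign⇓ , ⊑-setReg k _ σ , trans (cong toℕ (setReg-≡ k _ σ)) (toℕ-word n safe)
  compile-correct (op o e₁ e₂) k σ s n≤k σ≈s (safe₁ , safe₂ , safe)
    with compile-correct e₁ k σ s n≤k σ≈s safe₁
  ... | σ₁ , run₁ , ext₁ , eq₁
    with compile-correct e₂ (suc k) σ₁ s (m≤n⇒m≤1+n n≤k) (≈-⊑ n≤k ext₁ σ≈s) safe₂
  ... | σ₂ , run₂ , ext₂ , eq₂ =
    _ , seq⇓ run₁ (seq⇓ run₂ assign⇓) ,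
    ⊑-trans ≤-refl (⊑-trans (n≤1+n k) ext₁ ext₂) (⊑-setReg k _ σ₂) ,
    (begin
      toℕ (regs (setReg k (⟦ o ⟧ᵒ w (regs σ₂ k) (regs σ₂ (suc k))) σ₂) k)
        ≡⟨ cong toℕ (setReg-≡ k _ σ₂) ⟩
      toℕ (⟦ o ⟧ᵒ w (regs σ₂ k) (regs σ₂ (suc k)))
        ≡⟨ op-correct o _ _ (subst₂ (SafeOp o) (sym eq₁′) (sym eq₂) safe) ⟩
      evalOp o (toℕ (regs σ₂ k)) (toℕ (regs σ₂ (suc k)))
        ≡⟨ cong₂ (evalOp o) eq₁′ eq₂ ⟩
      evalOp o (eval e₁ s) (eval e₂ s) ∎)
    where
    open ≡-Reasoning
    eq₁′ : toℕ (regs σ₂ k) ≡ eval e₁ s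
    eq₁′ = trans (cong toℕ (proj₂ ext₂ k (n<1+n k))) eq₁
  compile-correct (q ⟦ e ⟧) k σ s n≤k σ≈s (q< , Z≡ , safe , i<Z)
    with compile-correct e (suc k) _ s (m≤n⇒m≤1+n n≤k) (≈-⊑ n≤k base-⊑ σ≈s) safe
    where
    σ₁ = setReg k (word w q) σ
    σ₂ = setReg (suc k) (regs σ₁ strideReg) σ₁
    σ₃ = setReg k (word w (toℕ (regs σ₂ k) * toℕ (regs σ₂ (suc k)))) σ₂
    base-⊑ : σ ⊑[ k ] σ₃
    base-⊑ = ⊑-trans ≤-refl (⊑-trans (n≤1+n k) (⊑-setReg k _ σ) (⊑-setReg (suc k) _ σ₁)) (⊑-setReg k _ σ₂)
  ... | σ₄ , run , ext , eq =
    _ , seq⇓ (seq⇓ assign⇓ (seq⇓ assign⇓ assign⇓)) (seq⇓ run (seq⇓ assign⇓ assign⇓)) ,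
    ⊑-trans ≤-refl (⊑-trans ≤-refl (⊑-trans (n≤1+n k) base-⊑ ext) (⊑-setReg k _ σ₄)) (⊑-setReg k _ σ₅) ,
    (begin
      toℕ (regs (setReg k (mem σ₅ (regs σ₅ k)) σ₅) k)
        ≡⟨ cong toℕ (setReg-≡ k _ σ₅) ⟩
      toℕ (mem σ₄ (regs σ₅ k))
        ≡⟨ cong (λ f → toℕ (f (regs σ₅ k))) (proj₁ ext) ⟩
      toℕ (mem σ (regs σ₅ k))
        ≡⟨ cong (λ a → toℕ (mem σ a)) (trans (setReg-≡ k _ σ₄) (cong (word w) (cong₂ _+_ eq-base eq))) ⟩
      toℕ (mem σ (word w (q * Z + eval e s)))
        ≡⟨ cells-eq σ≈s q (eval e s) (<ᵇ⇒< q _ q<) i<Z ⟩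
      array# s q (eval e s) ∎)
    where
    open ≡-Reasoning
    σ₁ = setReg k (word w q) σ
    σ₂ = setReg (suc k) (regs σ₁ strideReg) σ₁
    σ₃ = setReg k (word w (toℕ (regs σ₂ k) * toℕ (regs σ₂ (suc k)))) σ₂
    σ₅ = setReg k (word w (toℕ (regs σ₄ k) + toℕ (regs σ₄ (suc k)))) σ₄
    base-⊑ : σ ⊑[ k ] σ₃
    base-⊑ = ⊑-trans ≤-refl (⊑-trans (n≤1+n k) (⊑-setReg k _ σ) (⊑-setReg (suc k) _ σ₁)) (⊑-setReg k _ σ₂)
    bound : q * Z + eval e s < 2 ^ w
    bound = address-bound (<ᵇ⇒< q (length (arrays s)) q<) i<Z (space σ≈s)
    q*Z<W : q * Z < 2 ^ w
    q*Z<W = ≤-<-trans (m≤m+n _ _) bound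
    stride : toℕ (regs σ₁ strideReg) ≡ Z
    stride = trans (vars-eq (≈-⊑ n≤k (⊑-setReg k _ σ) σ≈s) strideReg (s≤s (s≤s (s≤s z≤n)))) Z≡
    q≤q*Z : q ≤ q * Z
    q≤q*Z = subst (_≤ q * Z) (*-identityʳ q) (*-monoʳ-≤ q (≤-trans (s≤s z≤n) i<Z))
    eq-q : toℕ (regs σ₂ k) ≡ q
    eq-q = trans (cong toℕ (trans (setReg-≢ (suc k) _ σ₁ k 1+n≢n) (setReg-≡ k _ σ)))
                 (toℕ-word q (≤-<-trans q≤q*Z q*Z<W))
    eq-mul : toℕ (regs σ₂ k) * toℕ (regs σ₂ (suc k)) ≡ q * Z
    eq-mul = cong₂ _*_ eq-q (trans (cong toℕ (setReg-≡ (suc k) _ σ₁)) stride)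
    eq-base : toℕ (regs σ₄ k) ≡ q * Z
    eq-base = trans (cong toℕ (trans (proj₂ ext k (n<1+n k)) (setReg-≡ k _ σ₂)))
                (trans (cong (toℕ ∘ word w) eq-mul) (toℕ-word _ q*Z<W))

  -- The clock need only bound the steps from above, so time estimates are part of the postcondition
  -- on the abstract state.
  Reaches : Cmd → AState → (AState → Set) → State w → Set
  Reaches P s Q σ = Σ[ σ′ ∈ State w ] ∃[ t ] Σ[ s′ ∈ AState ]
    (⟨ code P , σ ⟩⇓[ t ] σ′) × σ′ ≈ s′ × t + clock s ≤ clock s′ × Q s′

  record Run (P : Cmd) (s : AState) (Q : AState → Set) : Set where
    constructor running
    field reaches : ∀ σ → σ ≈ s → Reaches P s Q σ

  open Run public

  -- The postcondition of the first command is that the rest runs. A proof about a program thus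
  -- becomes a chain of rules in program order.
  run-seq : ∀ {P P′ s Q} → Run P s (λ s′ → Run P′ s′ Q) → Run (P ⨾ P′) s Q
  run-seq {s = s} run = running λ σ σ≈s →
    let σ₁ , t₁ , s₁ , exec₁ , rel₁ , time₁ , run₂ = reaches run σ σ≈s
        σ₂ , t₂ , s₂ , exec₂ , rel₂ , time₂ , q = reaches run₂ σ₁ rel₁
    in σ₂ , t₁ + t₂ , s₂ , seq⇓ exec₁ exec₂ , rel₂ ,
       subst (_≤ clock s₂) (trans (sym (+-assoc t₂ t₁ _)) (cong (_+ clock s) (+-comm t₂ t₁)))
         (≤-trans (+-monoʳ-≤ t₂ time₁) time₂) , q

  tick-≈ : ∀ {σ s} c → σ ≈ s → σ ≈ tick c s
  tick-≈ c σ≈s = record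
    { vars-length = vars-length σ≈s ; vars-eq = vars-eq σ≈s
    ; space = space σ≈s ; cells-eq = cells-eq σ≈s }

  run-pass : ∀ {s Q} → Q (tick 1 s) → Run pass s Q
  run-pass {s} q = running λ σ σ≈s → σ , 1 , tick 1 s , skip⇓ , tick-≈ 1 σ≈s , ≤-refl , q

  setVar-≈ : ∀ {σ s} r x v → r < numVars → toℕ x ≡ v → σ ≈ s → setReg r x σ ≈ setVar r v s
  setVar-≈ {σ} {s} r x v r< x≡v σ≈s = record
    { vars-length = trans (length-put (vars s) r v) (vars-length σ≈s)
    ; vars-eq = eq
    ; space = space σ≈s
    ; cells-eq = cells-eq σ≈s
    }
    where
    eq : ∀ r′ → r′ < numVars → toℕ (regs (setReg r x σ) r′) ≡ nth 0 (put (vars s) r v) r′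
    eq r′ r′< with r ≟ r′
    ... | yes refl = trans (cong toℕ (setReg-≡ r x σ))
          (trans x≡v (sym (nth-put 0 (vars s) r v (subst (r <_) (sym (vars-length σ≈s)) r<))))
    ... | no r≢r′ = trans (cong toℕ (setReg-≢ r x σ r′ r≢r′))
          (trans (vars-eq σ≈s r′ r′<) (sym (nth-put-≢ 0 (vars s) r r′ v r≢r′)))

  -- The value `v` is separate from the expression so that the next state can display it in its
  -- mathematical form.
  run-← : ∀ {r e s Q} → Safe e s → ∀ v → eval e s ≡ v → T (r <ᵇ numVars) →
           Q (tick (suc (cost e)) (setVar r v s)) → Run (r ← e) s Q
  run-← {r} {e} {s} safe v refl r< q = running λ σ σ≈s →
    let σ₁ , exec , ext , eq = compile-correct e numVars σ s ≤-refl σ≈s safe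
    in _ , cost e + 1 , _ , seq⇓ exec assign⇓ ,
       tick-≈ _ (setVar-≈ r (regs σ₁ numVars) v (<ᵇ⇒< r numVars r<) eq (≈-⊑ ≤-refl ext σ≈s)) ,
       ≤-reflexive (cong (_+ clock s) (+-comm (cost e) 1)) , q

  -- Quotient and remainder by `Z` recover the array and the index, as long as no address wraps
  -- around. Hence a store changes a single abstract cell.
  address-injective : ∀ {q x q′ x′} → x < Z → x′ < Z → q * Z + x < 2 ^ w → q′ * Z + x′ < 2 ^ w →
                      word w (q * Z + x) ≡ word w (q′ * Z + x′) → q ≡ q′ × x ≡ x′
  address-injective {q} {x} {q′} {x′} x<Z x′<Z b b′ eq =
    trans (sym ([q*n+x]/n≡q q Z x<Z)) (trans (cong (_/ Z) eqℕ) ([q*n+x]/n≡q q′ Z x′<Z)) ,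
    trans (sym ([q*n+x]%n≡x q Z x<Z)) (trans (cong (_% Z) eqℕ) ([q*n+x]%n≡x q′ Z x′<Z))
    where
    instance
      Z≢0 : NonZero Z
      Z≢0 = >-nonZero (≤-trans (s≤s z≤n) x<Z)
    eqℕ : q * Z + x ≡ q′ * Z + x′
    eqℕ = trans (sym (toℕ-word _ b)) (trans (cong toℕ eq) (toℕ-word _ b′))

  setCell-≈ : ∀ {σ s} q i (y : Word w) v → q < length (arrays s) → i < Z → toℕ y ≡ v → σ ≈ s →
              setMem (word w (q * Z + i)) y σ ≈ setCell q i v s
  setCell-≈ {σ} {s} q i y v q< i<Z y≡v σ≈s = record
    { vars-length = vars-length σ≈s
    ; vars-eq = vars-eq σ≈s
    ; space = subst (λ l → l * Z ≤ 2 ^ w) (sym len) (space σ≈s)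
    ; cells-eq = λ q′ x q′< x<Z → eq q′ x (subst (q′ <_) len q′<) x<Z
    }
    where
    open ≡-Reasoning
    f = nth (const 0) (arrays s) q
    len : length (put (arrays s) q (upd f i v)) ≡ length (arrays s)
    len = length-put (arrays s) q _
    a = word w (q * Z + i)
    eq : ∀ q′ x → q′ < length (arrays s) → x < Z →
         toℕ (updateAt (mem σ) a (const y) (word w (q′ * Z + x)))
         ≡ nth (const 0) (put (arrays s) q (upd f i v)) q′ x
    eq q′ x q′< x<Z with q ≟ q′
    ... | no q≢q′ = trans
          (cong toℕ (updateAt-minimal (word w (q′ * Z + x)) a (mem σ)
            (λ e → q≢q′ (sym (proj₁ (address-injective x<Z i<Z
              (address-bound q′< x<Z (space σ≈s)) (address-bound q< i<Z (space σ≈s)) e))))))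
          (trans (cells-eq σ≈s q′ x q′< x<Z)
            (cong (_$ x) (sym (nth-put-≢ (const 0) (arrays s) q q′ _ q≢q′))))
    ... | yes refl with i ≟ x
    ...   | yes refl = begin
            toℕ (updateAt (mem σ) a (const y) a)    ≡⟨ cong toℕ (updateAt-updates a (mem σ)) ⟩
            toℕ y                                   ≡⟨ y≡v ⟩
            v                                       ≡⟨ upd-≡ f i v ⟨
            upd f i v i                             ≡⟨ cong (_$ i) (nth-put (const 0) (arrays s) q _ q<) ⟨
            nth (const 0) (put (arrays s) q (upd f i v)) q i ∎
    ...   | no i≢x = begin
            toℕ (updateAt (mem σ) a (const y) (word w (q * Z + x)))
              ≡⟨ cong toℕ (updateAt-minimal (word w (q * Z + x)) a (mem σ)
                   (λ e → i≢x (sym (proj₂ (address-injective {q} {x} {q} x<Z i<Z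
                     (address-bound q′< x<Z (space σ≈s)) (address-bound q< i<Z (space σ≈s)) e))))) ⟩
            toℕ (mem σ (word w (q * Z + x)))        ≡⟨ cells-eq σ≈s q x q′< x<Z ⟩
            f x                                     ≡⟨ upd-≢ f i v x i≢x ⟨
            upd f i v x                             ≡⟨ cong (_$ x) (nth-put (const 0) (arrays s) q _ q<) ⟨
            nth (const 0) (put (arrays s) q (upd f i v)) q x ∎

  store-reaches : ∀ {q e₁ e₂ s Q} → Safe (q ⟦ e₁ ⟧) s → Safe e₂ s →
             ∀ i → eval e₁ s ≡ i → ∀ v → eval e₂ s ≡ v →
             Q (tick (cost e₁ + cost e₂ + 5) (setCell q i v s)) → ∀ σ → σ ≈ s → Reaches (q ⟦ e₁ ⟧← e₂) s Q σ
  store-reaches {q} {e₁} {e₂} {s} {Q} (q< , Z≡ , safe₁ , i<Z) safe₂ i refl v refl goal σ σ≈s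
    with compile-correct (address q e₁) numVars σ s ≤-refl σ≈s
           ( (≤-<-trans q≤q*Z q*Z<W , tt , subst (λ z → q * z < 2 ^ w) (sym Z≡) q*Z<W) , safe₁
           , subst (λ z → q * z + eval e₁ s < 2 ^ w) (sym Z≡) bound)
    where
    bound : q * Z + eval e₁ s < 2 ^ w
    bound = address-bound (<ᵇ⇒< q (length (arrays s)) q<) i<Z (space σ≈s)
    q*Z<W : q * Z < 2 ^ w
    q*Z<W = ≤-<-trans (m≤m+n _ _) bound
    q≤q*Z : q ≤ q * Z
    q≤q*Z = subst (_≤ q * Z) (*-identityʳ q) (*-monoʳ-≤ q (≤-trans (s≤s z≤n) i<Z))
  ... | σ₁ , exec₁ , ext₁ , eq₁
    with compile-correct e₂ (suc numVars) σ₁ s (n≤1+n _) (≈-⊑ ≤-refl ext₁ σ≈s) safe₂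
  ... | σ₂ , exec₂ , ext₂ , eq₂ =
    _ , _ , _ , seq⇓ exec₁ (seq⇓ exec₂ store⇓) , rel , ≤-reflexive time , goal
    where
    addr : regs σ₂ numVars ≡ word w (q * Z + eval e₁ s)
    addr = trans (proj₂ ext₂ numVars ≤-refl) (trans (sym (word-toℕ _))
             (cong (word w) (trans eq₁ (cong (λ z → q * z + eval e₁ s) Z≡))))
    rel : setMem (regs σ₂ numVars) (regs σ₂ (suc numVars)) σ₂
          ≈ tick (cost e₁ + cost e₂ + 5) (setCell q (eval e₁ s) (eval e₂ s) s)
    rel = subst (λ a → setMem a (regs σ₂ (suc numVars)) σ₂ ≈ _) (sym addr)
            (tick-≈ _ (setCell-≈ q (eval e₁ s) _ _ (<ᵇ⇒< q _ q<) i<Z eq₂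
              (≈-⊑ ≤-refl (⊑-trans (n≤1+n _) ext₁ ext₂) σ≈s)))
    time : (3 + (cost e₁ + 1)) + (cost e₂ + 1) + clock s ≡ cost e₁ + cost e₂ + 5 + clock s
    time = cong (_+ clock s) (begin
      3 + (cost e₁ + 1) + (cost e₂ + 1)   ≡⟨ +-assoc 3 (cost e₁ + 1) (cost e₂ + 1) ⟩
      3 + (cost e₁ + 1 + (cost e₂ + 1))   ≡⟨ cong (3 +_) (+-assoc (cost e₁) 1 _) ⟩
      3 + (cost e₁ + suc (cost e₂ + 1))   ≡⟨ cong (λ z → 3 + (cost e₁ + suc z)) (+-comm (cost e₂) 1) ⟩
      3 + (cost e₁ + (2 + cost e₂))       ≡⟨ cong (λ z → 3 + (cost e₁ + z)) (+-comm 2 (cost e₂)) ⟩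
      3 + (cost e₁ + (cost e₂ + 2))       ≡⟨ cong (3 +_) (sym (+-assoc (cost e₁) (cost e₂) 2)) ⟩
      3 + (cost e₁ + cost e₂ + 2)         ≡⟨ +-comm 3 _ ⟩
      cost e₁ + cost e₂ + 2 + 3           ≡⟨ +-assoc (cost e₁ + cost e₂) 2 3 ⟩
      cost e₁ + cost e₂ + 5               ∎)
      where open ≡-Reasoning

  run-⟦⟧← : ∀ {q e₁ e₂ s Q} → Safe (q ⟦ e₁ ⟧) s → Safe e₂ s →
             ∀ i → eval e₁ s ≡ i → ∀ v → eval e₂ s ≡ v →
             Q (tick (cost e₁ + cost e₂ + 5) (setCell q i v s)) → Run (q ⟦ e₁ ⟧← e₂) s Q
  run-⟦⟧← {q} {e₁} {e₂} safe₁ safe₂ i eq₁ v eq₂ goal =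
    running (store-reaches {q} {e₁} {e₂} safe₁ safe₂ i eq₁ v eq₂ goal)

  test-reaches : ∀ {e₁ e₂ P₁ P₂ s Q} → Safe e₁ s → Safe e₂ s →
           ∀ x → eval e₁ s ≡ x → ∀ y → eval e₂ s ≡ y →
           (x < y → Run P₁ (tick (cost e₁ + cost e₂ + 1) s) Q) →
           (y ≤ x → Run P₂ (tick (cost e₁ + cost e₂ + 1) s) Q) →
           ∀ σ → σ ≈ s → Reaches (test e₁ < e₂ then P₁ else P₂) s Q σ
  test-reaches {e₁} {e₂} {P₁} {P₂} {s} {Q} safe₁ safe₂ x refl y refl k₁ k₂ σ σ≈s
    with compile-correct e₁ numVars σ s ≤-refl σ≈s safe₁
  ... | σ₁ , exec₁ , ext₁ , eq₁
    with compile-correct e₂ (suc numVars) σ₁ s (n≤1+n _) (≈-⊑ ≤-refl ext₁ σ≈s) safe₂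
  ... | σ₂ , exec₂ , ext₂ , eq₂ = go (eval e₁ s <? eval e₂ s)
    where
    C = cost e₁ + cost e₂ + 1
    rel : σ₂ ≈ tick C s
    rel = tick-≈ C (≈-⊑ ≤-refl (⊑-trans (n≤1+n _) ext₁ ext₂) σ≈s)
    eq₁′ : toℕ (regs σ₂ numVars) ≡ eval e₁ s
    eq₁′ = trans (cong toℕ (proj₂ ext₂ numVars ≤-refl)) eq₁
    time : ∀ {t t′} → t + clock (tick C s) ≤ t′ → cost e₁ + (cost e₂ + suc t) + clock s ≤ t′
    time {t} le = ≤-trans (≤-reflexive (begin
      cost e₁ + (cost e₂ + suc t) + clock s   ≡⟨ cong (_+ clock s) (sym (+-assoc (cost e₁) (cost e₂) (suc t))) ⟩
      cost e₁ + cost e₂ + suc t + clock s     ≡⟨ cong (_+ clock s) (sym (+-assoc (cost e₁ + cost e₂) 1 t)) ⟩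
      C + t + clock s                         ≡⟨ cong (_+ clock s) (+-comm C t) ⟩
      t + C + clock s                         ≡⟨ +-assoc t C (clock s) ⟩
      t + (C + clock s)                       ∎)) le
      where open ≡-Reasoning
    go : _ → Reaches (test e₁ < e₂ then P₁ else P₂) s Q σ
    go (yes p) =
      let σ′ , t , s′ , exec , rel′ , le , q = reaches (k₁ p) σ₂ rel
      in σ′ , _ , s′ ,
         seq⇓ exec₁ (seq⇓ exec₂ (then⇓ (<ᵇ-true (subst₂ _<_ (sym eq₁′) (sym eq₂) p)) exec)) ,
         rel′ , time le , q
    go (no ¬p) =
      let σ′ , t , s′ , exec , rel′ , le , q = reaches (k₂ (≮⇒≥ ¬p)) σ₂ rel
      in σ′ , _ , s′ ,
         seq⇓ exec₁ (seq⇓ exec₂ (else⇓ (<ᵇ-false (subst₂ _≤_ (sym eq₂) (sym eq₁′) (≮⇒≥ ¬p))) exec)) ,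
         rel′ , time le , q

  run-if : ∀ {e₁ e₂ P₁ P₂ s Q} → Safe e₁ s → Safe e₂ s →
           ∀ x → eval e₁ s ≡ x → ∀ y → eval e₂ s ≡ y →
           (x < y → Run P₁ (tick (cost e₁ + cost e₂ + 1) s) Q) →
           (y ≤ x → Run P₂ (tick (cost e₁ + cost e₂ + 1) s) Q) →
           Run (test e₁ < e₂ then P₁ else P₂) s Q
  run-if {e₁} {e₂} safe₁ safe₂ x eq₁ y eq₂ k₁ k₂ =
    running (test-reaches {e₁} {e₂} safe₁ safe₂ x eq₁ y eq₂ k₁ k₂)

  -- One unrolling; the induction on the remaining rounds is left to the proof about each loop.
  run-loop : ∀ {a b P s Q} → T (a <ᵇ numVars) → T (b <ᵇ numVars) → var# s a < var# s b →
             Run P (tick 1 s) (λ s′ → Run (while a < b repeat P) s′ Q) →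
             Run (while a < b repeat P) s Q
  run-loop {a} {b} {P} {s} a< b< lt run = running λ σ σ≈s →
    let σ₁ , t₁ , s₁ , exec₁ , rel₁ , time₁ , run₂ = reaches run σ (tick-≈ 1 σ≈s)
        σ₂ , t₂ , s₂ , exec₂ , rel₂ , time₂ , q = reaches run₂ σ₁ rel₁
    in σ₂ , _ , s₂ ,
       loop⇓ (<ᵇ-true (subst₂ _<_ (sym (vars-eq σ≈s a (<ᵇ⇒< a numVars a<)))
                                  (sym (vars-eq σ≈s b (<ᵇ⇒< b numVars b<))) lt)) exec₁ exec₂ ,
       rel₂ ,
       subst (_≤ clock s₂)
         (trans (cong (t₂ +_) (+-suc t₁ (clock s)))
           (trans (+-suc t₂ (t₁ + clock s))
             (cong suc (trans (sym (+-assoc t₂ t₁ _)) (cong (_+ clock s) (+-comm t₂ t₁))))))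
         (≤-trans (+-monoʳ-≤ t₂ time₁) time₂) , q

  run-exit : ∀ {a b P s Q} → T (a <ᵇ numVars) → T (b <ᵇ numVars) → var# s b ≤ var# s a →
             Q (tick 1 s) → Run (while a < b repeat P) s Q
  run-exit {a} {b} {P} {s} a< b< ge q = running λ σ σ≈s →
    σ , 1 , tick 1 s ,
    stop⇓ (<ᵇ-false (subst₂ _≤_ (sym (vars-eq σ≈s b (<ᵇ⇒< b numVars b<)))
                                (sym (vars-eq σ≈s a (<ᵇ⇒< a numVars a<))) ge)) ,
    tick-≈ 1 σ≈s , ≤-refl , q

-- Finite sums

sumTo : (ℕ → ℕ) → ℕ → ℕ
sumTo f zero    = 0
sumTo f (suc n) = sumTo f n + f n

sumTo-cong : ∀ {f g} n → (∀ t → t < n → f t ≡ g t) → sumTo f n ≡ sumTo g n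
sumTo-cong zero    eq = refl
sumTo-cong (suc n) eq = cong₂ _+_ (sumTo-cong n (λ t t<n → eq t (m≤n⇒m≤1+n t<n))) (eq n ≤-refl)

sumTo-split : ∀ f m n → sumTo f (m + n) ≡ sumTo f m + sumTo (λ t → f (m + t)) n
sumTo-split f m zero    = trans (cong (sumTo f) (+-identityʳ m)) (sym (+-identityʳ _))
sumTo-split f m (suc n) = begin
  sumTo f (m + suc n)                                       ≡⟨ cong (sumTo f) (+-suc m n) ⟩
  sumTo f (m + n) + f (m + n)                               ≡⟨ cong (_+ f (m + n)) (sumTo-split f m n) ⟩
  sumTo f m + sumTo (λ t → f (m + t)) n + f (m + n)         ≡⟨ +-assoc (sumTo f m) _ _ ⟩
  sumTo f m + (sumTo (λ t → f (m + t)) n + f (m + n))       ∎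
  where open ≡-Reasoning

sumTo-≤ : ∀ f n c → (∀ t → f t ≤ c) → sumTo f n ≤ n * c
sumTo-≤ f zero    c f≤c = z≤n
sumTo-≤ f (suc n) c f≤c = ≤-trans (+-mono-≤ (sumTo-≤ f n c f≤c) (f≤c n)) (≤-reflexive (+-comm (n * c) c))

sumTo-mono : ∀ f {m n} → m ≤ n → sumTo f m ≤ sumTo f n
sumTo-mono f {m} {n} m≤n = subst (λ k → sumTo f m ≤ sumTo f k) (m+[n∸m]≡n m≤n)
  (subst (sumTo f m ≤_) (sym (sumTo-split f m (n ∸ m))) (m≤m+n _ _))

sumTo-+ : ∀ f g n → sumTo (λ t → f t + g t) n ≡ sumTo f n + sumTo g n
sumTo-+ f g zero    = refl
sumTo-+ f g (suc n) = trans (cong (_+ (f n + g n)) (sumTo-+ f g n))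
  (solve 4 (λ a b c d → a :+ b :+ (c :+ d) := a :+ c :+ (b :+ d)) refl (sumTo f n) (sumTo g n) (f n) (g n))
  where open +-*-Solver

sumTo-const : ∀ c n → sumTo (const c) n ≡ n * c
sumTo-const c zero    = refl
sumTo-const c (suc n) = trans (cong (_+ c) (sumTo-const c n)) (+-comm (n * c) c)

-- Bit length and population count

halvingSum′ : (ℕ → ℕ) → ℕ → ℕ → ℕ
halvingSum′ g zero       n       = 0
halvingSum′ g (suc fuel) zero    = 0
halvingSum′ g (suc fuel) (suc n) = halvingSum′ g fuel (suc n / 2) + g (suc n)

-- With weight 1 this is the bit length, with the parity as weight the population count. Fuel `n`
-- suffices since halving lowers a positive number.
halvingSum : (ℕ → ℕ) → ℕ → ℕ
halvingSum g n = halvingSum′ g n n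

half≤ : ∀ n → suc n / 2 ≤ n
half≤ n = s≤s⁻¹ (m/n<m (suc n) 2 ≤-refl)

halvingSum′-fuel : ∀ g k l n → n ≤ k → n ≤ l → halvingSum′ g k n ≡ halvingSum′ g l n
halvingSum′-fuel g zero    zero    n       p       q       = refl
halvingSum′-fuel g zero    (suc l) zero    p       q       = refl
halvingSum′-fuel g (suc k) zero    zero    p       q       = refl
halvingSum′-fuel g (suc k) (suc l) zero    p       q       = refl
halvingSum′-fuel g (suc k) (suc l) (suc n) (s≤s p) (s≤s q) =
  cong (_+ g (suc n)) (halvingSum′-fuel g k l (suc n / 2) (≤-trans (half≤ n) p) (≤-trans (half≤ n) q))

halvingSum-suc : ∀ g n → halvingSum g (suc n) ≡ halvingSum g (suc n / 2) + g (suc n)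
halvingSum-suc g n =
  cong (_+ g (suc n)) (halvingSum′-fuel g n (suc n / 2) (suc n / 2) (half≤ n) ≤-refl)

abstract

  lev pc : ℕ → ℕ
  lev = halvingSum (const 1)
  pc  = halvingSum (_% 2)

  lev-zero : lev 0 ≡ 0
  lev-zero = refl

  pc-zero : pc 0 ≡ 0
  pc-zero = refl

  lev-suc : ∀ n → lev (suc n) ≡ suc (lev (suc n / 2))
  lev-suc n = trans (halvingSum-suc (const 1) n) (+-comm _ 1)

  pc-half : ∀ n → pc n ≡ pc (n / 2) + n % 2
  pc-half zero    = refl
  pc-half (suc n) = halvingSum-suc (_% 2) n

lev≤ : ∀ k {n} → n < 2 ^ k → lev n ≤ k
lev≤ zero    {zero}  p = ≤-reflexive lev-zero
lev≤ zero    {suc n} (s≤s ())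
lev≤ (suc k) {zero}  p = subst (_≤ suc k) (sym lev-zero) z≤n
lev≤ (suc k) {suc n} p = subst (_≤ suc k) (sym (lev-suc n))
  (s≤s (lev≤ k (m<n*o⇒m/o<n {suc n} {2 ^ k} {2} (subst (suc n <_) (*-comm 2 (2 ^ k)) p))))

n<2*[1+n/2] : ∀ n → n < 2 * suc (n / 2)
n<2*[1+n/2] n = begin-strict
  n                       ≡⟨ m≡m%n+[m/n]*n n 2 ⟩
  n % 2 + n / 2 * 2       <⟨ +-monoˡ-< (n / 2 * 2) (m%n<n n 2) ⟩
  suc (n / 2) * 2         ≡⟨ *-comm (suc (n / 2)) 2 ⟩
  2 * suc (n / 2)         ∎
  where open ≤-Reasoning

<2^lev : ∀ n → n < 2 ^ lev n
<2^lev n = go n n ≤-refl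
  where
  go : ∀ fuel n → n ≤ fuel → n < 2 ^ lev n
  go fuel       zero    p       = subst (λ k → 0 < 2 ^ k) (sym lev-zero) (s≤s z≤n)
  go (suc fuel) (suc n) (s≤s p) = subst (λ k → suc n < 2 ^ k) (sym (lev-suc n))
    (<-≤-trans (n<2*[1+n/2] (suc n)) (*-monoʳ-≤ 2 (go fuel (suc n / 2) (≤-trans (half≤ n) p))))

lev-mono : ∀ {a b} → a ≤ b → lev a ≤ lev b
lev-mono {a} {b} a≤b = lev≤ (lev b) (≤-<-trans a≤b (<2^lev b))

-- The number `2 * a + 1` has one binary digit more than `a`, so every `u` beyond `2 * a` is longer
-- than `a`. Rounding to bit lengths therefore costs only a factor 2.
lev-reflects : ∀ {u a} → lev u ≤ lev a → u ≤ 2 * a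
lev-reflects {u} {a} p with u ≤? 2 * a
... | yes q = q
... | no ¬q = contradiction (≤-trans (≤-reflexive (sym eq)) (≤-trans (lev-mono (≰⇒> ¬q)) p)) (<-irrefl refl)
  where
  eq : lev (suc (2 * a)) ≡ suc (lev a)
  eq = trans (lev-suc (2 * a)) (cong (suc ∘ lev)
    (trans (cong (_/ 2) (trans (+-comm 1 (2 * a)) (cong (_+ 1) (*-comm 2 a)))) ([q*n+x]/n≡q a 2 ≤-refl)))

-- Numbers given by their binary digits

binary : (ℕ → ℕ) → ℕ → ℕ
binary f zero    = 0
binary f (suc n) = binary (f ∘ suc) n * 2 + f 0

binary-cong : ∀ {f g} n → (∀ t → t < n → f t ≡ g t) → binary f n ≡ binary g n
binary-cong zero    eq = refl
binary-cong (suc n) eq = cong₂ (λ a b → a * 2 + b) (binary-cong n (λ t t<n → eq (suc t) (s≤s t<n))) (eq 0 (s≤s z≤n))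

binary-zero : ∀ {f} n → (∀ t → t < n → f t ≡ 0) → binary f n ≡ 0
binary-zero zero    eq = refl
binary-zero (suc n) eq = cong₂ (λ a b → a * 2 + b) (binary-zero n (λ t t<n → eq (suc t) (s≤s t<n))) (eq 0 (s≤s z≤n))

-- Carries need no attention because `binary` is linear in its digits, whatever their size. This
-- merges two bit vectors by one addition.
binary-+ : ∀ f g n → binary (λ t → f t + g t) n ≡ binary f n + binary g n
binary-+ f g zero    = refl
binary-+ f g (suc n) = trans (cong (λ z → z * 2 + (f 0 + g 0)) (binary-+ (f ∘ suc) (g ∘ suc) n))
  (solve 4 (λ a b c d → (a :+ b) :* con 2 :+ (c :+ d) := a :* con 2 :+ c :+ (b :* con 2 :+ d)) refl
     (binary (f ∘ suc) n) (binary (g ∘ suc) n) (f 0) (g 0))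
  where open +-*-Solver

binary-bump : ∀ {f g} n t → t < n → g t ≡ suc (f t) → (∀ t′ → t′ < n → t′ ≢ t → g t′ ≡ f t′) →
           binary g n ≡ binary f n + 2 ^ t
binary-bump {f} {g} (suc n) zero    _       eq rest = trans
  (cong₂ (λ a b → a * 2 + b) (binary-cong n (λ t t<n → rest (suc t) (s≤s t<n) (λ ()))) eq)
  (trans (+-suc _ (f 0)) (+-comm 1 _))
binary-bump {f} {g} (suc n) (suc t) (s≤s p) eq rest = trans
  (cong₂ (λ a b → a * 2 + b)
    (binary-bump {f ∘ suc} {g ∘ suc} n t p eq (λ t′ t′<n t′≢t → rest (suc t′) (s≤s t′<n) (t′≢t ∘ suc-injective)))
    (rest 0 (s≤s z≤n) (λ ())))
  (solve 3 (λ a b c → (a :+ b) :* con 2 :+ c := a :* con 2 :+ c :+ con 2 :* b) refl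
     (binary (f ∘ suc) n) (2 ^ t) (f 0))
  where open +-*-Solver

binary< : ∀ f n → (∀ t → f t ≤ 1) → binary f n < 2 ^ n
binary< f zero    f≤1 = s≤s z≤n
binary< f (suc n) f≤1 = begin-strict
  binary (f ∘ suc) n * 2 + f 0   <⟨ +-monoʳ-< (binary (f ∘ suc) n * 2) (s≤s (f≤1 0)) ⟩
  binary (f ∘ suc) n * 2 + 2     ≡⟨ solve 1 (λ a → a :* con 2 :+ con 2 := con 2 :* (con 1 :+ a)) refl (binary (f ∘ suc) n) ⟩
  2 * suc (binary (f ∘ suc) n)   ≤⟨ *-monoʳ-≤ 2 (binary< (f ∘ suc) n (f≤1 ∘ suc)) ⟩
  2 * 2 ^ n                   ∎
  where
  open ≤-Reasoning
  open +-*-Solver using (solve; _:+_; _:*_; _:=_; con)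

/₀≡/ : ∀ x d .{{_ : NonZero d}} → x /₀ d ≡ x / d
/₀≡/ x (suc d) = refl

-- The shift discards exactly the digits below `r`, which the second summand restores. It yields the
-- ones from a given position of a block on.
pc-shift : ∀ f n r → r ≤ n → (∀ t → f t ≤ 1) → pc (binary f n /₀ 2 ^ r) + sumTo f r ≡ sumTo f n
pc-shift f zero    zero    z≤n     f≤1 = trans (+-identityʳ _) pc-zero
pc-shift f (suc n) zero    z≤n     f≤1 = begin
  pc (v /₀ 1) + 0                      ≡⟨ +-identityʳ _ ⟩
  pc (v / 1)                           ≡⟨ cong pc (n/1≡n v) ⟩
  pc v                                 ≡⟨ pc-half v ⟩
  pc (v / 2) + v % 2                   ≡⟨ cong₂ (λ a b → pc a + b) ([q*n+x]/n≡q v′ 2 (s≤s (f≤1 0))) ([q*n+x]%n≡x v′ 2 (s≤s (f≤1 0))) ⟩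
  pc v′ + f 0                          ≡⟨ cong (λ z → pc z + f 0) (n/1≡n v′) ⟨
  pc (v′ / 1) + f 0                    ≡⟨ cong (_+ f 0) (trans (sym (+-identityʳ _)) (pc-shift (f ∘ suc) n 0 z≤n (f≤1 ∘ suc))) ⟩
  sumTo (f ∘ suc) n + f 0              ≡⟨ +-comm _ (f 0) ⟩
  f 0 + sumTo (f ∘ suc) n              ≡⟨ sumTo-split f 1 n ⟨
  sumTo f (suc n)                      ∎
  where
  open ≡-Reasoning
  v = binary f (suc n)
  v′ = binary (f ∘ suc) n
pc-shift f (suc n) (suc r) (s≤s p) f≤1 = begin
  pc (v /₀ (2 * 2 ^ r)) + sumTo f (suc r)            ≡⟨ cong₂ (λ a b → pc a + b) shift (sumTo-split f 1 r) ⟩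
  pc (v′ /₀ 2 ^ r) + (f 0 + sumTo (f ∘ suc) r)       ≡⟨ solve 3 (λ a b c → a :+ (b :+ c) := b :+ (a :+ c)) refl (pc (v′ /₀ 2 ^ r)) (f 0) _ ⟩
  f 0 + (pc (v′ /₀ 2 ^ r) + sumTo (f ∘ suc) r)       ≡⟨ cong (f 0 +_) (pc-shift (f ∘ suc) n r p (f≤1 ∘ suc)) ⟩
  f 0 + sumTo (f ∘ suc) n                            ≡⟨ sumTo-split f 1 n ⟨
  sumTo f (suc n)                                    ∎
  where
  open ≡-Reasoning
  open +-*-Solver using (solve; _:+_; _:=_)
  v = binary f (suc n)
  v′ = binary (f ∘ suc) n
  instance
    2^r≢0 : NonZero (2 ^ r)
    2^r≢0 = m^n≢0 2 r
    2*2^r≢0 : NonZero (2 * 2 ^ r)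
    2*2^r≢0 = m*n≢0 2 (2 ^ r)
  shift : v /₀ (2 * 2 ^ r) ≡ v′ /₀ 2 ^ r
  shift = begin
    v /₀ (2 * 2 ^ r)   ≡⟨ /₀≡/ v (2 * 2 ^ r) ⟩
    v / (2 * 2 ^ r)    ≡⟨ m/n/o≡m/[n*o] v 2 (2 ^ r) ⟨
    v / 2 / 2 ^ r      ≡⟨ cong (_/ 2 ^ r) ([q*n+x]/n≡q v′ 2 (s≤s (f≤1 0))) ⟩
    v′ / 2 ^ r         ≡⟨ /₀≡/ v′ (2 ^ r) ⟨
    v′ /₀ 2 ^ r        ∎

pc-binary : ∀ f n → (∀ t → f t ≤ 1) → pc (binary f n) ≡ sumTo f n
pc-binary f n f≤1 = trans (cong pc (sym (n/1≡n (binary f n)))) (trans (sym (+-identityʳ _)) (pc-shift f n 0 z≤n f≤1))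

-- Rank queries on a narrow array

rank : (ℕ → ℕ) → ℕ → ℕ → ℕ
rank D o = sumTo (λ x → ind (o ≤ᵇ D x))

rank-cong : ∀ {D D′} o n → (∀ x → x < n → D x ≡ D′ x) → rank D o n ≡ rank D′ o n
rank-cong o n eq = sumTo-cong n (λ x x<n → cong (λ z → ind (o ≤ᵇ z)) (eq x x<n))

module NarrowRank (D : ℕ → ℕ) (l nb : ℕ) where

  L NB : ℕ
  L  = suc l
  NB = suc nb

  -- Word y holds block y % NB of the bit vector for the threshold y / NB.
  pos : ℕ → ℕ → ℕ
  pos y t = y % NB * L + t

  -- The test against `n` pads the last block with zeros. For `eqBit` the bound `n` also measures
  -- progress: only the entries before `n` have been inserted.
  eqBit geBit : ℕ → ℕ → ℕ → ℕ
  eqBit n y t = ind ((pos y t <ᵇ n) ∧ (D (pos y t) ≡ᵇ y / NB))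
  geBit n y t = ind ((pos y t <ᵇ n) ∧ (y / NB ≤ᵇ D (pos y t)))

  cell : ℕ → ℕ
  cell x = D x * NB + x / L

  -- An entry is ≥ o if it equals o or is ≥ o + 1, never both, and the same block of the next row
  -- lies `NB` words further on.
  geBit-step : ∀ n y t → geBit n y t ≡ eqBit n y t + geBit n (y + NB) t
  geBit-step n y t = trans (go (pos y t <ᵇ n) (D (pos y t)) (y / NB))
    (cong (eqBit n y t +_) (cong₂ (λ r o → ind ((r * L + t <ᵇ n) ∧ (o ≤ᵇ D (r * L + t))))
      (sym ([m+n]%n≡m%n y NB)) o≡))
    where
    o≡ : suc (y / NB) ≡ (y + NB) / NB
    o≡ = sym (trans (cong (_/ NB) y+NB≡) ([q*n+x]/n≡q (suc (y / NB)) NB (m%n<n y NB)))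
      where
      open ≡-Reasoning
      y+NB≡ : y + NB ≡ suc (y / NB) * NB + y % NB
      y+NB≡ = begin
        y + NB                             ≡⟨ cong (_+ NB) (m≡m%n+[m/n]*n y NB) ⟩
        y % NB + y / NB * NB + NB          ≡⟨ +-assoc (y % NB) _ NB ⟩
        y % NB + (y / NB * NB + NB)        ≡⟨ cong (y % NB +_) (+-comm _ NB) ⟩
        y % NB + suc (y / NB) * NB         ≡⟨ +-comm (y % NB) _ ⟩
        suc (y / NB) * NB + y % NB         ∎
    go : ∀ b d o → ind (b ∧ (o ≤ᵇ d)) ≡ ind (b ∧ (d ≡ᵇ o)) + ind (b ∧ (suc o ≤ᵇ d))
    go false d o = refl
    go true  d o with <-cmp d o
    ... | tri< d<o d≢o _ rewrite ≤ᵇ-false d<o | ≡ᵇ-false d≢o | ≤ᵇ-false (m<n⇒m<1+n d<o) = refl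
    ... | tri≈ _ refl _ rewrite ≤ᵇ-true (≤-refl {d}) | ≡ᵇ-true {d} refl | ≤ᵇ-false (n<1+n d) = refl
    ... | tri> _ d≢o o<d rewrite ≤ᵇ-true (<⇒≤ o<d) | ≡ᵇ-false d≢o | ≤ᵇ-true o<d = refl

  -- Start of the descending recursion over the rows: where both kinds of bits vanish, they agree.
  top-row : ∀ n K y → (∀ x → x < n → D x < K) → K * NB ≤ y → ∀ t → eqBit n y t ≡ 0 × geBit n y t ≡ 0
  top-row n K y D<K K*NB≤y t with pos y t <? n
  ... | no ¬p rewrite <ᵇ-false (≮⇒≥ ¬p) = refl , refl
  ... | yes p = eqs
    where
    d<o : D (pos y t) < y / NB
    d<o = <-≤-trans (D<K _ p) (subst (_≤ y / NB) (m*n/n≡m K NB) (/-monoˡ-≤ NB K*NB≤y))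
    eqs : eqBit n y t ≡ 0 × geBit n y t ≡ 0
    eqs rewrite <ᵇ-true p | ≡ᵇ-false (<⇒≢ d<o) | ≤ᵇ-false d<o = refl , refl

  pos-cell : ∀ x → x / L < NB → pos (cell x) (x % L) ≡ x
  pos-cell x x/L<NB = trans (cong (λ b → b * L + x % L) ([q*n+x]%n≡x (D x) NB x/L<NB))
    (trans (+-comm _ (x % L)) (sym (m≡m%n+[m/n]*n x L)))

  pos-unique : ∀ {x y t} → t < L → pos y t ≡ x → D x ≡ y / NB → cell x ≡ y × t ≡ x % L
  pos-unique {x} {y} {t} t<L refl D≡ =
    trans (cong₂ (λ a b → a * NB + b) D≡ ([q*n+x]/n≡q (y % NB) L t<L))
      (trans (+-comm _ (y % NB)) (sym (m≡m%n+[m/n]*n y NB))) ,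
    sym ([q*n+x]%n≡x (y % NB) L t<L)

  insert-other : ∀ x y t → t < L → ¬ (pos y t ≡ x × D x ≡ y / NB) → eqBit (suc x) y t ≡ eqBit x y t
  insert-other x y t t<L ne with <-cmp (pos y t) x
  ... | tri< p _ _ rewrite <ᵇ-true p | <ᵇ-true (m<n⇒m<1+n p) = refl
  ... | tri> _ _ p rewrite <ᵇ-false (<⇒≤ p) | <ᵇ-false p = refl
  ... | tri≈ ¬p refl _ rewrite <ᵇ-true (n<1+n (pos y t)) | <ᵇ-false (≤-refl {pos y t})
      | ≡ᵇ-false {D (pos y t)} {y / NB} (λ D≡ → ne (refl , D≡)) = refl

  insert-≢ : ∀ x y → cell x ≢ y → binary (eqBit (suc x) y) L ≡ binary (eqBit x y) L
  insert-≢ x y ne = binary-cong L λ t t<L →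
    insert-other x y t t<L (λ (p , d) → ne (proj₁ (pos-unique {x} {y} t<L p d)))

  insert-≡ : ∀ x → x / L < NB → binary (eqBit (suc x) (cell x)) L ≡ binary (eqBit x (cell x)) L + 2 ^ (x % L)
  insert-≡ x x/L<NB = binary-bump L (x % L) (m%n<n x L) new
    (λ t t<L t≢ → insert-other x (cell x) t t<L (λ (p , d) → t≢ (proj₂ (pos-unique {x} {cell x} t<L p d))))
    where
    new : eqBit (suc x) (cell x) (x % L) ≡ suc (eqBit x (cell x) (x % L))
    new rewrite pos-cell x x/L<NB | [q*n+x]/n≡q (D x) NB x/L<NB | <ᵇ-true (n<1+n x)
      | <ᵇ-false (≤-refl {x}) | ≡ᵇ-true {D x} refl = refl

  module _ (n Y : ℕ) (W Cnt : ℕ → ℕ)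
           (W≡   : ∀ y → y < Y → W y ≡ binary (geBit n y) L)
           (Cnt≡ : ∀ y → y < Y → Cnt y ≡ Cnt (suc y) + pc (W y)) where

    -- A right shift keeps the bits from `x` on, hence suffix sums rather than prefix sums. Only the
    -- recursion of `Cnt` is prescribed, since a query takes differences.
    suffixRank : ℕ → ℕ → ℕ
    suffixRank x o = Cnt (suc (o * NB + x / L)) + pc (W (o * NB + x / L) /₀ 2 ^ (x % L))

    module _ (o : ℕ) (row : suc o * NB ≤ Y) where

      in-row : ∀ {β} → β < NB → o * NB + β < Y
      in-row {β} β<NB = <-≤-trans (+-monoʳ-< (o * NB) β<NB)
        (subst (_≤ Y) (+-comm NB (o * NB)) row)

      bits-rank : ∀ β r → β < NB → β * L + r ≤ n →
                  sumTo (geBit n (o * NB + β)) r ≡ sumTo (λ t → ind (o ≤ᵇ D (β * L + t))) r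
      bits-rank β r β<NB le = sumTo-cong r λ t t<r → bit t (<-≤-trans (+-monoʳ-< (β * L) t<r) le)
        where
        bit : ∀ t → β * L + t < n → geBit n (o * NB + β) t ≡ ind (o ≤ᵇ D (β * L + t))
        bit t lt rewrite [q*n+x]%n≡x o NB β<NB | [q*n+x]/n≡q o NB β<NB | <ᵇ-true lt = refl

      block-rank : ∀ β → β < NB → β * L ≤ n → Cnt (o * NB + β) + rank D o (β * L) ≡ Cnt (o * NB)
      block-rank zero    β<NB le = trans (+-identityʳ _) (cong Cnt (+-identityʳ _))
      block-rank (suc β) β<NB le = begin
        Cnt (o * NB + suc β) + rank D o (suc β * L)
          ≡⟨ cong₂ _+_ (cong Cnt (+-suc (o * NB) β)) (cong (rank D o) (+-comm L (β * L))) ⟩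
        Cnt (suc y) + rank D o (β * L + L)
          ≡⟨ cong (Cnt (suc y) +_) (sumTo-split _ (β * L) L) ⟩
        Cnt (suc y) + (rank D o (β * L) + sumTo (λ t → ind (o ≤ᵇ D (β * L + t))) L)
          ≡⟨ solve 3 (λ a b c → a :+ (b :+ c) := a :+ c :+ b) refl (Cnt (suc y)) (rank D o (β * L)) _ ⟩
        Cnt (suc y) + sumTo (λ t → ind (o ≤ᵇ D (β * L + t))) L + rank D o (β * L)
          ≡⟨ cong (λ z → Cnt (suc y) + z + rank D o (β * L)) (trans
               (sym (bits-rank β L β<NB′ (subst (_≤ n) (+-comm L (β * L)) le)))
               (sym (pc-binary (geBit n y) L (λ t → ind≤1 _)))) ⟩
        Cnt (suc y) + pc (binary (geBit n y) L) + rank D o (β * L)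
          ≡⟨ cong (_+ rank D o (β * L)) (trans (Cnt≡ y y<Y) (cong (λ z → Cnt (suc y) + pc z) (W≡ y y<Y))) ⟨
        Cnt y + rank D o (β * L)
          ≡⟨ block-rank β β<NB′ (≤-trans (m≤n+m (β * L) L) le) ⟩
        Cnt (o * NB) ∎
        where
        open ≡-Reasoning
        open +-*-Solver using (solve; _:+_; _:=_)
        y = o * NB + β
        β<NB′ : β < NB
        β<NB′ = <-trans (n<1+n β) β<NB
        y<Y : y < Y
        y<Y = in-row β<NB′

      -- The right-hand side does not depend on `x`, so two instances subtract to a difference of
      -- ranks. The blocks before that of `x` are accounted for by `block-rank`, the bits shifted
      -- out by `pc-shift`.
      suffixRank-rank : ∀ x → x ≤ n → x / L < NB → suffixRank x o + rank D o x ≡ Cnt (o * NB)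
      suffixRank-rank x x≤n x/L<NB = begin
        Cnt (suc y) + p + rank D o x
          ≡⟨ cong (λ z → Cnt (suc y) + p + rank D o z) x≡ ⟩
        Cnt (suc y) + p + rank D o (β * L + r)
          ≡⟨ cong (Cnt (suc y) + p +_) (sumTo-split _ (β * L) r) ⟩
        Cnt (suc y) + p + (rank D o (β * L) + sumTo (λ t → ind (o ≤ᵇ D (β * L + t))) r)
          ≡⟨ cong (λ z → Cnt (suc y) + p + (rank D o (β * L) + z))
               (bits-rank β r x/L<NB (subst (_≤ n) x≡ x≤n)) ⟨
        Cnt (suc y) + p + (rank D o (β * L) + q)
          ≡⟨ solve 4 (λ a b c d → a :+ b :+ (c :+ d) := a :+ (b :+ d) :+ c) refl (Cnt (suc y)) p _ q ⟩
        Cnt (suc y) + (p + q) + rank D o (β * L)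
          ≡⟨ cong (λ z → Cnt (suc y) + z + rank D o (β * L)) p+q ⟩
        Cnt (suc y) + pc (W y) + rank D o (β * L)
          ≡⟨ cong (_+ rank D o (β * L)) (Cnt≡ y y<Y) ⟨
        Cnt y + rank D o (β * L)
          ≡⟨ block-rank β x/L<NB (≤-trans (m/n*n≤m x L) x≤n) ⟩
        Cnt (o * NB) ∎
        where
        open ≡-Reasoning
        open +-*-Solver using (solve; _:+_; _:=_)
        β = x / L
        r = x % L
        y = o * NB + β
        p = pc (W y /₀ 2 ^ r)
        q = sumTo (geBit n y) r
        y<Y : y < Y
        y<Y = in-row x/L<NB
        x≡ : x ≡ β * L + r
        x≡ = trans (m≡m%n+[m/n]*n x L) (+-comm r _)
        p+q : p + q ≡ pc (W y)
        p+q = trans (cong (λ z → pc (z /₀ 2 ^ r) + q) (W≡ y y<Y))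
          (trans (pc-shift (geBit n y) L r (<⇒≤ (m%n<n x L)) (λ t → ind≤1 _))
            (trans (sym (pc-binary (geBit n y) L (λ t → ind≤1 _))) (cong pc (sym (W≡ y y<Y)))))

-- Counting, filtering, and lists stored in arrays

count : (ℕ → Bool) → List ℕ → ℕ
count p []       = 0
count p (x ∷ xs) = ind (p x) + count p xs

length-filterᵇ : ∀ p xs → length (filterᵇ p xs) ≡ count p xs
length-filterᵇ p []       = refl
length-filterᵇ p (x ∷ xs) with p x
... | true  = cong suc (length-filterᵇ p xs)
... | false = length-filterᵇ p xs

rangeCount-count : ∀ A j v → rangeCount A j v ≡ count (v ≤ᵇ_) (take j A)
rangeCount-count A j v = go (take j A)
  where
  go : ∀ xs → length (filter (v ≤?_) xs) ≡ count (v ≤ᵇ_) xs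
  go []       = refl
  go (x ∷ xs) with v ≤ᵇ x
  ... | true  = cong suc (go xs)
  ... | false = go xs

count-≤-length : ∀ p xs → count p xs ≤ length xs
count-≤-length p []       = z≤n
count-≤-length p (x ∷ xs) = +-mono-≤ (ind≤1 (p x)) (count-≤-length p xs)

count-take-≤ : ∀ p j xs → count p (take j xs) ≤ count p xs
count-take-≤ p zero    xs       = z≤n
count-take-≤ p (suc j) []       = z≤n
count-take-≤ p (suc j) (x ∷ xs) = +-monoʳ-≤ (ind (p x)) (count-take-≤ p j xs)

-- Elements dropped by `p` do not count for `q` either. This moves a prefix query on the input to a
-- prefix of one level, whose length is itself a count.
count-take-filterᵇ : ∀ {p q : ℕ → Bool} → (∀ x → p x ≡ false → q x ≡ false) → ∀ j xs →
  count q (take (count p (take j xs)) (filterᵇ p xs)) ≡ count q (take j xs)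
count-take-filterᵇ imp zero    xs       = refl
count-take-filterᵇ imp (suc j) []       = refl
count-take-filterᵇ {p} {q} imp (suc j) (x ∷ xs) with p x in eq
... | true  = cong (ind (q x) +_) (count-take-filterᵇ imp j xs)
... | false = trans (count-take-filterᵇ imp j xs) (cong (λ b → ind b + count q (take j xs)) (sym (imp x eq)))

-- Lets each level be selected from the preceding one instead of from the whole input.
filterᵇ-filterᵇ : ∀ {p q : ℕ → Bool} → (∀ x → p x ≡ false → q x ≡ false) → ∀ xs →
  filterᵇ q (filterᵇ p xs) ≡ filterᵇ q xs
filterᵇ-filterᵇ imp []       = refl
filterᵇ-filterᵇ {p} {q} imp (x ∷ xs) with p x in eq
... | false rewrite imp x eq = filterᵇ-filterᵇ imp xs
... | true with q x
...   | true  = cong (x ∷_) (filterᵇ-filterᵇ imp xs)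
...   | false = filterᵇ-filterᵇ imp xs

filterᵇ-all : ∀ {p : ℕ → Bool} → (∀ x → p x ≡ true) → ∀ xs → filterᵇ p xs ≡ xs
filterᵇ-all all []       = refl
filterᵇ-all all (x ∷ xs) rewrite all x = cong (x ∷_) (filterᵇ-all all xs)

filterᵇ-∷ʳ-true : ∀ {p : ℕ → Bool} xs {x} → p x ≡ true → filterᵇ p (xs ++ [ x ]) ≡ filterᵇ p xs ++ [ x ]
filterᵇ-∷ʳ-true []       eq rewrite eq = refl
filterᵇ-∷ʳ-true {p} (y ∷ xs) eq with p y
... | true  = cong (y ∷_) (filterᵇ-∷ʳ-true xs eq)
... | false = filterᵇ-∷ʳ-true xs eq

filterᵇ-∷ʳ-false : ∀ {p : ℕ → Bool} xs {x} → p x ≡ false → filterᵇ p (xs ++ [ x ]) ≡ filterᵇ p xs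
filterᵇ-∷ʳ-false []       eq rewrite eq = refl
filterᵇ-∷ʳ-false {p} (y ∷ xs) eq with p y
... | true  = cong (y ∷_) (filterᵇ-∷ʳ-false xs eq)
... | false = filterᵇ-∷ʳ-false xs eq

Segment : (ℕ → ℕ) → ℕ → List ℕ → Set
Segment f k []       = ⊤
Segment f k (x ∷ xs) = f k ≡ x × Segment f (suc k) xs

segment-cong : ∀ {f g} k xs → (∀ i → k ≤ i → i < k + length xs → g i ≡ f i) → Segment f k xs → Segment g k xs
segment-cong k []       eq _        = tt
segment-cong k (x ∷ xs) eq (h , hs) =
  trans (eq k ≤-refl (m<m+n k (s≤s z≤n))) h ,
  segment-cong (suc k) xs (λ i k<i i< → eq i (<⇒≤ k<i) (subst (i <_) (sym (+-suc k (length xs))) i<)) hs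

segment-∷ʳ : ∀ {f} k xs {x} → Segment f k xs → f (k + length xs) ≡ x → Segment f k (xs ++ [ x ])
segment-∷ʳ {f} k []       _        eq = trans (cong f (sym (+-identityʳ k))) eq , tt
segment-∷ʳ {f} k (y ∷ xs) (h , hs) eq = h , segment-∷ʳ (suc k) xs hs (trans (cong f (sym (+-suc k (length xs)))) eq)

-- Total size of the levels

sumTo-initial : ∀ b u → sumTo (λ v → ind (v ≤ᵇ b)) u ≤ suc b
sumTo-initial b zero    = z≤n
sumTo-initial b (suc u) with u ≤? b
... | yes u≤b = ≤-trans (sumTo-≤ (λ v → ind (v ≤ᵇ b)) (suc u) 1 (λ v → ind≤1 _))
                  (subst (_≤ suc b) (sym (*-identityʳ (suc u))) (s≤s u≤b))
... | no u≰b rewrite ≤ᵇ-false (≰⇒> u≰b) = subst (_≤ suc b) (sym (+-identityʳ _)) (sumTo-initial b u)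

sumTo-≤-pointwise : ∀ {f g} n → (∀ t → f t ≤ g t) → sumTo f n ≤ sumTo g n
sumTo-≤-pointwise zero    f≤g = z≤n
sumTo-≤-pointwise (suc n) f≤g = +-mono-≤ (sumTo-≤-pointwise n f≤g) (f≤g n)

-- By `lev-reflects`, the `v` that are counted lie among 0, ..., `2 * a`.
lev-count : ∀ a u → sumTo (λ v → ind (lev v ≤ᵇ lev a)) u ≤ suc (2 * a)
lev-count a u = ≤-trans (sumTo-≤-pointwise u le) (sumTo-initial (2 * a) u)
  where
  le : ∀ v → ind (lev v ≤ᵇ lev a) ≤ ind (v ≤ᵇ 2 * a)
  le v with lev v ≤? lev a
  ... | no ¬p rewrite ≤ᵇ-false (≰⇒> ¬p) = z≤n
  ... | yes p rewrite ≤ᵇ-true (lev-reflects {v} {a} p) = ind≤1 _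

module Levels (l : ℕ) where

  L : ℕ
  L = suc l

  above : ℕ → ℕ → Bool
  above k x = k ≤ᵇ lev (x / L)

  levelSize : List ℕ → ℕ → ℕ
  levelSize A u = count (above (lev u)) A

  quotients : List ℕ → ℕ
  quotients A = sum (map (_/ L) A)

  -- Double counting: the total over all thresholds is taken element by element, each contributing
  -- what `lev-count` allows.
  levelSizes-≤ : ∀ A u → sumTo (levelSize A) u ≤ length A + 2 * quotients A
  levelSizes-≤ []       u = ≤-reflexive (trans (sumTo-const 0 u) (*-zeroʳ u))
  levelSizes-≤ (x ∷ A) u = begin
    sumTo (levelSize (x ∷ A)) u
      ≡⟨ sumTo-+ (λ v → ind (lev v ≤ᵇ lev (x / L))) (levelSize A) u ⟩
    sumTo (λ v → ind (lev v ≤ᵇ lev (x / L))) u + sumTo (levelSize A) u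
      ≤⟨ +-mono-≤ (lev-count (x / L) u) (levelSizes-≤ A u) ⟩
    suc (2 * (x / L)) + (length A + 2 * quotients A)
      ≡⟨ solve 3 (λ a b c → con 1 :+ con 2 :* a :+ (b :+ con 2 :* c) := con 1 :+ b :+ con 2 :* (a :+ c)) refl
           (x / L) (length A) (quotients A) ⟩
    length (x ∷ A) + 2 * quotients (x ∷ A) ∎
    where
    open ≤-Reasoning
    open +-*-Solver using (solve; _:+_; _:*_; _:=_; con)

  quotients-≤ : ∀ A → quotients A * L ≤ sum A
  quotients-≤ []       = z≤n
  quotients-≤ (x ∷ A) = subst (_≤ x + sum A) (sym (*-distribʳ-+ L (x / L) (quotients A)))
    (+-mono-≤ (m/n*n≤m x L) (quotients-≤ A))

  above-false : ∀ k x → above k x ≡ false → lev (x / L) < k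
  above-false k x eq = ≰⇒> (λ p → case trans (sym (≤ᵇ-true p)) eq of λ ())

  above-antitone : ∀ {k k′} → k ≤ k′ → ∀ x → above k x ≡ false → above k′ x ≡ false
  above-antitone {k} k≤k′ x eq = ≤ᵇ-false (<-≤-trans (above-false k x eq) k≤k′)

  -- An element that reaches `u * L` has quotient at least `u`, and bit length is monotone. So
  -- nothing outside the level of `u` can be counted by a query with this `u`.
  above-threshold : ∀ u {o} x → above (lev u) x ≡ false → (u * L + o ≤ᵇ x) ≡ false
  above-threshold u {o} x eq = ≤ᵇ-false (≰⇒> λ p →
    <-irrefl refl (<-≤-trans (above-false (lev u) x eq)
      (lev-mono (subst (_≤ x / L) (m*n/n≡m u L) (/-monoˡ-≤ L (≤-trans (m≤m+n (u * L) o) p))))))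

n<2^n : ∀ n → n < 2 ^ n
n<2^n zero    = s≤s z≤n
n<2^n (suc n) = +-mono-≤-< {1} (m^n>0 2 n) (subst (n <_) (sym (+-identityʳ (2 ^ n))) (n<2^n n))

lev≤n : ∀ n → lev n ≤ n
lev≤n n = lev≤ n (n<2^n n)

pc≤n : ∀ n → pc n ≤ n
pc≤n n = go n n ≤-refl
  where
  go : ∀ fuel n → n ≤ fuel → pc n ≤ n
  go fuel       zero    p       = ≤-reflexive pc-zero
  go (suc fuel) (suc n) (s≤s p) = begin
    pc (suc n)                           ≡⟨ pc-half (suc n) ⟩
    pc (suc n / 2) + suc n % 2           ≤⟨ +-monoˡ-≤ _ (go fuel (suc n / 2) (≤-trans (half≤ n) p)) ⟩
    suc n / 2 + suc n % 2                ≤⟨ +-monoˡ-≤ _ (m≤m*n (suc n / 2) 2) ⟩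
    suc n / 2 * 2 + suc n % 2            ≡⟨ +-comm _ (suc n % 2) ⟩
    suc n % 2 + suc n / 2 * 2            ≡⟨ m≡m%n+[m/n]*n (suc n) 2 ⟨
    suc n                                ∎
    where open ≤-Reasoning

-- The step counts k at the calls are those that `cost` evaluates to; the
-- bounds c are generous.
loop-time : ∀ n k c {τ τ′} → T (k ≤ᵇ c) → τ′ ≤ suc (k + τ) + n * c → τ′ ≤ suc τ + suc n * c
loop-time n k c {τ} k≤c le = ≤-trans le (s≤s (begin
  k + τ + n * c     ≤⟨ +-monoˡ-≤ (n * c) (+-monoˡ-≤ τ (≤ᵇ⇒≤ k c k≤c)) ⟩
  c + τ + n * c     ≡⟨ cong (_+ n * c) (+-comm c τ) ⟩
  τ + c + n * c     ≡⟨ +-assoc τ c (n * c) ⟩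
  τ + (c + n * c)   ∎))
  where open ≤-Reasoning

upd-ext : ∀ {f g : ℕ → ℕ} x {v} → v ≡ g x → (∀ y → y < x → f y ≡ g y) →
          ∀ y → y < suc x → upd f x v y ≡ g y
upd-ext {f} {g} x {v} v≡ eq y y<1+x with x ≟ y
... | yes refl = trans (upd-≡ f x v) v≡
... | no x≢y = trans (upd-≢ f x v y x≢y) (eq y (≤∧≢⇒< (s≤s⁻¹ y<1+x) (x≢y ∘ sym)))

-- The programs

-- Arrays: 0 the input A, 1 bit lengths, 2 population counts, 3 the elements of
-- the current level, 4 D, 5 F, 6 the start of the row of F for each u, 7 the
-- words of the bit vectors, 8 the suffix sums of their population counts.
-- Variables: 0 and 1 the input (m and m′, or j and v), 2 the stride, 3 zero
-- exactly in the case of a small m, 4 L, 5 the number of blocks of a bit vector,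
-- 6 the number of values of u.
tablesBody tablesLoop tables : Cmd
tablesBody =
  1 ⟦ var 7 ⟧← 1 ⟦ var 7 ⊘ num 2 ⟧ ⊕ num 1 ⨾
  2 ⟦ var 7 ⟧← 2 ⟦ var 7 ⊘ num 2 ⟧ ⊕ var 7 ⊙ num 2 ⨾
  -- Memory is not initialised, and bits will be set in this array by additions.
  7 ⟦ var 7 ⟧← num 0 ⨾
  7 ← var 7 ⊕ num 1
tablesLoop = while 7 < 2 repeat tablesBody
tables =
  1 ⟦ num 0 ⟧← num 0 ⨾
  2 ⟦ num 0 ⟧← num 0 ⨾
  7 ⟦ num 0 ⟧← num 0 ⨾
  7 ← num 1 ⨾
  tablesLoop

record Tables (x : ℕ) (lv pv wv : ℕ → ℕ) : Set where
  field
    lev-ok  : ∀ y → y < x → lv y ≡ lev y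
    pc-ok   : ∀ y → y < x → pv y ≡ pc y
    zero-ok : ∀ y → y < x → wv y ≡ 0
open Tables

module _ (w Z : ℕ) (2<Z : 2 < Z) (Z<W : Z < 2 ^ w) where
  open Simulation w Z

  <W : ∀ {x} → x ≤ Z → x < 2 ^ w
  <W x≤Z = ≤-<-trans x≤Z Z<W

  tablesLoop-run : ∀ {r0 r1 r3 r4 r5 r6 r8 r9 r10 r11 r12 r13 r14 r15 r16 a bs d f s k Q} n x {lv pv wv τ} → n + suc x ≡ Z → Tables (suc x) lv pv wv →
    (∀ lv pv wv τ′ → Tables Z lv pv wv → τ′ ≤ suc τ + n * 99 →
      Q ⟪ r0 ∷ r1 ∷ Z ∷ r3 ∷ r4 ∷ r5 ∷ r6 ∷ Z ∷ r8 ∷ r9 ∷ r10 ∷ r11 ∷ r12 ∷ r13 ∷ r14 ∷ r15 ∷ r16 ∷ []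
        , a ∷ lv ∷ pv ∷ bs ∷ d ∷ f ∷ s ∷ wv ∷ k ∷ [] , τ′ ⟫) →
    Run tablesLoop
      ⟪ r0 ∷ r1 ∷ Z ∷ r3 ∷ r4 ∷ r5 ∷ r6 ∷ suc x ∷ r8 ∷ r9 ∷ r10 ∷ r11 ∷ r12 ∷ r13 ∷ r14 ∷ r15 ∷ r16 ∷ []
      , a ∷ lv ∷ pv ∷ bs ∷ d ∷ f ∷ s ∷ wv ∷ k ∷ [] , τ ⟫ Q
  tablesLoop-run zero    x refl tab k = run-exit _ _ ≤-refl (k _ _ _ _ tab (m≤m+n _ _))
  tablesLoop-run (suc n) x {lv} {pv} {wv} {τ} eq tab k =
    run-loop _ _ x<Z
      $ run-seq $ run-⟦⟧← (_ , refl , _ , x<Z)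
          ((_ , refl , (_ , 2<W , _) , half<Z) , 1<W , <W (subst (_≤ Z) (sym lev-eq) (≤-trans (lev≤n (suc x)) (<⇒≤ x<Z))))
          (suc x) refl (lev (suc x)) lev-eq
      $ run-seq $ run-⟦⟧← (_ , refl , _ , x<Z)
          ((_ , refl , (_ , 2<W , _) , half<Z) , (_ , 2<W , _) , <W (subst (_≤ Z) (sym pc-eq) (≤-trans (pc≤n (suc x)) (<⇒≤ x<Z))))
          (suc x) refl (pc (suc x)) pc-eq
      $ run-seq $ run-⟦⟧← (_ , refl , _ , x<Z) 0<W (suc x) refl 0 refl
      $ run-← (_ , 1<W , <W (subst (_≤ Z) (+-comm 1 (suc x)) x<Z)) (suc (suc x)) (+-comm (suc x) 1) _
      $ tablesLoop-run n (suc x) (trans (+-suc n (suc x)) eq)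
          (record { lev-ok  = upd-ext (suc x) refl (lev-ok tab)
                  ; pc-ok   = upd-ext (suc x) refl (pc-ok tab)
                  ; zero-ok = upd-ext {g = const 0} (suc x) refl (zero-ok tab) })
          (λ _ _ _ _ tab′ le → k _ _ _ _ tab′ (loop-time n 46 99 _ le))
    where
    x<Z : suc x < Z
    x<Z = subst (suc x <_) eq (s≤s (m≤n+m (suc x) n))
    2<W : 2 < 2 ^ w
    2<W = <W (<⇒≤ 2<Z)
    1<W : 1 < 2 ^ w
    1<W = <-trans ≤-refl 2<W
    0<W : 0 < 2 ^ w
    0<W = <-trans ≤-refl 1<W
    half<Z : suc x / 2 < Z
    half<Z = ≤-<-trans (m/n≤m (suc x) 2) x<Z
    half< : suc x / 2 < suc x
    half< = m/n<m (suc x) 2 ≤-refl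
    lev-eq : lv (suc x / 2) + 1 ≡ lev (suc x)
    lev-eq = trans (cong (_+ 1) (lev-ok tab (suc x / 2) half<)) (trans (+-comm _ 1) (sym (lev-suc x)))
    pc-eq : pv (suc x / 2) + suc x % 2 ≡ pc (suc x)
    pc-eq = trans (cong (_+ suc x % 2) (pc-ok tab (suc x / 2) half<)) (sym (pc-half (suc x)))

-- Scanning one level

rank-upd : ∀ d o {n p} v → n ≤ p → rank (upd d p v) o n ≡ rank d o n
rank-upd d o v n≤p = rank-cong o _ (λ x x<n → upd-≢ d _ v x (λ p≡x → <-irrefl (sym p≡x) (<-≤-trans x<n n≤p)))

count-take-suc : ∀ q ys z zs →
  count q (take (suc (length ys)) (ys ++ z ∷ zs)) ≡ count q (take (length ys) (ys ++ z ∷ zs)) + ind (q z)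
count-take-suc q []       z zs = +-identityʳ _
count-take-suc q (y ∷ ys) z zs = trans (cong (ind (q y) +_) (count-take-suc q ys z zs)) (sym (+-assoc (ind (q y)) _ _))

module ScanInvariant (l K : ℕ) where
  open Levels l

  -- While the elements xs of a level are scanned for the threshold u * L, the
  -- array d receives the capped excesses from position p₀ on and the array f
  -- the resulting positions, from position q₀ on; t elements have been read.
  record Filled (u : ℕ) (xs : List ℕ) (p₀ q₀ : ℕ) (d₀ f₀ : ℕ → ℕ) (t : ℕ) (d f : ℕ → ℕ) (p : ℕ) : Set where
    field
      lower   : p₀ ≤ p
      upper   : p ≤ p₀ + t
      rank-ok : ∀ o → o < L → rank d o p ≡ rank d o p₀ + count (u * L + o ≤ᵇ_) (take t xs)
      entries : ∀ r → r < t → f (q₀ + r) ≤ p ×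
                (∀ o → o < L → rank d o (f (q₀ + r)) ≡ rank d o p₀ + count (u * L + o ≤ᵇ_) (take r xs))
      d-frame : ∀ x → x < p₀ → d x ≡ d₀ x
      f-frame : ∀ x → x < q₀ → f x ≡ f₀ x
      bounded : ∀ x → x < p → d x < K
  open Filled public

  module _ {u ys z zs p₀ q₀ d₀ f₀ d f p} (inv : Filled u (ys ++ z ∷ zs) p₀ q₀ d₀ f₀ (length ys) d f p) where

    private
      t  = length ys
      xs = ys ++ z ∷ zs
      f′ = upd f (q₀ + t) p

      f′-frame : ∀ x → x < q₀ → f′ x ≡ f₀ x
      f′-frame x x<q₀ = trans (upd-≢ f (q₀ + t) p x (λ e → <-irrefl (sym e) (<-≤-trans x<q₀ (m≤m+n q₀ t))))
                              (f-frame inv x x<q₀)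

      f′-entries : ∀ r → r < suc t → f′ (q₀ + r) ≤ p ×
        (∀ o → o < L → rank d o (f′ (q₀ + r)) ≡ rank d o p₀ + count (u * L + o ≤ᵇ_) (take r xs))
      f′-entries r r<1+t with r ≟ t
      ... | yes refl rewrite upd-≡ f (q₀ + t) p = ≤-refl , rank-ok inv
      ... | no r≢t rewrite upd-≢ f (q₀ + t) p (q₀ + r) (λ e → r≢t (sym (+-cancelˡ-≡ q₀ t r e))) =
        entries inv r (≤∧≢⇒< (s≤s⁻¹ r<1+t) r≢t)

    -- The element fails every threshold of this row, so `d` does not grow; its place in the level
    -- still gets an entry of `f`.
    filled-skip : z < u * L → Filled u xs p₀ q₀ d₀ f₀ (suc t) d f′ p
    filled-skip z<uL = record
      { lower   = lower inv
      ; upper   = ≤-trans (upper inv) (+-monoʳ-≤ p₀ (n≤1+n t))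
      ; rank-ok = λ o o<L → trans (rank-ok inv o o<L) (cong (rank d o p₀ +_) (sym (same o)))
      ; entries = f′-entries
      ; d-frame = d-frame inv
      ; f-frame = f′-frame
      ; bounded = bounded inv
      }
      where
      same : ∀ o → count (u * L + o ≤ᵇ_) (take (suc t) xs) ≡ count (u * L + o ≤ᵇ_) (take t xs)
      same o = trans (count-take-suc (u * L + o ≤ᵇ_) ys z zs)
        (trans (cong (λ b → count (u * L + o ≤ᵇ_) (take t xs) + ind b)
                  (≤ᵇ-false (<-≤-trans z<uL (m≤m+n (u * L) o)))) (+-identityʳ _))

    -- The row of `u` is asked only for thresholds `u * L + o` with `o < L`, so any `c` that answers
    -- these as `z` does may stand for it.
    filled-push : ∀ {c} → c < K → (∀ o → o < L → (o ≤ᵇ c) ≡ (u * L + o ≤ᵇ z)) →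
                  Filled u xs p₀ q₀ d₀ f₀ (suc t) (upd d p c) f′ (suc p)
    filled-push {c} c<K c-ok = record
      { lower   = m≤n⇒m≤1+n (lower inv)
      ; upper   = subst (suc p ≤_) (sym (+-suc p₀ t)) (s≤s (upper inv))
      ; rank-ok = rank-ok′
      ; entries = λ r r<1+t → let le , eq = f′-entries r r<1+t in
          m≤n⇒m≤1+n le , λ o o<L → trans (rank-upd d o c le)
            (trans (eq o o<L) (cong (_+ _) (sym (rank-upd d o c (lower inv)))))
      ; d-frame = λ x x<p₀ → trans (upd-≢ d p c x (λ e → <-irrefl (sym e) (<-≤-trans x<p₀ (lower inv))))
                                   (d-frame inv x x<p₀)
      ; f-frame = f′-frame
      ; bounded = λ x x<1+p → bounded′ x (s≤s⁻¹ x<1+p)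
      }
      where
      bounded′ : ∀ x → x ≤ p → upd d p c x < K
      bounded′ x x≤p with p ≟ x
      ... | yes refl = subst (_< K) (sym (upd-≡ d p c)) c<K
      ... | no p≢x = subst (_< K) (sym (upd-≢ d p c x p≢x)) (bounded inv x (≤∧≢⇒< x≤p (p≢x ∘ sym)))
      rank-ok′ : ∀ o → o < L →
        rank (upd d p c) o (suc p) ≡ rank (upd d p c) o p₀ + count (u * L + o ≤ᵇ_) (take (suc t) xs)
      rank-ok′ o o<L = begin
        rank (upd d p c) o p + ind (o ≤ᵇ upd d p c p)
          ≡⟨ cong₂ (λ a b → a + ind b) (rank-upd d o {p} c ≤-refl) (trans (cong (o ≤ᵇ_) (upd-≡ d p c)) (c-ok o o<L)) ⟩
        rank d o p + ind (u * L + o ≤ᵇ z)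
          ≡⟨ cong (_+ ind (u * L + o ≤ᵇ z)) (rank-ok inv o o<L) ⟩
        rank d o p₀ + count (u * L + o ≤ᵇ_) (take t xs) + ind (u * L + o ≤ᵇ z)
          ≡⟨ +-assoc (rank d o p₀) _ _ ⟩
        rank d o p₀ + (count (u * L + o ≤ᵇ_) (take t xs) + ind (u * L + o ≤ᵇ z))
          ≡⟨ cong₂ _+_ (sym (rank-upd d o c (lower inv))) (sym (count-take-suc (u * L + o ≤ᵇ_) ys z zs)) ⟩
        rank (upd d p c) o p₀ + count (u * L + o ≤ᵇ_) (take (suc t) xs) ∎
        where open ≡-Reasoning

  cap-small : ∀ u {z} → u * L ≤ z → ∀ o → (o ≤ᵇ z ∸ u * L) ≡ (u * L + o ≤ᵇ z)
  cap-small u {z} uL≤z o with o ≤? z ∸ u * L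
  ... | yes p = trans (≤ᵇ-true p) (sym (≤ᵇ-true (subst (u * L + o ≤_) (m+[n∸m]≡n uL≤z) (+-monoʳ-≤ (u * L) p))))
  ... | no ¬p = trans (≤ᵇ-false (≰⇒> ¬p)) (sym (≤ᵇ-false
        (subst (_< u * L + o) (m+[n∸m]≡n uL≤z) (+-monoʳ-< (u * L) (≰⇒> ¬p)))))

  -- Both comparisons succeed. Capping at `L` is thus harmless for `o < L`, and it keeps the entries
  -- narrow.
  cap-large : ∀ u {z} → u * L ≤ z → L ≤ z ∸ u * L → ∀ o → o < L → (o ≤ᵇ L) ≡ (u * L + o ≤ᵇ z)
  cap-large u {z} uL≤z L≤ o o<L =
    trans (≤ᵇ-true (<⇒≤ o<L)) (sym (trans (sym (cap-small u uL≤z o)) (≤ᵇ-true (≤-trans (<⇒≤ o<L) L≤))))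

  -- The in-place selection of the next level: the elements ys have been
  -- read, the elements zs have not.
  record Sifted (keep : ℕ → Bool) (ys zs : List ℕ) (base : ℕ → ℕ) (k : ℕ) : Set where
    field
      rest-ok : Segment base (length ys) zs
      kept-ok : Segment base 0 (filterᵇ keep ys)
      kept-length : k ≡ length (filterᵇ keep ys)
  open Sifted public

  length-∷ʳ : ∀ (ys : List ℕ) z → length (ys ++ [ z ]) ≡ suc (length ys)
  length-∷ʳ ys z = trans (length-++ ys) (+-comm (length ys) 1)

  -- The write position never overtakes the read position; otherwise the selection in place would
  -- destroy elements not yet read.
  kept≤ : ∀ {keep ys zs base k} → Sifted keep ys zs base k → k ≤ length ys
  kept≤ {keep} {ys} inv = subst (_≤ length ys)
    (sym (trans (kept-length inv) (length-filterᵇ keep ys))) (count-≤-length keep ys)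

  sifted-drop : ∀ {keep ys z zs base k} → Sifted keep ys (z ∷ zs) base k → keep z ≡ false →
                Sifted keep (ys ++ [ z ]) zs base k
  sifted-drop {keep} {ys} {z} {zs} {base} inv eq = record
    { rest-ok = subst (λ i → Segment base i zs) (sym (length-∷ʳ ys z)) (proj₂ (rest-ok inv))
    ; kept-ok = subst (Segment base 0) (sym (filterᵇ-∷ʳ-false ys eq)) (kept-ok inv)
    ; kept-length = trans (kept-length inv) (cong length (sym (filterᵇ-∷ʳ-false ys eq)))
    }

  sifted-keep : ∀ {keep ys z zs base k} → Sifted keep ys (z ∷ zs) base k → keep z ≡ true →
                Sifted keep (ys ++ [ z ]) zs (upd base k z) (suc k)
  sifted-keep {keep} {ys} {z} {zs} {base} {k} inv eq = record
    { rest-ok = subst (λ i → Segment (upd base k z) i zs) (sym (length-∷ʳ ys z))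
        (segment-cong (suc (length ys)) zs
          (λ i t<i _ → upd-≢ base k z i (λ k≡i → <-irrefl k≡i (≤-<-trans (kept≤ inv) t<i))) (proj₂ (rest-ok inv)))
    ; kept-ok = subst (Segment (upd base k z) 0) (sym (filterᵇ-∷ʳ-true ys eq))
        (segment-∷ʳ 0 (filterᵇ keep ys)
          (segment-cong 0 (filterᵇ keep ys)
            (λ i _ i<k → upd-≢ base k z i (λ k≡i → <-irrefl (trans (sym k≡i) (kept-length inv)) i<k)) (kept-ok inv))
          (trans (cong (upd base k z) (sym (kept-length inv))) (upd-≡ base k z)))
    ; kept-length = sym (trans (cong length (filterᵇ-∷ʳ-true ys eq))
        (trans (length-∷ʳ (filterᵇ keep ys) z) (cong suc (sym (kept-length inv)))))
    }

-- Variable 7 runs through the level, whose length is in 8. The next free places of the arrays 4 and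
-- 5 are in 9 and 10, the number of elements kept for the next level in 12, the current element in
-- 13, the threshold `u * L` in 14, and the bit length of `u + 1` in 15.
scanBody scanLoop : Cmd
scanBody =
  13 ← 3 ⟦ var 7 ⟧ ⨾
  5 ⟦ var 10 ⟧← var 9 ⨾
  10 ← var 10 ⊕ num 1 ⨾
  (test var 13 < var 14 then pass else
    (test var 13 ⊖ var 14 < var 4 then 4 ⟦ var 9 ⟧← var 13 ⊖ var 14 else (4 ⟦ var 9 ⟧← var 4)) ⨾
    9 ← var 9 ⊕ num 1) ⨾
  (test 1 ⟦ var 13 ⊘ var 4 ⟧ < var 15 then pass else
    3 ⟦ var 12 ⟧← var 13 ⨾
    12 ← var 12 ⊕ num 1) ⨾
  7 ← var 7 ⊕ num 1
scanLoop = while 7 < 8 repeat scanBody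

ticks : ∀ k c {τ} → T (k ≤ᵇ c) → k + τ ≤ c + τ
ticks k c {τ} k≤c = +-monoˡ-≤ τ (≤ᵇ⇒≤ k c k≤c)

++-snoc : ∀ (ys : List ℕ) z zs → ys ++ z ∷ zs ≡ (ys ++ [ z ]) ++ zs
++-snoc ys z zs = sym (++-assoc ys [ z ] zs)

module _ (w Z l K : ℕ) (2<Z : 2 < Z) (ZL<W : Z * suc l < 2 ^ w) (L<K : suc l < K)
         (u : ℕ) (xs : List ℕ) (p₀ q₀ : ℕ) (d₀ f₀ : ℕ → ℕ) (lv : ℕ → ℕ)
         (lev-ok : ∀ y → y < Z → lv y ≡ lev y)
         (p-space : p₀ + length xs < Z) (q-space : q₀ + length xs < Z) where
  open Simulation w Z
  open Levels l
  open ScanInvariant l K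

  private
    ≤Z⇒<W : ∀ {x} → x ≤ Z → x < 2 ^ w
    ≤Z⇒<W x≤Z = ≤-<-trans (≤-trans x≤Z (m≤m*n Z L)) ZL<W

    1<W : 1 < 2 ^ w
    1<W = ≤Z⇒<W (≤-trans (s≤s z≤n) (<⇒≤ 2<Z))

    keep : ℕ → Bool
    keep = above (lev (suc u))

  scanLoop-run : ∀ {r0 r1 r3 r5 r6 r11 x₀ r16 a₀ a₂ a₆ a₇ a₈ Q} zs ys {base d f p k τ t q} →
    t ≡ length ys → q ≡ q₀ + length ys →
    xs ≡ ys ++ zs → All (λ x → x / L < Z) zs →
    Filled u xs p₀ q₀ d₀ f₀ (length ys) d f p → Sifted keep ys zs base k →
    (∀ base d f p k x′ τ′ → Filled u xs p₀ q₀ d₀ f₀ (length xs) d f p → Sifted keep xs [] base k →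
      τ′ ≤ suc τ + length zs * 199 →
      Q ⟪ r0 ∷ r1 ∷ Z ∷ r3 ∷ L ∷ r5 ∷ r6 ∷ length xs ∷ length xs ∷ p ∷ q₀ + length xs ∷ r11 ∷ k ∷ x′ ∷ u * L ∷ lev (suc u) ∷ r16 ∷ []
        , a₀ ∷ lv ∷ a₂ ∷ base ∷ d ∷ f ∷ a₆ ∷ a₇ ∷ a₈ ∷ [] , τ′ ⟫) →
    Run scanLoop
      ⟪ r0 ∷ r1 ∷ Z ∷ r3 ∷ L ∷ r5 ∷ r6 ∷ t ∷ length xs ∷ p ∷ q ∷ r11 ∷ k ∷ x₀ ∷ u * L ∷ lev (suc u) ∷ r16 ∷ []
      , a₀ ∷ lv ∷ a₂ ∷ base ∷ d ∷ f ∷ a₆ ∷ a₇ ∷ a₈ ∷ [] , τ ⟫ Q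
  scanLoop-run [] ys refl refl xs≡ all filled sifted k with trans xs≡ (++-identityʳ ys)
  ... | refl = run-exit _ _ ≤-refl (k _ _ _ _ _ _ _ filled sifted (m≤m+n _ _))
  scanLoop-run {r0} {r1} {r3} {r5} {r6} {r11} {x₀} {r16} {a₀} {a₂} {a₆} {a₇} {a₈} {Q}
               (z ∷ zs) ys {base} {d} {f} {p} {k} {τ} refl refl refl (z<Z ∷ all) filled sifted cont =
    run-loop _ _ t<n
      $ run-seq $ run-← (_ , refl , _ , ≤-<-trans (m≤n+m t p₀) t<Z) z (proj₁ (rest-ok sifted)) _
      $ run-seq $ run-⟦⟧← (_ , refl , _ , q<Z) _ (q₀ + t) refl p refl
      $ run-seq $ run-← (_ , 1<W , ≤Z⇒<W (subst (_≤ Z) (+-comm 1 (q₀ + t)) q<Z)) (q₀ + suc t)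
                    (trans (+-comm (q₀ + t) 1) (sym (+-suc q₀ t))) _
      $ run-seq $ run-if {e₁ = var 13} {var 14} _ _ z refl (u * L) refl
          (λ z<uL → run-pass (sift (filled-skip filled z<uL) (ticks 23 100 _)))
          (λ uL≤z → run-seq $ run-if {e₁ = var 13 ⊖ var 14} {var 4} (_ , _ , uL≤z) _ (z ∸ u * L) refl L refl
            (λ lt → run-⟦⟧← (_ , refl , _ , p<Z) (_ , _ , uL≤z) p refl (z ∸ u * L) refl
                     (push (<-trans lt L<K) (λ o _ → cap-small u uL≤z o) (ticks 36 90 _)))
            (λ ge → run-⟦⟧← (_ , refl , _ , p<Z) _ p refl L refl
                     (push L<K (cap-large u uL≤z ge) (ticks 34 90 _))))
    where
    t = length ys
    n = length xs
    t<n : t < n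
    t<n = subst (t <_) (sym (length-++ ys)) (m<m+n t (s≤s z≤n))
    t<Z : p₀ + t < Z
    t<Z = <-trans (+-monoʳ-< p₀ t<n) p-space
    q<Z : q₀ + t < Z
    q<Z = <-trans (+-monoʳ-< q₀ t<n) q-space
    p<Z : p < Z
    p<Z = ≤-<-trans (upper filled) t<Z
    k<Z : k < Z
    k<Z = ≤-<-trans (≤-trans (kept≤ sifted) (m≤n+m t p₀)) t<Z
    f′ = upd f (q₀ + t) p

    -- The branches of the tests meet in the common tails `push`, `sift` and `done`. Their bounds
    -- 90, 100 and 180 cover the dearest way to each tail and stay below the 199 allowed for a
    -- round.
    done : ∀ {base′ d′ p′ k′ τ′} → Filled u xs p₀ q₀ d₀ f₀ (suc t) d′ f′ p′ → Sifted keep (ys ++ [ z ]) zs base′ k′ →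
      τ′ ≤ 180 + τ →
      Run (7 ← var 7 ⊕ num 1)
        ⟪ r0 ∷ r1 ∷ Z ∷ r3 ∷ L ∷ r5 ∷ r6 ∷ t ∷ n ∷ p′ ∷ q₀ + suc t ∷ r11 ∷ k′ ∷ z ∷ u * L ∷ lev (suc u) ∷ r16 ∷ []
        , a₀ ∷ lv ∷ a₂ ∷ base′ ∷ d′ ∷ f′ ∷ a₆ ∷ a₇ ∷ a₈ ∷ [] , τ′ ⟫ (λ s → Run scanLoop s Q)
    done filled′ sifted′ le =
      run-← (_ , 1<W , ≤Z⇒<W (subst (_≤ Z) (+-comm 1 t) (≤-trans (s≤s (m≤n+m t p₀)) t<Z)))
        (suc t) (+-comm t 1) _
        $ scanLoop-run zs (ys ++ [ z ]) (sym (length-∷ʳ ys z)) (cong (q₀ +_) (sym (length-∷ʳ ys z))) (++-snoc ys z zs) all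
            (subst (λ i → Filled u xs p₀ q₀ d₀ f₀ i _ f′ _) (sym (length-∷ʳ ys z)) filled′) sifted′
            (λ _ _ _ _ _ _ _ fl si le′ → cont _ _ _ _ _ _ _ fl si
              (loop-time (length zs) 184 199 _ (≤-trans le′ (+-monoˡ-≤ _ (s≤s (+-monoʳ-≤ 4 le))))))

    sift : ∀ {d′ p′ τ′} → Filled u xs p₀ q₀ d₀ f₀ (suc t) d′ f′ p′ → τ′ ≤ 100 + τ →
      Run ((test 1 ⟦ var 13 ⊘ var 4 ⟧ < var 15 then pass else 3 ⟦ var 12 ⟧← var 13 ⨾ 12 ← var 12 ⊕ num 1) ⨾ 7 ← var 7 ⊕ num 1)
        ⟪ r0 ∷ r1 ∷ Z ∷ r3 ∷ L ∷ r5 ∷ r6 ∷ t ∷ n ∷ p′ ∷ q₀ + suc t ∷ r11 ∷ k ∷ z ∷ u * L ∷ lev (suc u) ∷ r16 ∷ []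
        , a₀ ∷ lv ∷ a₂ ∷ base ∷ d′ ∷ f′ ∷ a₆ ∷ a₇ ∷ a₈ ∷ [] , τ′ ⟫ (λ s → Run scanLoop s Q)
    sift filled′ le = run-seq $ run-if {e₁ = 1 ⟦ var 13 ⊘ var 4 ⟧} {var 15} (_ , refl , _ , z<Z) _
        (lev (z / L)) (lev-ok (z / L) z<Z) (lev (suc u)) refl
        (λ lt → run-pass (done filled′ (sifted-drop sifted (≤ᵇ-false lt)) (≤-trans (+-monoʳ-≤ 11 le) (ticks 111 180 _))))
        (λ ge → run-seq $ run-⟦⟧← (_ , refl , _ , k<Z) _ k refl z refl
              $ run-← (_ , 1<W , ≤Z⇒<W (subst (_≤ Z) (+-comm 1 k) k<Z)) (suc k) (+-comm k 1) _
              $ done filled′ (sifted-keep sifted (≤ᵇ-true ge)) (≤-trans (+-monoʳ-≤ 21 le) (ticks 121 180 _)))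

    push : ∀ {c τ′} → c < K → (∀ o → o < L → (o ≤ᵇ c) ≡ (u * L + o ≤ᵇ z)) → τ′ ≤ 90 + τ →
      Run (9 ← var 9 ⊕ num 1)
        ⟪ r0 ∷ r1 ∷ Z ∷ r3 ∷ L ∷ r5 ∷ r6 ∷ t ∷ n ∷ p ∷ q₀ + suc t ∷ r11 ∷ k ∷ z ∷ u * L ∷ lev (suc u) ∷ r16 ∷ []
        , a₀ ∷ lv ∷ a₂ ∷ base ∷ upd d p c ∷ f′ ∷ a₆ ∷ a₇ ∷ a₈ ∷ [] , τ′ ⟫
        (λ s → Run ((test 1 ⟦ var 13 ⊘ var 4 ⟧ < var 15 then pass else 3 ⟦ var 12 ⟧← var 13 ⨾ 12 ← var 12 ⊕ num 1) ⨾ 7 ← var 7 ⊕ num 1) s (λ s → Run scanLoop s Q))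
    push c<K c-ok le = run-← (_ , 1<W , ≤Z⇒<W (subst (_≤ Z) (+-comm 1 p) p<Z)) (suc p) (+-comm p 1) _
      (sift (filled-push filled c<K c-ok) (≤-trans (+-monoʳ-≤ 4 le) (ticks 94 100 _)))

-- Building all levels

all-filterᵇ : ∀ {P : ℕ → Set} p {xs} → All P xs → All P (filterᵇ p xs)
all-filterᵇ p []               = []
all-filterᵇ p {x ∷ xs} (h ∷ hs) with p x
... | true  = h ∷ all-filterᵇ p hs
... | false = all-filterᵇ p hs

levelBody levelLoop : Cmd
levelBody =
  6 ⟦ var 11 ⟧← var 10 ⨾
  12 ← num 0 ⨾
  7 ← num 0 ⨾
  14 ← var 11 ⊗ var 4 ⨾
  15 ← 1 ⟦ var 11 ⊕ num 1 ⟧ ⨾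
  scanLoop ⨾
  -- The entry for the level as a whole: the scan records a position only before each element.
  5 ⟦ var 10 ⟧← var 9 ⨾
  10 ← var 10 ⊕ num 1 ⨾
  8 ← var 12 ⨾
  11 ← var 11 ⊕ num 1
levelLoop = while 11 < 6 repeat levelBody

module LevelInvariant (l K : ℕ) (A : List ℕ) where
  open Levels l
  open ScanInvariant l K

  members : ℕ → List ℕ
  members u = filterᵇ (above (lev u)) A

  -- A row needs one entry more than the level has elements, for the prefix lengths from 0 to the
  -- size inclusive.
  offset : ℕ → ℕ
  offset = sumTo (λ v → suc (levelSize A v))

  length-members : ∀ u → length (members u) ≡ levelSize A u
  length-members u = length-filterᵇ (above (lev u)) A

  -- The ranks in row v of the array f, relative to the position p₀ of the
  -- array d at which the elements for the threshold v * L begin.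
  Row : ℕ → (ℕ → ℕ) → (ℕ → ℕ) → ℕ → Set
  Row v d f p = Σ[ p₀ ∈ ℕ ] p₀ ≤ p × (∀ r → r ≤ length (members v) →
    f (offset v + r) ≤ p ×
    (∀ o → o < L → rank d o (f (offset v + r)) ≡ rank d o p₀ + count (v * L + o ≤ᵇ_) (take r (members v))))

  record Built (u : ℕ) (d f s : ℕ → ℕ) (p : ℕ) : Set where
    field
      lower   : length A ≤ p
      upper   : p ≤ length A + offset u
      prefix  : ∀ j → j ≤ length A → ∀ o → rank d o j ≡ count (above o) (take j A)
      bounded : ∀ x → x < p → d x < K
      starts  : ∀ v → v < u → s v ≡ offset v
      rows    : ∀ v → v < u → Row v d f p

  offset-mono : ∀ {v u} → v < u → offset v + length (members v) < offset u
  offset-mono {v} {u} v<u = subst (_≤ offset u)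
    (trans (+-suc (offset v) (levelSize A v)) (cong (λ n → suc (offset v + n)) (sym (length-members v))))
    (sumTo-mono (λ v → suc (levelSize A v)) v<u)

  -- Earlier rows occupy `f` below `offset u` and refer to positions of `d` up to `p₀`, whose ranks
  -- depend only on entries before `p₀`. The scan changes neither.
  built-step : ∀ {u d₀ f₀ s p₀ d f p} → Built u d₀ f₀ s p₀ →
    Filled u (members u) p₀ (offset u) d₀ f₀ (length (members u)) d f p →
    Built (suc u) d (upd f (offset u + length (members u)) p) (upd s u (offset u)) p
  built-step {u} {d₀} {f₀} {s} {p₀} {d} {f} {p} inv fl = record
    { lower   = ≤-trans (lower inv) (Filled.lower fl)
    ; upper   = ≤-trans (Filled.upper fl) (≤-trans (+-monoˡ-≤ n (upper inv))
                  (≤-trans (≤-reflexive (+-assoc (length A) (offset u) n))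
                    (+-monoʳ-≤ (length A) (<⇒≤ (offset-mono (n<1+n u))))))
    ; prefix  = λ j j≤ o → trans (rank-cong o j (λ x x<j → Filled.d-frame fl x (<-≤-trans x<j (≤-trans j≤ (lower inv)))))
                                 (prefix inv j j≤ o)
    ; bounded = Filled.bounded fl
    ; starts  = λ v v<1+u → upd-ext {g = offset} u refl (starts inv) v v<1+u
    ; rows    = rows′
    }
    where
    open Built
    n = length (members u)
    f′ = upd f (offset u + n) p

    old : ∀ v → v < u → Row v d f′ p
    old v v<u with rows inv v v<u
    ... | b , b≤p₀ , row = b , ≤-trans b≤p₀ (Filled.lower fl) , λ r r≤ → go r r≤
      where
      rank≡ : ∀ o {a} → a ≤ p₀ → rank d o a ≡ rank d₀ o a
      rank≡ o a≤p₀ = rank-cong o _ (λ x x<a → Filled.d-frame fl x (<-≤-trans x<a a≤p₀))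
      go : ∀ r → r ≤ length (members v) → f′ (offset v + r) ≤ p ×
        (∀ o → o < L → rank d o (f′ (offset v + r)) ≡ rank d o b + count (v * L + o ≤ᵇ_) (take r (members v)))
      go r r≤ with row r r≤
      ... | le , eq = subst (_≤ p) (sym f≡) (≤-trans le (Filled.lower fl)) ,
        λ o o<L → trans (cong (rank d o) f≡) (trans (rank≡ o le)
          (trans (eq o o<L) (cong (_+ _) (sym (rank≡ o b≤p₀)))))
        where
        lt : offset v + r < offset u
        lt = ≤-<-trans (+-monoʳ-≤ (offset v) r≤) (offset-mono v<u)
        f≡ : f′ (offset v + r) ≡ f₀ (offset v + r)
        f≡ = trans (upd-≢ f (offset u + n) p _ (λ e → <-irrefl (sym e) (<-≤-trans lt (m≤m+n (offset u) n))))
                   (Filled.f-frame fl _ lt)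

    new : Row u d f′ p
    new = p₀ , Filled.lower fl , λ r r≤n → case r ≟ n of λ where
      (yes refl) → subst (λ a → a ≤ p × (∀ o → o < L → rank d o a ≡ rank d o p₀ + count (u * L + o ≤ᵇ_) (take n (members u))))
                     (sym (upd-≡ f (offset u + n) p)) (≤-refl , Filled.rank-ok fl)
      (no r≢n)   → subst (λ a → a ≤ p × (∀ o → o < L → rank d o a ≡ rank d o p₀ + count (u * L + o ≤ᵇ_) (take r (members u))))
                     (sym (upd-≢ f (offset u + n) p (offset u + r) (λ e → r≢n (sym (+-cancelˡ-≡ (offset u) n r e)))))
                     (Filled.entries fl r (≤∧≢⇒< r≤n r≢n))

    rows′ : ∀ v → v < suc u → Row v d f′ p
    rows′ v v<1+u with v ≟ u
    ... | yes refl = new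
    ... | no v≢u = old v (≤∧≢⇒< (s≤s⁻¹ v<1+u) v≢u)

  open Built public

module _ (w Z l K : ℕ) (2<Z : 2 < Z) (ZL<W : Z * suc l < 2 ^ w) (L<K : suc l < K)
         (A : List ℕ) (U : ℕ) (U<Z : U < Z) (lv : ℕ → ℕ) (lev-ok : ∀ y → y < Z → lv y ≡ lev y)
         (quotient< : All (λ x → x / suc l < Z) A)
         (space : length A + LevelInvariant.offset l K A U < Z) where
  open Simulation w Z
  open Levels l
  open ScanInvariant l K
  open LevelInvariant l K A

  private
    ≤Z⇒<W : ∀ {x} → x ≤ Z → x < 2 ^ w
    ≤Z⇒<W x≤Z = ≤-<-trans (≤-trans x≤Z (m≤m*n Z L)) ZL<W

    0<W : 0 < 2 ^ w
    0<W = ≤Z⇒<W z≤n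

    1<W : 1 < 2 ^ w
    1<W = ≤Z⇒<W (≤-trans (s≤s z≤n) (<⇒≤ 2<Z))

  -- The time is amortised over the entries of the array 5: a round costs at most 299 for each entry
  -- that it adds, and `offset u` counts the entries so far.
  levelLoop-run : ∀ {r0 r1 r3 r5 r7 r12 r13 r14 r15 r16 a₀ a₂ a₇ a₈ Q} T₀ k u {base d f s p τ} → k + u ≡ U →
    Segment base 0 (members u) → Built u d f s p → τ ≤ T₀ + offset u * 299 →
    (∀ base d f s p n r7 r12 r13 r14 r15 τ′ → Built U d f s p → τ′ ≤ suc (T₀ + offset U * 299) →
      Q ⟪ r0 ∷ r1 ∷ Z ∷ r3 ∷ L ∷ r5 ∷ U ∷ r7 ∷ n ∷ p ∷ offset U ∷ U ∷ r12 ∷ r13 ∷ r14 ∷ r15 ∷ r16 ∷ []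
        , a₀ ∷ lv ∷ a₂ ∷ base ∷ d ∷ f ∷ s ∷ a₇ ∷ a₈ ∷ [] , τ′ ⟫) →
    Run levelLoop
      ⟪ r0 ∷ r1 ∷ Z ∷ r3 ∷ L ∷ r5 ∷ U ∷ r7 ∷ length (members u) ∷ p ∷ offset u ∷ u ∷ r12 ∷ r13 ∷ r14 ∷ r15 ∷ r16 ∷ []
      , a₀ ∷ lv ∷ a₂ ∷ base ∷ d ∷ f ∷ s ∷ a₇ ∷ a₈ ∷ [] , τ ⟫ Q
  levelLoop-run T₀ zero u refl seg built le cont =
    run-exit _ _ ≤-refl (cont _ _ _ _ _ _ _ _ _ _ _ _ built (s≤s le))
  levelLoop-run {a₀ = a₀} {a₂} {a₇} {a₈} {Q} T₀ (suc k) u {base} {d} {f} {s} {p} {τ} eq seg built le cont =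
    run-loop _ _ u<U
      $ run-seq $ run-⟦⟧← (_ , refl , _ , u<Z) _ u refl (offset u) refl
      $ run-seq $ run-← 0<W 0 refl _
      $ run-seq $ run-← 0<W 0 refl _
      $ run-seq $ run-← (_ , _ , ≤-<-trans (*-monoˡ-≤ L (<⇒≤ u<Z)) ZL<W) (u * L) refl _
      $ run-seq $ run-← (_ , refl , (_ , 1<W , ≤Z⇒<W (≤-trans (≤-reflexive (+-comm u 1)) u<Z)) , subst (_< Z) (+-comm 1 u) 1+u<Z)
          (lev (suc u)) (trans (cong lv (+-comm u 1)) (lev-ok (suc u) 1+u<Z)) _
      $ run-seq $ scanLoop-run w Z l K 2<Z ZL<W L<K u (members u) p (offset u) d f lv lev-ok
          (≤-<-trans (≤-trans (+-monoˡ-≤ n (upper built))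
            (≤-trans (≤-reflexive (+-assoc (length A) (offset u) n)) (+-monoʳ-≤ (length A) (<⇒≤ q<)))) space)
          (≤-<-trans (≤-trans (<⇒≤ q<) (m≤n+m _ (length A))) space)
          (members u) [] refl (sym (+-identityʳ (offset u))) refl
          (all-filterᵇ (above (lev u)) quotient<)
          (record { lower = ≤-refl ; upper = ≤-reflexive (sym (+-identityʳ p))
                  ; rank-ok = λ _ _ → sym (+-identityʳ _) ; entries = λ _ () ; d-frame = λ _ _ → refl
                  ; f-frame = λ _ _ → refl ; bounded = Built.bounded built })
          (record { rest-ok = seg ; kept-ok = tt ; kept-length = refl })
          (λ base′ d′ f′ p′ n′ x′ τ′ fl si le′ →
             run-seq $ run-⟦⟧← (_ , refl , _ , q<Z) _ (offset u + n) refl p′ refl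
           $ run-seq $ run-← (_ , 1<W , ≤Z⇒<W (subst (_≤ Z) (+-comm 1 _) q<Z)) (offset (suc u)) next-offset _
           $ run-seq $ run-← _ (length (members (suc u))) (trans (kept-length si) (cong length next-members)) _
           $ run-← (_ , 1<W , ≤Z⇒<W (subst (_≤ Z) (+-comm 1 u) u<Z)) (suc u) (+-comm u 1) _
           $ levelLoop-run T₀ k (suc u) (trans (+-suc k u) eq)
               (subst (Segment base′ 0) next-members (kept-ok si)) (built-step built fl) (time le′) cont)
    where
    n = length (members u)
    u<U : u < U
    u<U = subst (u <_) eq (s≤s (m≤n+m u k))
    u<Z : u < Z
    u<Z = <-trans u<U U<Z
    1+u<Z : suc u < Z
    1+u<Z = ≤-<-trans u<U U<Z
    q< : offset u + n < offset U
    q< = offset-mono u<U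
    q<Z : offset u + n < Z
    q<Z = ≤-<-trans (≤-trans (<⇒≤ q<) (m≤n+m _ (length A))) space
    next-offset : offset u + n + 1 ≡ offset (suc u)
    next-offset = trans (+-assoc (offset u) n 1)
      (cong (offset u +_) (trans (+-comm n 1) (cong suc (length-members u))))
    next-members : filterᵇ (above (lev (suc u))) (members u) ≡ members (suc u)
    next-members = filterᵇ-filterᵇ (above-antitone (lev-mono (n≤1+n u))) A
    time : ∀ {τ′} → τ′ ≤ suc (25 + τ) + n * 199 → 17 + τ′ ≤ T₀ + offset (suc u) * 299
    time {τ′} le′ = begin
      17 + τ′                                  ≤⟨ +-monoʳ-≤ 17 le′ ⟩
      43 + τ + n * 199                         ≤⟨ +-mono-≤ (+-mono-≤ (≤ᵇ⇒≤ 43 299 tt) le) (*-monoʳ-≤ n (≤ᵇ⇒≤ 199 299 tt)) ⟩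
      299 + (T₀ + offset u * 299) + n * 299     ≡⟨ solve 3 (λ a b c → con 299 :+ (a :+ b :* con 299) :+ c :* con 299
                                                     := a :+ (b :+ c :+ con 1) :* con 299) refl T₀ (offset u) n ⟩
      T₀ + (offset u + n + 1) * 299             ≡⟨ cong (λ z → T₀ + z * 299) next-offset ⟩
      T₀ + offset (suc u) * 299                 ∎
      where
      open ≤-Reasoning
      open +-*-Solver using (solve; _:+_; _:*_; _:=_; con)

-- The bit vectors with their suffix sums, and queries by table

bitBody bitLoop sumBody sumLoop : Cmd
bitBody =
  12 ← 4 ⟦ var 7 ⟧ ⊗ var 5 ⊕ var 7 ⊘ var 4 ⨾
  -- Each position is entered only once, so an addition sets its bit.
  7 ⟦ var 12 ⟧← 7 ⟦ var 12 ⟧ ⊕ pow2 (var 7 ⊙ var 4) ⨾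
  7 ← var 7 ⊕ num 1
bitLoop = while 7 < 9 repeat bitBody
sumBody =
  12 ← var 12 ⊖ num 1 ⨾
  -- Going downwards, the same block for the next threshold is already final.
  7 ⟦ var 12 ⟧← 7 ⟦ var 12 ⟧ ⊕ 7 ⟦ var 12 ⊕ var 5 ⟧ ⨾
  8 ⟦ var 12 ⟧← 8 ⟦ var 12 ⊕ num 1 ⟧ ⊕ 2 ⟦ 7 ⟦ var 12 ⟧ ⟧
sumLoop = while 13 < 12 repeat sumBody

indexing : ℕ → Cmd
indexing κ =
  -- The extra block makes room for the end position `p` itself, at which ranks are also taken.
  5 ← var 9 ⊘ var 4 ⊕ num 1 ⨾
  7 ← num 0 ⨾
  bitLoop ⨾
  12 ← num κ ⊗ var 4 ⊗ var 5 ⨾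
  8 ⟦ var 12 ⟧← num 0 ⨾
  13 ← num 0 ⨾
  sumLoop

module _ (w Z l κ : ℕ) (2<Z : 2 < Z) (ZL<W : Z * suc l < 2 ^ w) (2^L≤Z : 2 ^ suc l ≤ Z)
         (d : ℕ → ℕ) (p : ℕ) (p<Z : p < Z) (bounded : ∀ x → x < p → d x < κ * suc l)
         (rows-fit : suc (κ * suc l) * suc (p / suc l) ≤ Z) where
  open Simulation w Z
  open NarrowRank d l (p / suc l)

  private
    ≤Z⇒<W : ∀ {x} → x ≤ Z → x < 2 ^ w
    ≤Z⇒<W x≤Z = ≤-<-trans (≤-trans x≤Z (m≤m*n Z L)) ZL<W

    1<W : 1 < 2 ^ w
    1<W = ≤Z⇒<W (≤-trans (s≤s z≤n) (<⇒≤ 2<Z))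

    0<W : 0 < 2 ^ w
    0<W = ≤Z⇒<W z≤n

    K Y : ℕ
    K = κ * L
    Y = K * NB

    eqBit≤1 : ∀ n y t → eqBit n y t ≤ 1
    eqBit≤1 n y t = ind≤1 _

    geBit≤1 : ∀ n y t → geBit n y t ≤ 1
    geBit≤1 n y t = ind≤1 _

    -- One row of zeros beyond the `K` proper ones, which the last of these reads as its successor.
    Y+NB≤Z : Y + NB ≤ Z
    Y+NB≤Z = subst (_≤ Z) (+-comm NB Y) rows-fit

    Y<Z : Y < Z
    Y<Z = <-≤-trans (m<m+n Y (s≤s z≤n)) Y+NB≤Z

  bitLoop-run : ∀ {r0 r1 r3 r4 r6 r8 r10 r11 r12 r13 r14 r15 r16 a₀ a₁ a₂ a₃ a₅ a₆ a₈ Q} n x {wv τ} → n + x ≡ p → r4 ≡ L →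
    (∀ y → y < Z → wv y ≡ binary (eqBit x y) L) →
    (∀ wv r12 τ′ → (∀ y → y < Z → wv y ≡ binary (eqBit p y) L) → τ′ ≤ suc τ + n * 99 →
      Q ⟪ r0 ∷ r1 ∷ Z ∷ r3 ∷ L ∷ NB ∷ r6 ∷ p ∷ r8 ∷ p ∷ r10 ∷ r11 ∷ r12 ∷ r13 ∷ r14 ∷ r15 ∷ r16 ∷ []
        , a₀ ∷ a₁ ∷ a₂ ∷ a₃ ∷ d ∷ a₅ ∷ a₆ ∷ wv ∷ a₈ ∷ [] , τ′ ⟫) →
    Run bitLoop
      ⟪ r0 ∷ r1 ∷ Z ∷ r3 ∷ r4 ∷ NB ∷ r6 ∷ x ∷ r8 ∷ p ∷ r10 ∷ r11 ∷ r12 ∷ r13 ∷ r14 ∷ r15 ∷ r16 ∷ []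
      , a₀ ∷ a₁ ∷ a₂ ∷ a₃ ∷ d ∷ a₅ ∷ a₆ ∷ wv ∷ a₈ ∷ [] , τ ⟫ Q
  bitLoop-run zero    x refl refl inv cont = run-exit _ _ ≤-refl (cont _ _ _ inv (m≤m+n _ _))
  bitLoop-run (suc n) x {wv} {τ} eq refl inv cont =
    run-loop _ _ x<p
      $ run-seq $ run-← (((_ , refl , _ , <-trans x<p p<Z) , _ , ≤Z⇒<W (≤-trans (m≤m+n _ _) (<⇒≤ y<Z))) , _ , ≤Z⇒<W (<⇒≤ y<Z)) y refl _
      $ run-seq $ run-⟦⟧← (_ , refl , _ , y<Z)
          ((_ , refl , _ , y<Z) , (1<W , _ , subst (_< 2 ^ w) (sym (*-identityˡ (2 ^ (x % L)))) 2^r<W)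
            , subst (_< 2 ^ w) (sym bumped) binary<W)
          y refl (binary (eqBit (suc x) y) L) bumped
      $ run-← (_ , 1<W , ≤Z⇒<W (subst (_≤ Z) (+-comm 1 x) (<-trans x<p p<Z))) (suc x) (+-comm x 1) _
      $ bitLoop-run n (suc x) (trans (+-suc n x) eq) refl inv′
          (λ _ _ _ inv″ le → cont _ _ _ inv″ (loop-time n 36 99 _ le))
    where
    y = cell x
    x<p : x < p
    x<p = subst (x <_) eq (s≤s (m≤n+m x n))
    x/L<NB : x / L < NB
    x/L<NB = s≤s (/-monoˡ-≤ L (<⇒≤ x<p))
    y<Y : y < Y
    y<Y = <-≤-trans (+-monoʳ-< (d x * NB) x/L<NB)
      (subst (_≤ Y) (+-comm NB (d x * NB)) (*-monoˡ-≤ NB (bounded x x<p)))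
    y<Z : y < Z
    y<Z = <-trans y<Y Y<Z
    2^r<W : 2 ^ (x % L) < 2 ^ w
    2^r<W = ≤Z⇒<W (≤-trans (^-monoʳ-≤ 2 (<⇒≤ (m%n<n x L))) 2^L≤Z)
    binary<W : binary (eqBit (suc x) y) L < 2 ^ w
    binary<W = ≤Z⇒<W (<⇒≤ (<-≤-trans (binary< _ L (eqBit≤1 (suc x) y)) 2^L≤Z))
    bumped : wv y + 1 * 2 ^ (x % L) ≡ binary (eqBit (suc x) y) L
    bumped = trans (cong₂ _+_ (inv y y<Z) (*-identityˡ (2 ^ (x % L)))) (sym (insert-≡ x x/L<NB))
    inv′ : ∀ y′ → y′ < Z → upd wv y (binary (eqBit (suc x) y) L) y′ ≡ binary (eqBit (suc x) y′) L
    inv′ y′ y′<Z with y ≟ y′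
    ... | yes refl = upd-≡ wv y _
    ... | no y≢y′ = trans (upd-≢ wv y _ y′ y≢y′) (trans (inv y′ y′<Z) (sym (insert-≢ x y′ y≢y′)))

  record Summed (y : ℕ) (wv cv : ℕ → ℕ) : Set where
    field
      below  : ∀ y′ → y′ < y → wv y′ ≡ binary (eqBit p y′) L
      above  : ∀ y′ → y ≤ y′ → y′ < Z → wv y′ ≡ binary (geBit p y′) L
      counts : ∀ y′ → y ≤ y′ → y′ < Y → cv y′ ≡ cv (suc y′) + pc (wv y′)
      -- Keeps the suffix sums at most `Y * L`, below `Z * L`, so that they fit in a word.
      total  : ∀ y′ → y ≤ y′ → y′ ≤ Y → cv y′ + y′ * L ≤ Y * L
  open Summed

  sumLoop-run : ∀ {r0 r1 r3 r4 r6 r7 r8 r10 r11 r14 r15 r16 a₀ a₁ pv a₃ a₄ a₅ a₆ Q} y {wv cv τ} → y ≤ Y →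
    (∀ y → y < Z → pv y ≡ pc y) → Summed y wv cv →
    (∀ wv cv τ′ → Summed 0 wv cv → τ′ ≤ suc τ + y * 99 →
      Q ⟪ r0 ∷ r1 ∷ Z ∷ r3 ∷ r4 ∷ NB ∷ r6 ∷ r7 ∷ r8 ∷ p ∷ r10 ∷ r11 ∷ 0 ∷ 0 ∷ r14 ∷ r15 ∷ r16 ∷ []
        , a₀ ∷ a₁ ∷ pv ∷ a₃ ∷ a₄ ∷ a₅ ∷ a₆ ∷ wv ∷ cv ∷ [] , τ′ ⟫) →
    Run sumLoop
      ⟪ r0 ∷ r1 ∷ Z ∷ r3 ∷ r4 ∷ NB ∷ r6 ∷ r7 ∷ r8 ∷ p ∷ r10 ∷ r11 ∷ y ∷ 0 ∷ r14 ∷ r15 ∷ r16 ∷ []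
      , a₀ ∷ a₁ ∷ pv ∷ a₃ ∷ a₄ ∷ a₅ ∷ a₆ ∷ wv ∷ cv ∷ [] , τ ⟫ Q
  sumLoop-run zero    y≤Y pc-ok inv cont = run-exit _ _ ≤-refl (cont _ _ _ inv (m≤m+n _ _))
  sumLoop-run {pv = pv} (suc y) {wv} {cv} {τ} y<Y pc-ok inv cont =
    run-loop _ _ (s≤s z≤n)
      $ run-seq $ run-← (_ , 1<W , s≤s z≤n) y refl _
      $ run-seq $ run-⟦⟧← (_ , refl , _ , y<Z)
          ((_ , refl , _ , y<Z) , (_ , refl , (_ , _ , ≤Z⇒<W (<⇒≤ y+NB<Z)) , y+NB<Z)
            , ≤Z⇒<W (subst (_≤ Z) (sym new) (<⇒≤ word<Z)))
          y refl word′ new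
      $ run-⟦⟧← (_ , refl , _ , y<Z)
          ((_ , refl , (_ , 1<W , ≤Z⇒<W (subst (_≤ Z) (+-comm 1 y) y<Z)) , subst (_< Z) (+-comm 1 y) 1+y<Z)
            , (_ , refl , (_ , refl , _ , y<Z) , subst (_< Z) (sym wv′y) word<Z)
            , subst (_< 2 ^ w) (sym count≡) count<W)
          y refl count′ count≡
      $ sumLoop-run y (<⇒≤ y<Y) pc-ok inv′ (λ _ _ _ inv″ le → cont _ _ _ inv″ (loop-time y 52 99 {τ} _ le))
    where
    word′ = binary (geBit p y) L
    wv′ = upd wv y word′
    count′ = cv (suc y) + pc word′
    cv′ = upd cv y count′
    y<Z : y < Z
    y<Z = <-trans y<Y Y<Z
    1+y<Z : suc y < Z
    1+y<Z = ≤-<-trans y<Y Y<Z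
    y+NB<Z : y + NB < Z
    y+NB<Z = <-≤-trans (+-monoˡ-< NB y<Y) Y+NB≤Z
    word<Z : word′ < Z
    word<Z = <-≤-trans (binary< _ L (geBit≤1 p y)) 2^L≤Z
    new : wv y + wv (y + NB) ≡ word′
    new = trans (cong₂ _+_ (below inv y (n<1+n y)) (above inv (y + NB) y< y+NB<Z))
      (trans (sym (binary-+ (eqBit p y) (geBit p (y + NB)) L)) (binary-cong L (λ t _ → sym (geBit-step p y t))))
      where
      y< : suc y ≤ y + NB
      y< = m<m+n y (s≤s z≤n)
    wv′y : wv′ y ≡ word′
    wv′y = upd-≡ wv y word′
    count≡ : cv (y + 1) + pv (wv′ y) ≡ count′
    count≡ = cong₂ _+_ (cong cv (+-comm y 1)) (trans (pc-ok _ (subst (_< Z) (sym wv′y) word<Z)) (cong pc wv′y))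
    pc≤L : pc word′ ≤ L
    pc≤L = subst₂ _≤_ (sym (pc-binary _ L (geBit≤1 p y))) (*-identityʳ L) (sumTo-≤ _ L 1 (geBit≤1 p y))
    total′ : count′ + y * L ≤ Y * L
    total′ = begin
      cv (suc y) + pc word′ + y * L     ≡⟨ +-assoc (cv (suc y)) _ _ ⟩
      cv (suc y) + (pc word′ + y * L)   ≤⟨ +-monoʳ-≤ (cv (suc y)) (+-monoˡ-≤ (y * L) pc≤L) ⟩
      cv (suc y) + suc y * L            ≤⟨ total inv (suc y) ≤-refl y<Y ⟩
      Y * L                             ∎
      where open ≤-Reasoning
    count<W : count′ < 2 ^ w
    count<W = ≤-<-trans (≤-trans (m≤m+n _ _) (≤-trans total′ (*-monoˡ-≤ L (<⇒≤ Y<Z)))) ZL<W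
    later : ∀ y′ → y ≤ y′ → y ≢ y′ → suc y ≤ y′
    later y′ y≤y′ y≢y′ = ≤∧≢⇒< y≤y′ y≢y′
    above′ : ∀ y′ → y ≤ y′ → y′ < Z → wv′ y′ ≡ binary (geBit p y′) L
    above′ y′ y≤y′ y′<Z with y ≟ y′
    ... | yes refl = wv′y
    ... | no y≢y′ = trans (upd-≢ wv y word′ y′ y≢y′) (above inv y′ (later y′ y≤y′ y≢y′) y′<Z)
    counts′ : ∀ y′ → y ≤ y′ → y′ < Y → cv′ y′ ≡ cv′ (suc y′) + pc (wv′ y′)
    counts′ y′ y≤y′ y′<Y with y ≟ y′
    ... | yes refl = trans (upd-≡ cv y count′) (sym (cong₂ (λ a b → a + pc b) (upd-≢ cv y count′ (suc y) (1+n≢n ∘ sym)) wv′y))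
    ... | no y≢y′ = trans (upd-≢ cv y count′ y′ y≢y′) (trans (counts inv y′ (later y′ y≤y′ y≢y′) y′<Y)
          (sym (cong₂ (λ a b → a + pc b) (upd-≢ cv y count′ (suc y′) (<⇒≢ (s≤s y≤y′))) (upd-≢ wv y word′ y′ y≢y′))))
    totals : ∀ y′ → y ≤ y′ → y′ ≤ Y → cv′ y′ + y′ * L ≤ Y * L
    totals y′ y≤y′ y′≤Y with y ≟ y′
    ... | yes refl = subst (λ c → c + y * L ≤ Y * L) (sym (upd-≡ cv y count′)) total′
    ... | no y≢y′ = subst (λ c → c + y′ * L ≤ Y * L) (sym (upd-≢ cv y count′ y′ y≢y′)) (total inv y′ (later y′ y≤y′ y≢y′) y′≤Y)
    inv′ : Summed y wv′ cv′
    inv′ = record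
      { below  = λ y′ y′<y → trans (upd-≢ wv y word′ y′ (≢-sym (<⇒≢ y′<y))) (below inv y′ (m<n⇒m<1+n y′<y))
      ; above  = above′
      ; counts = counts′
      ; total  = totals
      }

  indexing-run : ∀ {r0 r1 r3 r5 r6 r7 r8 r10 r11 r12 r13 r14 r15 r16 a₀ a₁ pv a₃ a₅ a₆ wv cv τ Q} →
    (∀ y → y < Z → pv y ≡ pc y) → (∀ y → y < Z → wv y ≡ 0) → κ < 2 ^ w →
    (∀ wv cv r7 τ′ → Summed 0 wv cv → τ′ ≤ τ + Z * 299 →
      Q ⟪ r0 ∷ r1 ∷ Z ∷ r3 ∷ L ∷ NB ∷ r6 ∷ r7 ∷ r8 ∷ p ∷ r10 ∷ r11 ∷ 0 ∷ 0 ∷ r14 ∷ r15 ∷ r16 ∷ []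
        , a₀ ∷ a₁ ∷ pv ∷ a₃ ∷ d ∷ a₅ ∷ a₆ ∷ wv ∷ cv ∷ [] , τ′ ⟫) →
    Run (indexing κ)
      ⟪ r0 ∷ r1 ∷ Z ∷ r3 ∷ L ∷ r5 ∷ r6 ∷ r7 ∷ r8 ∷ p ∷ r10 ∷ r11 ∷ r12 ∷ r13 ∷ r14 ∷ r15 ∷ r16 ∷ []
      , a₀ ∷ a₁ ∷ pv ∷ a₃ ∷ d ∷ a₅ ∷ a₆ ∷ wv ∷ cv ∷ [] , τ ⟫ Q
  indexing-run {wv = wv} {cv} {τ} pc-ok zero-ok κ<W cont =
    run-seq $ run-← (_ , 1<W , ≤Z⇒<W (subst (_≤ Z) (+-comm 1 (p / L)) (≤-trans (m≤n+m NB Y) Y+NB≤Z))) NB (+-comm (p / L) 1) _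
      $ run-seq $ run-← 0<W 0 refl _
      $ run-seq $ bitLoop-run p 0 (+-identityʳ p) refl
          (λ y y<Z → trans (zero-ok y y<Z) (sym (binary-zero L (λ t _ → refl))))
          (λ wv′ _ τ₁ inv le → run-seq
            $ run-← ((κ<W , _ , ≤Z⇒<W (≤-trans (m≤m*n K NB) (<⇒≤ Y<Z))) , _ , ≤Z⇒<W (<⇒≤ Y<Z)) Y refl _
            $ run-seq $ run-⟦⟧← (_ , refl , _ , Y<Z) 0<W Y refl 0 refl
            $ run-seq $ run-← 0<W 0 refl _
            $ sumLoop-run Y ≤-refl pc-ok
                (record { below = λ y y<Y → inv y (<-trans y<Y Y<Z)
                        ; above = λ y Y≤y y<Z → trans (inv y y<Z) (binary-cong L (λ t _ →
                            let eq , ge = top-row p K y bounded Y≤y t in trans eq (sym ge)))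
                        ; counts = λ y Y≤y y<Y → contradiction (<-≤-trans y<Y Y≤y) (<-irrefl refl)
                        ; total = λ y Y≤y y≤Y → top y (≤-antisym Y≤y y≤Y) })
                (λ _ _ _ inv′ le′ → cont _ _ _ _ inv′ (time le le′)))
    where
    top : ∀ y → Y ≡ y → upd cv Y 0 y + y * L ≤ Y * L
    top y refl = ≤-reflexive (cong (_+ Y * L) (upd-≡ cv Y 0))
    time : ∀ {τ₁ τ₂} → τ₁ ≤ suc (8 + τ) + p * 99 → τ₂ ≤ suc (15 + τ₁) + Y * 99 → τ₂ ≤ τ + Z * 299
    time {τ₁} {τ₂} le le′ = begin
      τ₂                                   ≤⟨ le′ ⟩
      16 + τ₁ + Y * 99                     ≤⟨ +-monoˡ-≤ (Y * 99) (+-monoʳ-≤ 16 le) ⟩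
      16 + (9 + τ + p * 99) + Y * 99       ≤⟨ +-mono-≤ (+-monoʳ-≤ 16 (+-monoʳ-≤ (9 + τ) (*-monoˡ-≤ 99 (<⇒≤ p<Z)))) (*-monoˡ-≤ 99 (<⇒≤ Y<Z)) ⟩
      16 + (9 + τ + Z * 99) + Z * 99       ≡⟨ solve 2 (λ t z → con 16 :+ (con 9 :+ t :+ z :* con 99) :+ z :* con 99
                                                 := con 25 :+ (t :+ z :* con 198)) refl τ Z ⟩
      25 + (τ + Z * 198)                   ≤⟨ +-monoˡ-≤ (τ + Z * 198) (≤-trans (≤ᵇ⇒≤ 25 101 tt) (*-monoˡ-≤ 101 (≤-trans (s≤s z≤n) (<⇒≤ 2<Z)))) ⟩
      Z * 101 + (τ + Z * 198)              ≡⟨ solve 2 (λ t z → z :* con 101 :+ (t :+ z :* con 198) := t :+ z :* con 299) refl τ Z ⟩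
      τ + Z * 299                          ∎
      where
      open ≤-Reasoning
      open +-*-Solver using (solve; _:+_; _:*_; _:=_; con)

-- The suffix sums continue through all later rows, so that only differences
-- within one row are meaningful.
suffixExp : Reg → Reg → Exp
suffixExp x o = 8 ⟦ y ⊕ num 1 ⟧ ⊕ 2 ⟦ 7 ⟦ y ⟧ ≫ (var x ⊙ var 4) ⟧
  where
  y : Exp
  y = var o ⊗ var 5 ⊕ var x ⊘ var 4

tableQueryBody tableQuery : Cmd
tableQueryBody =
  8 ← 1 ⟦ var 7 ⟧ ⨾
  -- `suffixExp` takes registers, so position 0 must first be placed in one. Suffix counts decrease
  -- with the position, which is why the left end is the minuend.
  9 ← num 0 ⨾
  9 ← suffixExp 9 8 ⊖ suffixExp 0 8 ⨾
  10 ← 6 ⟦ var 7 ⟧ ⨾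
  11 ← 5 ⟦ var 10 ⊕ var 9 ⟧ ⨾
  12 ← 5 ⟦ var 10 ⟧ ⨾
  13 ← var 1 ⊙ var 4 ⨾
  0 ← suffixExp 12 13 ⊖ suffixExp 11 13
tableQuery =
  7 ← var 1 ⊘ var 4 ⨾
  (test var 7 < var 6 then tableQueryBody else 0 ← num 0)

-- Against a common total, suffix counts differ as ranks do with the order reversed. The inequality
-- is delivered too, since a subtraction is safe only with it.
difference : ∀ {a b t} x y c → a + x ≡ t → b + y ≡ t → y ≡ x + c → b ≤ a × a ∸ b ≡ c
difference {a} {b} {t} x y c a+x b+y y≡ = subst (b ≤_) (sym a≡) (m≤m+n b c) , trans (cong (_∸ b) a≡) (m+n∸m≡n b c)
  where
  open ≡-Reasoning
  a≡ : a ≡ b + c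
  a≡ = +-cancelʳ-≡ x a (b + c) (begin
    a + x         ≡⟨ trans a+x (sym b+y) ⟩
    b + y         ≡⟨ cong (b +_) (trans y≡ (+-comm x c)) ⟩
    b + (c + x)   ≡⟨ +-assoc b c x ⟨
    b + c + x     ∎)

module _ (w Z l κ : ℕ) (2<Z : 2 < Z) (ZL<W : Z * suc l < 2 ^ w) (2^L≤Z : 2 ^ suc l ≤ Z)
         (d : ℕ → ℕ) (p : ℕ) (p<Z : p < Z) (bounded : ∀ x → x < p → d x < κ * suc l)
         (rows-fit : suc (κ * suc l) * suc (p / suc l) ≤ Z)
         (wv cv pv : ℕ → ℕ) (pc-ok : ∀ y → y < Z → pv y ≡ pc y)
         (summed : Summed w Z l κ 2<Z ZL<W 2^L≤Z d p p<Z bounded rows-fit 0 wv cv) where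
  open Simulation w Z
  open NarrowRank d l (p / suc l)

  private
    module S = Summed summed

    ≤Z⇒<W : ∀ {x} → x ≤ Z → x < 2 ^ w
    ≤Z⇒<W x≤Z = ≤-<-trans (≤-trans x≤Z (m≤m*n Z L)) ZL<W

    1<W : 1 < 2 ^ w
    1<W = ≤Z⇒<W (≤-trans (s≤s z≤n) (<⇒≤ 2<Z))

    K Y : ℕ
    K = κ * L
    Y = K * NB

    Y<Z : Y < Z
    Y<Z = <-≤-trans (m<m+n Y (s≤s z≤n)) (subst (_≤ Z) (+-comm NB Y) rows-fit)

    words : ∀ y → y < Y → wv y ≡ binary (geBit p y) L
    words y y<Y = S.above y z≤n (<-trans y<Y Y<Z)

    counts : ∀ y → y < Y → cv y ≡ cv (suc y) + pc (wv y)
    counts y y<Y = S.counts y z≤n y<Y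

    suffix : ℕ → ℕ → ℕ
    suffix = suffixRank p Y wv cv words counts

    x/L<NB : ∀ {x} → x ≤ p → x / L < NB
    x/L<NB x≤p = s≤s (/-monoˡ-≤ L x≤p)

  suffix-total : ∀ {x o} → x ≤ p → o < K → suffix x o + rank d o x ≡ cv (o * NB)
  suffix-total {x} {o} x≤p o<K =
    suffixRank-rank p Y wv cv words counts o (*-monoˡ-≤ NB o<K) x x≤p (x/L<NB x≤p)

  module _ {r0 r1 r3 r6 : ℕ} {rest : List ℕ} {a₀ a₁ a₃ a₄ a₅ a₆ : ℕ → ℕ} {τ : ℕ} where

    private
      s : AState
      s = ⟪ r0 ∷ r1 ∷ Z ∷ r3 ∷ L ∷ NB ∷ r6 ∷ rest , a₀ ∷ a₁ ∷ pv ∷ a₃ ∷ a₄ ∷ a₅ ∷ a₆ ∷ wv ∷ cv ∷ [] , τ ⟫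

    suffix-safe : ∀ x o → T (x <ᵇ numVars) → T (o <ᵇ numVars) → var# s x ≤ p → var# s o < K →
                  Safe (suffixExp x o) s × eval (suffixExp x o) s ≡ suffix (var# s x) (var# s o)
    suffix-safe x o x< o< x≤p o<K =
      ( (_ , refl , (safe-y , 1<W , ≤Z⇒<W (subst (_≤ Z) (+-comm 1 y) (<⇒≤ 1+y<Z))) , subst (_< Z) (+-comm 1 y) 1+y<Z)
      , (_ , refl , ((_ , refl , safe-y , y<Z) , (x< , _ , _) , _) , shifted<Z)
      , subst (_< 2 ^ w) (sym eval≡) suffix<W) , eval≡
      where
      y = var# s o * NB + var# s x / L
      y<Y : y < Y
      y<Y = in-row p Y wv cv words counts (var# s o) (*-monoˡ-≤ NB o<K) (x/L<NB x≤p)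
      y<Z : y < Z
      y<Z = <-trans y<Y Y<Z
      1+y<Z : suc y < Z
      1+y<Z = ≤-<-trans y<Y Y<Z
      safe-y : Safe (var o ⊗ var 5 ⊕ var x ⊘ var 4) s
      safe-y = (o< , _ , ≤Z⇒<W (≤-trans (m≤m+n _ _) (<⇒≤ y<Z))) , (x< , _ , _) , ≤Z⇒<W (<⇒≤ y<Z)
      shifted<Z : wv y /₀ 2 ^ (var# s x % L) < Z
      shifted<Z = ≤-<-trans (/₀-≤ (wv y) (2 ^ (var# s x % L))) (<-≤-trans
        (subst (_< 2 ^ L) (sym (words y y<Y)) (binary< (geBit p y) L (λ t → ind≤1 ((pos y t <ᵇ p) ∧ (y / NB ≤ᵇ d (pos y t)))))) 2^L≤Z)
      eval≡ : cv (y + 1) + pv (wv y /₀ 2 ^ (var# s x % L)) ≡ suffix (var# s x) (var# s o)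
      eval≡ = cong₂ _+_ (cong cv (+-comm y 1)) (pc-ok _ shifted<Z)
      suffix<W : suffix (var# s x) (var# s o) < 2 ^ w
      suffix<W = ≤-<-trans (≤-trans (m≤m+n _ (rank d (var# s o) (var# s x)))
        (≤-trans (≤-reflexive (suffix-total x≤p o<K))
        (≤-trans (m≤m+n _ _) (≤-trans (S.total _ z≤n (*-monoˡ-≤ NB (<⇒≤ o<K))) (*-monoˡ-≤ L (<⇒≤ Y<Z)))))) ZL<W

  module _ (A : List ℕ) (U : ℕ) (U<Z : U < Z) (lv : ℕ → ℕ) (lev-ok : ∀ y → y < Z → lv y ≡ lev y)
           (lev<K : ∀ u → u < U → lev u < κ * suc l) (L<K : suc l < κ * suc l)
           (quotient<U : All (λ x → x / suc l < U) A)
           (f s : ℕ → ℕ) (built : LevelInvariant.Built l (κ * suc l) A U d f s p)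
           (space : length A + LevelInvariant.offset l (κ * suc l) A U < Z) where
    open Levels l using (above; above-threshold)
    open LevelInvariant l (κ * suc l) A

    private
      module B = Built built

    none : ∀ v j xs → All (λ x → x / L < U) xs → U ≤ v / L → count (v ≤ᵇ_) (take j xs) ≡ 0
    none v zero    xs       all       U≤ = refl
    none v (suc j) []       all       U≤ = refl
    none v (suc j) (x ∷ xs) (h ∷ all) U≤ = cong₂ _+_
      (cong ind (≤ᵇ-false {v} {x} (≰⇒> (λ v≤x → <-irrefl refl (<-≤-trans h (≤-trans U≤ (/-monoˡ-≤ {v} {x} L v≤x)))))))
      (none v j xs all U≤)

    tableQuery-run : ∀ {r3 r7 r8 r9 r10 r11 r12 r13 r14 r15 r16 a₀ a₃ τ Q} j v → j ≤ length A →
      (∀ r7 r8 r9 r10 r11 r12 r13 τ′ → τ′ ≤ 500 + τ →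
        Q ⟪ rangeCount A j v ∷ v ∷ Z ∷ r3 ∷ L ∷ NB ∷ U ∷ r7 ∷ r8 ∷ r9 ∷ r10 ∷ r11 ∷ r12 ∷ r13 ∷ r14 ∷ r15 ∷ r16 ∷ []
          , a₀ ∷ lv ∷ pv ∷ a₃ ∷ d ∷ f ∷ s ∷ wv ∷ cv ∷ [] , τ′ ⟫) →
      Run tableQuery
        ⟪ j ∷ v ∷ Z ∷ r3 ∷ L ∷ NB ∷ U ∷ r7 ∷ r8 ∷ r9 ∷ r10 ∷ r11 ∷ r12 ∷ r13 ∷ r14 ∷ r15 ∷ r16 ∷ []
        , a₀ ∷ lv ∷ pv ∷ a₃ ∷ d ∷ f ∷ s ∷ wv ∷ cv ∷ [] , τ ⟫ Q
    tableQuery-run {r3} {r7} {r8} {r9} {r10} {r11} {r12} {r13} {r14} {r15} {r16} {a₀} {a₃} {τ} {Q} j v j≤m cont =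
      run-seq $ run-← _ (v / L) refl _
      $ run-if {e₁ = var 7} {var 6} _ _ (v / L) refl U refl
          (λ u<U → found u<U)
          (λ U≤u → run-← 0<W (rangeCount A j v)
            (sym (trans (rangeCount-count A j v) (none v j A quotient<U U≤u))) _
            (cont _ _ _ _ _ _ _ _ (ticks 9 500 _)))
      where
      0<W : 0 < 2 ^ w
      0<W = ≤Z⇒<W z≤n
      u = v / L
      ℓ = lev u
      o = v % L
      found : u < U → Run tableQueryBody
        ⟪ j ∷ v ∷ Z ∷ r3 ∷ L ∷ NB ∷ U ∷ u ∷ r8 ∷ r9 ∷ r10 ∷ r11 ∷ r12 ∷ r13 ∷ r14 ∷ r15 ∷ r16 ∷ []
        , a₀ ∷ lv ∷ pv ∷ a₃ ∷ d ∷ f ∷ s ∷ wv ∷ cv ∷ [] , 7 + τ ⟫ Q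
      found u<U with B.rows u u<U
      ... | p₀ , p₀≤p , row =
        run-seq $ run-← (_ , refl , _ , u<Z) ℓ (lev-ok u u<Z) _
        $ run-seq $ run-← 0<W 0 refl _
        $ run-seq $ run-← (proj₁ from-zero , proj₁ from-j , subst₂ _≤_ (sym (proj₂ from-j)) (sym (proj₂ from-zero)) (proj₁ r-ok))
            r (trans (cong₂ _∸_ (proj₂ from-zero) (proj₂ from-j)) (proj₂ r-ok)) _
        $ run-seq $ run-← (_ , refl , _ , u<Z) (offset u) (B.starts u u<U) _
        $ run-seq $ run-← (_ , refl , (_ , _ , ≤Z⇒<W (<⇒≤ end<Z)) , end<Z) end refl _
        $ run-seq $ run-← (_ , refl , _ , ≤-<-trans (m≤m+n _ _) end<Z) begin refl _
        $ run-seq $ run-← _ o refl _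
        $ run-← (proj₁ begin-ok , proj₁ end-ok , subst₂ _≤_ (sym (proj₂ end-ok)) (sym (proj₂ begin-ok)) (proj₁ answer-ok))
            (rangeCount A j v) (trans (cong₂ _∸_ (proj₂ begin-ok) (proj₂ end-ok)) (proj₂ answer-ok)) _
            (cont _ _ _ _ _ _ _ _ (ticks 191 500 _))
        where
        u<Z : u < Z
        u<Z = <-trans u<U U<Z
        r n end begin : ℕ
        r = count (above ℓ) (take j A)
        n = length (members u)
        end = f (offset u + r)
        begin = f (offset u)
        r≤n : r ≤ n
        r≤n = ≤-trans (count-take-≤ (above ℓ) j A) (≤-reflexive (sym (length-members u)))
        end<Z : offset u + r < Z
        end<Z = <-trans (≤-<-trans (+-monoʳ-≤ (offset u) r≤n) (offset-mono u<U)) (≤-<-trans (m≤n+m _ (length A)) space)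
        o<K : o < κ * L
        o<K = <-trans (m%n<n v L) L<K
        j≤p : j ≤ p
        j≤p = ≤-trans j≤m B.lower
        end≤p : end ≤ p
        end≤p = proj₁ (row r r≤n)
        begin≡ : f (offset u + 0) ≡ begin
        begin≡ = cong f (+-identityʳ (offset u))
        begin≤p : begin ≤ p
        begin≤p = subst (_≤ p) begin≡ (proj₁ (row 0 z≤n))
        from-zero = suffix-safe {j} {v} {r3} {U} {u ∷ ℓ ∷ 0 ∷ r10 ∷ r11 ∷ r12 ∷ r13 ∷ r14 ∷ r15 ∷ r16 ∷ []} {a₀} {lv} {a₃} {d} {f} {s} {0}
                    9 8 _ _ z≤n (lev<K u u<U)
        from-j = suffix-safe {j} {v} {r3} {U} {u ∷ ℓ ∷ 0 ∷ r10 ∷ r11 ∷ r12 ∷ r13 ∷ r14 ∷ r15 ∷ r16 ∷ []} {a₀} {lv} {a₃} {d} {f} {s} {0}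
                    0 8 _ _ j≤p (lev<K u u<U)
        r-ok : suffix j ℓ ≤ suffix 0 ℓ × suffix 0 ℓ ∸ suffix j ℓ ≡ r
        r-ok = difference 0 (rank d ℓ j) r (suffix-total z≤n (lev<K u u<U)) (suffix-total j≤p (lev<K u u<U)) (B.prefix j j≤m ℓ)
        begin-ok = suffix-safe {j} {v} {r3} {U} {u ∷ ℓ ∷ r ∷ offset u ∷ end ∷ begin ∷ o ∷ r14 ∷ r15 ∷ r16 ∷ []} {a₀} {lv} {a₃} {d} {f} {s} {0}
                     12 13 _ _ begin≤p o<K
        end-ok = suffix-safe {j} {v} {r3} {U} {u ∷ ℓ ∷ r ∷ offset u ∷ end ∷ begin ∷ o ∷ r14 ∷ r15 ∷ r16 ∷ []} {a₀} {lv} {a₃} {d} {f} {s} {0}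
                   11 13 _ _ end≤p o<K
        v≡ : u * L + o ≡ v
        v≡ = trans (+-comm (u * L) o) (sym (m≡m%n+[m/n]*n v L))
        counted : count (u * L + o ≤ᵇ_) (take r (members u)) ≡ rangeCount A j v
        counted = trans (count-take-filterᵇ (above-threshold u) j A)
          (trans (cong (λ z → count (z ≤ᵇ_) (take j A)) v≡) (sym (rangeCount-count A j v)))
        -- The starting position of a row is not stored as such; the entry for the empty prefix has
        -- the same ranks.
        ranks : rank d o end ≡ rank d o begin + rangeCount A j v
        ranks = trans (proj₂ (row r r≤n) o (m%n<n v L)) (cong₂ _+_
          (sym (trans (cong (rank d o) (sym begin≡)) (trans (proj₂ (row 0 z≤n) o (m%n<n v L)) (+-identityʳ _)))) counted)
        answer-ok : suffix end o ≤ suffix begin o × suffix begin o ∸ suffix end o ≡ rangeCount A j v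
        answer-ok = difference (rank d o begin) (rank d o end) (rangeCount A j v)
          (suffix-total begin≤p o<K) (suffix-total end≤p o<K) ranks

-- The complete construction for large m

copyBody copyLoop : Cmd
copyBody =
  4 ⟦ var 7 ⟧← 1 ⟦ 0 ⟦ var 7 ⟧ ⊘ var 4 ⟧ ⨾
  3 ⟦ var 7 ⟧← 0 ⟦ var 7 ⟧ ⨾
  7 ← var 7 ⊕ num 1
copyLoop = while 7 < 1 repeat copyBody

build : ℕ → ℕ → Cmd
build G κ =
  tables ⨾
  -- The bit length of m is ⌊log₂ m⌋ + 1.
  4 ← 1 ⟦ var 0 ⟧ ⊖ num 1 ⨾
  6 ← num G ⊗ var 0 ⨾
  7 ← num 0 ⨾
  copyLoop ⨾
  8 ← var 1 ⨾
  9 ← var 1 ⨾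
  10 ← num 0 ⨾
  11 ← num 0 ⨾
  levelLoop ⨾
  indexing κ

segment-reads : ∀ {f g : ℕ → ℕ} k xs → (∀ i → i < length xs → g (k + i) ≡ f (k + i)) → Segment f k xs → Segment g k xs
segment-reads {f} {g} k xs eq = segment-cong k xs λ i k≤i i< →
  subst (λ j → g j ≡ f j) (m+[n∸m]≡n k≤i)
    (eq (i ∸ k) (+-cancelˡ-< k _ _ (subst (_< k + length xs) (sym (m+[n∸m]≡n k≤i)) i<)))

segment-all : ∀ {P : ℕ → Set} {f} k xs → Segment f k xs → All P xs → ∀ i → i < length xs → P (f (k + i))
segment-all {P} {f} k (x ∷ xs) (h , hs) (px ∷ pxs) zero    _       = subst P (sym (trans (cong f (+-identityʳ k)) h)) px
segment-all {P} {f} k (x ∷ xs) (h , hs) (px ∷ pxs) (suc i) (s≤s p) =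
  subst P (cong f (sym (+-suc k i))) (segment-all {P} (suc k) xs hs pxs i p)

segment-sum : ∀ {f} (q : ℕ → Bool) k xs → Segment f k xs → ∀ j → j ≤ length xs →
  sumTo (λ i → ind (q (f (k + i)))) j ≡ count q (take j xs)
segment-sum q k xs       _        zero    _       = refl
segment-sum {f} q k (x ∷ xs) (h , hs) (suc j) (s≤s p) = begin
  sumTo (λ i → ind (q (f (k + i)))) (suc j)
    ≡⟨ sumTo-split (λ i → ind (q (f (k + i)))) 1 j ⟩
  ind (q (f (k + 0))) + sumTo (λ i → ind (q (f (k + suc i)))) j
    ≡⟨ cong₂ _+_ (cong (ind ∘ q) (trans (cong f (+-identityʳ k)) h))
         (sumTo-cong j (λ i _ → cong (ind ∘ q ∘ f) (+-suc k i))) ⟩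
  ind (q x) + sumTo (λ i → ind (q (f (suc k + i)))) j
    ≡⟨ cong (ind (q x) +_) (segment-sum q (suc k) xs hs j p) ⟩
  ind (q x) + count q (take j xs) ∎
  where open ≡-Reasoning

module _ (w Z l : ℕ) (2<Z : 2 < Z) (ZL<W : Z * suc l < 2 ^ w)
         (a lv : ℕ → ℕ) (m′ : ℕ) (m′<Z : m′ < Z) (lev-ok : ∀ y → y < Z → lv y ≡ lev y)
         (quotient< : ∀ y → y < m′ → a y / suc l < Z) where
  open Simulation w Z

  private
    L : ℕ
    L = suc l

    ≤Z⇒<W : ∀ {x} → x ≤ Z → x < 2 ^ w
    ≤Z⇒<W x≤Z = ≤-<-trans (≤-trans x≤Z (m≤m*n Z L)) ZL<W

    1<W : 1 < 2 ^ w
    1<W = ≤Z⇒<W (≤-trans (s≤s z≤n) (<⇒≤ 2<Z))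

  copyLoop-run : ∀ {r0 r3 r5 r6 r8 r9 r10 r11 r12 r13 r14 r15 r16 a₂ a₅ a₆ a₇ a₈ Q} n x {base d τ} → n + x ≡ m′ →
    (∀ y → y < x → d y ≡ lev (a y / L)) → (∀ y → y < x → base y ≡ a y) →
    (∀ base d τ′ → (∀ y → y < m′ → d y ≡ lev (a y / L)) → (∀ y → y < m′ → base y ≡ a y) → τ′ ≤ suc τ + n * 99 →
      Q ⟪ r0 ∷ m′ ∷ Z ∷ r3 ∷ L ∷ r5 ∷ r6 ∷ m′ ∷ r8 ∷ r9 ∷ r10 ∷ r11 ∷ r12 ∷ r13 ∷ r14 ∷ r15 ∷ r16 ∷ []
        , a ∷ lv ∷ a₂ ∷ base ∷ d ∷ a₅ ∷ a₆ ∷ a₇ ∷ a₈ ∷ [] , τ′ ⟫) →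
    Run copyLoop
      ⟪ r0 ∷ m′ ∷ Z ∷ r3 ∷ L ∷ r5 ∷ r6 ∷ x ∷ r8 ∷ r9 ∷ r10 ∷ r11 ∷ r12 ∷ r13 ∷ r14 ∷ r15 ∷ r16 ∷ []
      , a ∷ lv ∷ a₂ ∷ base ∷ d ∷ a₅ ∷ a₆ ∷ a₇ ∷ a₈ ∷ [] , τ ⟫ Q
  copyLoop-run zero    x refl d-ok base-ok cont = run-exit _ _ ≤-refl (cont _ _ _ d-ok base-ok (m≤m+n _ _))
  copyLoop-run (suc n) x {base} {d} eq d-ok base-ok cont =
    run-loop _ _ x<m′
      $ run-seq $ run-⟦⟧← (_ , refl , _ , x<Z) (_ , refl , ((_ , refl , _ , x<Z) , _) , quotient< x x<m′)
          x refl (lev (a x / L)) (lev-ok _ (quotient< x x<m′))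
      $ run-seq $ run-⟦⟧← (_ , refl , _ , x<Z) (_ , refl , _ , x<Z) x refl (a x) refl
      $ run-← (_ , 1<W , ≤Z⇒<W (subst (_≤ Z) (+-comm 1 x) x<Z)) (suc x) (+-comm x 1) _
      $ copyLoop-run n (suc x) (trans (+-suc n x) eq)
          (upd-ext {g = λ y → lev (a y / L)} x refl d-ok) (upd-ext {g = a} x refl base-ok)
          (λ _ _ _ d-ok′ base-ok′ le → cont _ _ _ d-ok′ base-ok′ (loop-time n 36 99 _ le))
    where
    x<m′ : x < m′
    x<m′ = subst (x <_) eq (s≤s (m≤n+m x n))
    x<Z : x < Z
    x<Z = <-trans x<m′ m′<Z

-- Sizes that make the construction fit: the thresholds u * L with u < G * m
-- cover all values, κ * L bounds the entries of the array d, and Z is the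
-- stride of the arrays.
record Sizes (w Z l κ G m : ℕ) (A : List ℕ) : Set where
  field
    2<Z       : 2 < Z
    ZL<W      : Z * suc l < 2 ^ w
    space     : 9 * Z ≤ 2 ^ w
    lev-m     : lev m ≡ suc (suc l)
    m<Z       : m < Z
    L<K       : suc l < κ * suc l
    2^L≤Z     : 2 ^ suc l ≤ Z
    κ≤Z       : κ ≤ Z
    G≤Z       : G ≤ Z
    U<Z       : G * m < Z
    quotient< : All (λ x → x / suc l < G * m) A
    lev<K     : ∀ u → u < G * m → lev u < κ * suc l
    slots     : length A + LevelInvariant.offset l (κ * suc l) A (G * m) < Z
    rows-fit  : ∀ p → p ≤ length A + LevelInvariant.offset l (κ * suc l) A (G * m) →
                suc (κ * suc l) * suc (p / suc l) ≤ Z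

-- Variables 2 to 6 and the arrays come back unchanged, while the remaining ten variables may change
-- freely. Hence any number of queries can follow one another.
Serves : ∀ (w Z : ℕ) → Cmd → ℕ → List ℕ → List ℕ → List (ℕ → ℕ) → Set
Serves w Z query D A fixed arrs = ∀ j v junk τ → length junk ≡ 10 → j ≤ length A →
  Simulation.Run w Z query ⟪ j ∷ v ∷ fixed ++ junk , arrs , τ ⟫ (λ s → Σ[ junk′ ∈ List ℕ ] ∃[ τ′ ]
    length junk′ ≡ 10 × τ′ ≤ D + τ × s ≡ ⟪ rangeCount A j v ∷ v ∷ fixed ++ junk′ , arrs , τ′ ⟫)

module _ {w Z l κ G m : ℕ} {A : List ℕ} (sizes : Sizes w Z l κ G m A) where
  open Sizes sizes
  open Simulation w Z
  open LevelInvariant l (κ * suc l) A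

  private
    L K U : ℕ
    L = suc l
    K = κ * L
    U = G * m

    ≤Z⇒<W : ∀ {x} → x ≤ Z → x < 2 ^ w
    ≤Z⇒<W x≤Z = ≤-<-trans (≤-trans x≤Z (m≤m*n Z L)) ZL<W

    1<W : 1 < 2 ^ w
    1<W = ≤Z⇒<W (≤-trans (s≤s z≤n) (<⇒≤ 2<Z))

    0<W : 0 < 2 ^ w
    0<W = ≤Z⇒<W z≤n

    0<Z : 0 < Z
    0<Z = <-trans (s≤s z≤n) 2<Z

  all-weaken : ∀ {P Q : ℕ → Set} → (∀ {x} → P x → Q x) → ∀ {xs} → All P xs → All Q xs
  all-weaken imp []       = []
  all-weaken imp (h ∷ hs) = imp h ∷ all-weaken imp hs

  build-run : ∀ {r3 r4 r5 r6 r7 r8 r9 r10 r11 r12 r13 r14 r15 r16 a lv pv base d f s wv cv τ Q} →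
    Segment a 0 A →
    (∀ NB arrs r0 r1 junk τ′ → length junk ≡ 10 → Serves w Z tableQuery 500 A (Z ∷ r3 ∷ L ∷ NB ∷ U ∷ []) arrs →
      τ′ ≤ τ + Z * 999 → Q ⟪ r0 ∷ r1 ∷ Z ∷ r3 ∷ L ∷ NB ∷ U ∷ junk , arrs , τ′ ⟫) →
    Run (build G κ)
      ⟪ m ∷ length A ∷ Z ∷ r3 ∷ r4 ∷ r5 ∷ r6 ∷ r7 ∷ r8 ∷ r9 ∷ r10 ∷ r11 ∷ r12 ∷ r13 ∷ r14 ∷ r15 ∷ r16 ∷ []
      , a ∷ lv ∷ pv ∷ base ∷ d ∷ f ∷ s ∷ wv ∷ cv ∷ [] , τ ⟫ Q
  build-run {r3 = r3} {a = a} {τ = τ} {Q} seg cont =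
    run-seq $ run-seq (run-⟦⟧← (_ , refl , 0<W , 0<Z) 0<W 0 refl 0 refl
      $ run-seq $ run-⟦⟧← (_ , refl , 0<W , 0<Z) 0<W 0 refl 0 refl
      $ run-seq $ run-⟦⟧← (_ , refl , 0<W , 0<Z) 0<W 0 refl 0 refl
      $ run-seq $ run-← 1<W 1 refl _
      $ tablesLoop-run w Z 2<Z (≤Z⇒<W ≤-refl) (Z ∸ 1) 0
          (trans (+-comm (Z ∸ 1) 1) (m+[n∸m]≡n 0<Z))
          (record { lev-ok = λ { zero _ → sym lev-zero ; (suc _) (s≤s ()) }
                  ; pc-ok = λ { zero _ → sym pc-zero ; (suc _) (s≤s ()) }
                  ; zero-ok = λ { zero _ → refl ; (suc _) (s≤s ()) } })
      λ lv pv wv τ₁ tab le₁ →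
      run-seq $ run-← ((_ , refl , _ , m<Z) , 1<W , subst (1 ≤_) (sym (lv-m tab)) (s≤s z≤n)) L (cong (_∸ 1) (lv-m tab)) _
      $ run-seq $ run-← (≤Z⇒<W G≤Z , _ , ≤Z⇒<W (<⇒≤ U<Z)) U refl _
      $ run-seq $ run-← 0<W 0 refl _
      $ run-seq $ copyLoop-run w Z l 2<Z ZL<W a lv (length A) m′<Z (Tables.lev-ok tab)
          (segment-all 0 A seg (all-weaken (λ h → <-trans h U<Z) quotient<)) (length A) 0
          (+-identityʳ (length A)) (λ _ ()) (λ _ ())
      λ base d τ₂ d-ok base-ok le₂ →
      run-seq $ run-← _ (length (members 0)) (cong length (sym members-0)) _
      $ run-seq $ run-← _ (length A) refl _
      $ run-seq $ run-← 0<W 0 refl _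
      $ run-seq $ run-← 0<W 0 refl _
      $ run-seq $ levelLoop-run w Z l K 2<Z ZL<W L<K A U U<Z lv (Tables.lev-ok tab)
          (all-weaken (λ h → <-trans h U<Z) quotient<) slots (τ₂ + 8) U 0 (+-identityʳ U)
          (subst (Segment base 0) (sym members-0) (segment-reads 0 A base-ok seg))
          (record { lower = ≤-refl ; upper = ≤-reflexive (sym (+-identityʳ _))
                  ; prefix = λ j j≤ o → trans (sumTo-cong j (λ i i<j → cong (λ z → ind (o ≤ᵇ z)) (d-ok i (<-≤-trans i<j j≤))))
                                          (segment-sum (λ x → o ≤ᵇ lev (x / L)) 0 A seg j j≤)
                  ; bounded = λ x x< → subst (_< K) (sym (d-ok x x<)) (lev<K _ (segment-all 0 A seg quotient< x x<))
                  ; starts = λ _ () ; rows = λ _ () })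
          (≤-trans (≤-reflexive (+-comm 8 τ₂)) (m≤m+n _ _))
      λ base d f s p n r7 r12 r13 r14 r15 τ₃ built le₃ →
      indexing-run w Z l κ 2<Z ZL<W 2^L≤Z d p (≤-<-trans (Built.upper built) slots) (Built.bounded built)
          (rows-fit p (Built.upper built)) (Tables.pc-ok tab) (Tables.zero-ok tab) (≤Z⇒<W κ≤Z)
      λ wv cv r7 τ₄ summed le₄ →
      cont _ _ _ _ _ _ refl
        (λ { j v (r7 ∷ r8 ∷ r9 ∷ r10 ∷ r11 ∷ r12 ∷ r13 ∷ r14 ∷ r15 ∷ r16 ∷ []) τ refl j≤ →
             tableQuery-run w Z l κ 2<Z ZL<W 2^L≤Z d p (≤-<-trans (Built.upper built) slots) (Built.bounded built)
               (rows-fit p (Built.upper built)) wv cv pv (Tables.pc-ok tab) summed A U U<Z lv (Tables.lev-ok tab)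
               lev<K L<K quotient< f s built slots j v j≤
               (λ _ _ _ _ _ _ _ _ le → _ , _ , refl , le , refl) })
        (time le₁ le₂ le₃ le₄))
    where
    m′<Z : length A < Z
    m′<Z = ≤-<-trans (m≤m+n _ _) slots
    lv-m : ∀ {lv pv wv} → Tables Z lv pv wv → lv m ≡ suc L
    lv-m tab = trans (Tables.lev-ok tab m m<Z) lev-m
    members-0 : members 0 ≡ A
    members-0 = filterᵇ-all (λ x → ≤ᵇ-true (subst (_≤ lev (x / L)) (sym lev-zero) z≤n)) A
    time : ∀ {τ₁ τ₂ τ₃ τ₄} → τ₁ ≤ suc (23 + τ) + (Z ∸ 1) * 99 → τ₂ ≤ suc (15 + τ₁) + length A * 99 →
           τ₃ ≤ suc (τ₂ + 8 + offset U * 299) → τ₄ ≤ τ₃ + Z * 299 → τ₄ ≤ τ + Z * 999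
    time {τ₁} {τ₂} {τ₃} {τ₄} le₁ le₂ le₃ le₄ = begin
      τ₄                                                  ≤⟨ le₄ ⟩
      τ₃ + Z * 299                                        ≤⟨ +-monoˡ-≤ (Z * 299) le₃ ⟩
      suc (τ₂ + 8 + offset U * 299) + Z * 299             ≤⟨ +-monoˡ-≤ (Z * 299) (s≤s (+-mono-≤ (+-monoˡ-≤ 8 le₂′) (*-monoˡ-≤ 299 offset≤Z))) ⟩
      suc (16 + (24 + τ + Z * 99) + Z * 99 + 8 + Z * 299) + Z * 299
        ≡⟨ solve 2 (λ t z → con 1 :+ (con 16 :+ (con 24 :+ t :+ z :* con 99) :+ z :* con 99 :+ con 8 :+ z :* con 299) :+ z :* con 299
                          := con 49 :+ (t :+ z :* con 796)) refl τ Z ⟩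
      49 + (τ + Z * 796)                                  ≤⟨ +-monoˡ-≤ (τ + Z * 796) (≤-trans (≤ᵇ⇒≤ 49 203 tt) (*-monoˡ-≤ 203 0<Z)) ⟩
      Z * 203 + (τ + Z * 796)                             ≡⟨ solve 2 (λ t z → z :* con 203 :+ (t :+ z :* con 796) := t :+ z :* con 999) refl τ Z ⟩
      τ + Z * 999                                         ∎
      where
      open ≤-Reasoning
      open +-*-Solver using (solve; _:+_; _:*_; _:=_; con)
      offset≤Z : offset U ≤ Z
      offset≤Z = ≤-trans (m≤n+m (offset U) (length A)) (<⇒≤ slots)
      le₂′ : τ₂ ≤ 16 + (24 + τ + Z * 99) + Z * 99
      le₂′ = ≤-trans le₂ (+-mono-≤ (+-monoʳ-≤ 16 (≤-trans le₁ (+-monoʳ-≤ (24 + τ) (*-monoˡ-≤ 99 (m∸n≤m Z 1)))))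
                                   (*-monoˡ-≤ 99 (<⇒≤ m′<Z)))

-- Choice of the constants

^-reflects-≤ : ∀ {a b} → 2 ^ a ≤ 2 ^ b → a ≤ b
^-reflects-≤ {a} {b} p = ≮⇒≥ λ b<a → <-irrefl refl (<-≤-trans (^-monoʳ-< 2 ≤-refl b<a) p)

-- Compares L² with m, as 2 ^ L ≤ m. Without the factor 2 the inequality would fail at n = 3.
n²≤2*2^n : ∀ n → n * n ≤ 2 * 2 ^ n
n²≤2*2^n zero    = z≤n
n²≤2*2^n (suc n) = begin
  suc n * suc n                ≡⟨ solve 1 (λ n → (con 1 :+ n) :* (con 1 :+ n) := n :* n :+ (con 1 :+ con 2 :* n)) refl n ⟩
  n * n + suc (2 * n)          ≤⟨ +-mono-≤ (n²≤2*2^n n) (≤-trans (n≤1+n _) (≤-trans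
                                    (≤-reflexive (solve 1 (λ n → con 2 :+ con 2 :* n := con 2 :* (con 1 :+ n)) refl n))
                                    (*-monoʳ-≤ 2 (n<2^n n)))) ⟩
  2 * 2 ^ n + 2 * 2 ^ n        ≡⟨ solve 1 (λ k → con 2 :* k :+ con 2 :* k := con 2 :* (con 2 :* k)) refl (2 ^ n) ⟩
  2 * (2 * 2 ^ n)              ∎
  where
  open ≤-Reasoning
  open +-*-Solver using (solve; _:+_; _:*_; _:=_; con)

module Constants (c₀ : ℕ) where
  -- As log₂ m < L + 1 ≤ 2 * L, the quotients sum to at most 2 * c₀ * m, less than G * m. A number
  -- below G * m has at most G + L + 1 bits, fewer than κ * L. The input length and the size of F
  -- add up to at most (6 * c₀ + 3) * m; E leaves room for partial blocks and strict inequalities,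
  -- and the factor κ + 1 in C is for the κ * L + 1 rows.
  G κ E C : ℕ
  G = suc (2 * c₀)
  κ = 3 + G
  E = 6 * c₀ + 5
  C = suc κ * E

  -- The 9 counts the arrays, the 2 is that of `n²≤2*2^n`: from L ≥ 18 * C follows 18 * C * L ≤ L² ≤
  -- 2 * m.
  smallBits : ℕ
  smallBits = 2 * (9 * C)

  module _ (m w : ℕ) (2≤m : 2 ≤ m) (m²≤W : m ^ 2 ≤ 2 ^ w) (large : 2 ^ smallBits ≤ m)
           (A : List ℕ) (length≤ : length A ≤ m) (sum≤ : 2 ^ sum A ≤ m ^ (c₀ * m))
           (l : ℕ) (lev-m : lev m ≡ suc (suc l)) where
    open Levels l
    open LevelInvariant l (κ * suc l) A using (offset)
    open ≤-Reasoning
    open +-*-Solver using (solve; _:+_; _:*_; _:=_; con)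

    private
      Z U : ℕ
      Z = C * m
      U = G * m

      2^L≤m : 2 ^ L ≤ m
      2^L≤m = ≮⇒≥ λ m<2^L → <-irrefl refl (<-≤-trans (≤-reflexive (sym lev-m)) (lev≤ L m<2^L))

      m<2^1+L : m < 2 ^ suc L
      m<2^1+L = subst (λ k → m < 2 ^ k) lev-m (<2^lev m)

      1≤m : 1 ≤ m
      1≤m = <⇒≤ 2≤m

      L≤m : L ≤ m
      L≤m = ≤-trans (<⇒≤ (n<2^n L)) 2^L≤m

      18C≤L : smallBits ≤ L
      18C≤L = ^-reflects-≤′ (≤-<-trans large m<2^1+L)
        where
        ^-reflects-≤′ : 2 ^ smallBits < 2 ^ suc L → smallBits ≤ L
        ^-reflects-≤′ p = ≮⇒≥ λ q → <-irrefl refl (<-≤-trans p (^-monoʳ-≤ 2 q))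

      9CL≤m : 9 * C * L ≤ m
      9CL≤m = *-cancelˡ-≤ 2 (begin
        2 * (9 * C * L)       ≡⟨ *-assoc 2 (9 * C) L ⟨
        smallBits * L         ≤⟨ *-monoˡ-≤ L 18C≤L ⟩
        L * L                 ≤⟨ n²≤2*2^n L ⟩
        2 * 2 ^ L             ≤⟨ *-monoʳ-≤ 2 2^L≤m ⟩
        2 * m                 ∎)

      -- One factor m is absorbed by the stride; the other pays for the nine arrays, the constant C
      -- and the factor L.
      9ZL≤W : 9 * Z * L ≤ 2 ^ w
      9ZL≤W = begin
        9 * (C * m) * L       ≡⟨ solve 3 (λ c m l → con 9 :* (c :* m) :* l := m :* (con 9 :* c :* l)) refl C m L ⟩
        m * (9 * C * L)       ≤⟨ *-monoʳ-≤ m 9CL≤m ⟩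
        m * m                 ≡⟨ cong (m *_) (*-identityʳ m) ⟨
        m ^ 2                 ≤⟨ m²≤W ⟩
        2 ^ w                 ∎

      sum≤′ : sum A ≤ suc L * (c₀ * m)
      sum≤′ = ^-reflects-≤ (begin
        2 ^ sum A                   ≤⟨ sum≤ ⟩
        m ^ (c₀ * m)                ≤⟨ ^-monoˡ-≤ (c₀ * m) (<⇒≤ m<2^1+L) ⟩
        (2 ^ suc L) ^ (c₀ * m)      ≡⟨ ^-*-assoc 2 (suc L) (c₀ * m) ⟩
        2 ^ (suc L * (c₀ * m))      ∎)

      quotients≤ : quotients A ≤ 2 * c₀ * m
      quotients≤ = *-cancelʳ-≤ (quotients A) (2 * c₀ * m) L (begin
        quotients A * L             ≤⟨ quotients-≤ A ⟩
        sum A                       ≤⟨ sum≤′ ⟩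
        suc L * (c₀ * m)            ≤⟨ *-monoˡ-≤ (c₀ * m) (+-monoˡ-≤ L {1} {L} (s≤s z≤n)) ⟩
        (L + L) * (c₀ * m)          ≡⟨ solve 3 (λ l c m → (l :+ l) :* (c :* m) := con 2 :* c :* m :* l) refl L c₀ m ⟩
        2 * c₀ * m * L              ∎)

      each : ∀ xs b → quotients xs ≤ b → All (λ x → x / L < suc b) xs
      each []       b le = []
      each (x ∷ xs) b le = s≤s (≤-trans (m≤m+n _ _) le) ∷ each xs b (≤-trans (m≤n+m _ (x / L)) le)

      offset≤ : offset U ≤ U + (m + 2 * (2 * c₀ * m))
      offset≤ = begin
        offset U                              ≡⟨ sumTo-+ (const 1) (levelSize A) U ⟩
        sumTo (const 1) U + sumTo (levelSize A) U
          ≤⟨ +-mono-≤ (≤-reflexive (trans (sumTo-const 1 U) (*-identityʳ U)))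
               (≤-trans (levelSizes-≤ A U) (+-mono-≤ length≤ (*-monoʳ-≤ 2 quotients≤))) ⟩
        U + (m + 2 * (2 * c₀ * m))            ∎

      slots≤ : length A + offset U ≤ (6 * c₀ + 3) * m
      slots≤ = begin
        length A + offset U                      ≤⟨ +-mono-≤ length≤ offset≤ ⟩
        m + (U + (m + 2 * (2 * c₀ * m)))
          ≡⟨ solve 2 (λ c m → m :+ ((con 1 :+ con 2 :* c) :* m :+ (m :+ con 2 :* (con 2 :* c :* m)))
                       := (con 6 :* c :+ con 3) :* m) refl c₀ m ⟩
        (6 * c₀ + 3) * m                         ∎

      E≤C : E ≤ C
      E≤C = m≤n*m E (suc κ)

      5≤E : 5 ≤ E
      5≤E = m≤n+m 5 (6 * c₀)

      *m≤Z : ∀ {k} → k ≤ E → k * m ≤ Z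
      *m≤Z k≤E = *-monoˡ-≤ m (≤-trans k≤E E≤C)

      *m<Z : ∀ {k} → k < E → k * m < Z
      *m<Z {k} k<E = <-≤-trans (m<n+m (k * m) 1≤m) (*m≤Z k<E)

      κ≤C : κ ≤ C
      κ≤C = ≤-trans (n≤1+n κ) (m≤m*n (suc κ) E {{>-nonZero (<-≤-trans (s≤s z≤n) 5≤E)}})

      C≤Z : C ≤ Z
      C≤Z = m≤m*n C m {{>-nonZero 1≤m}}

      levels : ∀ u → u < G * m → lev u < κ * L
      levels u u<U = ≤-<-trans (lev≤ (G + suc L) (<-trans u<U (begin-strict
        G * m                  <⟨ *-mono-< (n<2^n G) m<2^1+L ⟩
        2 ^ G * 2 ^ suc L      ≡⟨ ^-distribˡ-+-* 2 G (suc L) ⟨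
        2 ^ (G + suc L)        ∎))) (begin-strict
        G + suc L              <⟨ +-monoʳ-< G (n<1+n (suc L)) ⟩
        G + (2 + L)            ≤⟨ +-mono-≤ (m≤m*n G L) (+-monoˡ-≤ L (*-monoʳ-≤ 2 {1} {L} (s≤s z≤n))) ⟩
        G * L + (2 * L + L)    ≡⟨ solve 2 (λ g l → g :* l :+ (con 2 :* l :+ l) := (con 3 :+ g) :* l) refl G L ⟩
        κ * L                  ∎)

    sizes : Sizes w Z l κ G m A
    sizes = record
      { 2<Z       = ≤-trans (≤ᵇ⇒≤ 3 5 tt) (≤-trans 5≤E (≤-trans E≤C C≤Z))
      ; ZL<W      = <-≤-trans (subst (Z * L <_) (solve 2 (λ z l → z :* l :+ con 8 :* z :* l := con 9 :* z :* l) refl Z L)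
                      (m<m+n (Z * L) (*-mono-< {0} {8 * Z} {0} (*-mono-< {0} {8} {0} (s≤s z≤n) 0<Z) (s≤s z≤n)))) 9ZL≤W
      ; space     = ≤-trans (m≤m*n (9 * Z) L) 9ZL≤W
      ; lev-m     = lev-m
      ; m<Z       = subst (_< Z) (*-identityˡ m) (*m<Z (≤-trans (≤ᵇ⇒≤ 2 5 tt) 5≤E))
      ; L<K       = subst (_< κ * L) (*-identityˡ L) (*-monoˡ-< L {1} {κ} (s≤s (s≤s z≤n)))
      ; 2^L≤Z     = ≤-trans 2^L≤m (subst (_≤ Z) (*-identityˡ m) (*m≤Z (≤-trans (s≤s z≤n) 5≤E)))
      ; κ≤Z       = ≤-trans κ≤C C≤Z
      ; G≤Z       = ≤-trans (≤-trans (m≤n+m G 3) κ≤C) C≤Z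
      ; U<Z       = *m<Z (≤-trans (≤-reflexive (+-comm 2 (2 * c₀))) (+-mono-≤ (*-monoˡ-≤ c₀ (≤ᵇ⇒≤ 2 6 tt)) (≤ᵇ⇒≤ 2 5 tt)))
      ; quotient< = weaken (each A (2 * c₀ * m) quotients≤)
      ; lev<K     = levels
      ; slots     = ≤-<-trans slots≤ (*m<Z (+-monoʳ-< (6 * c₀) (≤ᵇ⇒≤ 4 5 tt)))
      ; rows-fit  = rows
      }
      where
      0<Z : 0 < Z
      0<Z = <-≤-trans (s≤s z≤n) (≤-trans 5≤E (≤-trans E≤C C≤Z))
      weaken : ∀ {xs} → All (λ x → x / L < suc (2 * c₀ * m)) xs → All (λ x → x / L < G * m) xs
      weaken []       = []
      weaken (h ∷ hs) = <-≤-trans h (+-monoˡ-≤ (2 * c₀ * m) 1≤m) ∷ weaken hs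
      rows : ∀ p → p ≤ length A + offset U → suc (κ * L) * suc (p / L) ≤ Z
      rows p p≤ = begin
        suc (κ * L) * suc (p / L)       ≤⟨ *-monoˡ-≤ (suc (p / L)) (+-monoˡ-≤ (κ * L) {1} {L} (s≤s z≤n)) ⟩
        suc κ * L * suc (p / L)         ≡⟨ solve 3 (λ k l q → k :* l :* (con 1 :+ q) := k :* (l :+ q :* l)) refl (suc κ) L (p / L) ⟩
        suc κ * (L + p / L * L)         ≤⟨ *-monoʳ-≤ (suc κ) (+-mono-≤ L≤m (≤-trans (m/n*n≤m p L) (≤-trans p≤ slots≤))) ⟩
        suc κ * (m + (6 * c₀ + 3) * m)  ≤⟨ *-monoʳ-≤ (suc κ) (*-monoˡ-≤ m (≤-trans (≤-reflexive (sym (+-suc (6 * c₀) 3))) (+-monoʳ-≤ (6 * c₀) (≤ᵇ⇒≤ 4 5 tt)))) ⟩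
        suc κ * (E * m)                 ≡⟨ *-assoc (suc κ) E m ⟨
        Z                               ∎

-- Small m, and the choice between the two methods

halve : ℕ → Cmd
halve zero    = pass
halve (suc k) = 3 ← var 3 ⊘ num 2 ⨾ halve k

countBody countLoop scan : Cmd
countBody =
  (test 0 ⟦ var 7 ⟧ < var 1 then pass else 8 ← var 8 ⊕ num 1) ⨾
  7 ← var 7 ⊕ num 1
countLoop = while 7 < 0 repeat countBody
scan =
  7 ← num 0 ⨾
  8 ← num 0 ⨾
  countLoop ⨾
  0 ← var 8

-- Whether m < 2 ^ k is found by k halvings, since the literals 2 ^ k and k might be reduced modulo
-- 2 ^ w when w is small, whereas 2 always fits. For small m only array 0 is accessed, and the
-- stride m suffices.
preprocessing : (k C G κ : ℕ) → Cmd
preprocessing k C G κ =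
  3 ← var 0 ⨾
  halve k ⨾
  (test num 0 < var 3 then 2 ← num C ⊗ var 0 ⨾ build G κ else 2 ← var 0)

answering : Cmd
answering = test num 0 < var 3 then tableQuery else scan

halved : ℕ → ℕ → ℕ
halved zero    x = x
halved (suc k) x = halved k (x / 2)

halved-zero : ∀ k x → halved k x ≡ 0 → x < 2 ^ k
halved-zero zero    x eq = s≤s (≤-reflexive eq)
halved-zero (suc k) x eq = <-≤-trans (n<2*[1+n/2] x) (*-monoʳ-≤ 2 (halved-zero k (x / 2) eq))

halved-pos : ∀ k x → 0 < halved k x → 2 ^ k ≤ x
halved-pos zero    x p = p
halved-pos (suc k) x p = ≤-trans (*-monoʳ-≤ 2 (halved-pos k (x / 2) p))
  (subst (_≤ x) (*-comm (x / 2) 2) (m/n*n≤m x 2))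

segment-lookup : ∀ {f} k xs → (∀ i → f (k + toℕ i) ≡ lookup xs i) → Segment f k xs
segment-lookup k []       eq = tt
segment-lookup {f} k (x ∷ xs) eq = trans (cong f (sym (+-identityʳ k))) (eq zero) ,
  segment-lookup (suc k) xs (λ i → trans (cong f (sym (+-suc k (toℕ i)))) (eq (suc i)))

nth-applyUpTo : ∀ {X : Set} d (f : ℕ → X) n r → r < n → nth d (applyUpTo f n) r ≡ f r
nth-applyUpTo d f (suc n) zero    p       = refl
nth-applyUpTo d f (suc n) (suc r) (s≤s p) = nth-applyUpTo d (f ∘ suc) n r p

module _ (w Z : ℕ) where
  open Simulation w Z
  open _≈_

  run-weaken : ∀ {P s Q Q′} → (∀ s′ → Q s′ → Q′ s′) → Run P s Q → Run P s Q′
  run-weaken imp run = running λ σ σ≈s →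
    let σ′ , t , s′ , exec , rel , time , q = reaches run σ σ≈s in σ′ , t , s′ , exec , rel , time , imp s′ q

  halve-run : ∀ {r0 r1 r2 rest arrs Q} → 2 < 2 ^ w → ∀ k x {τ} →
    (∀ τ′ → τ′ ≤ suc τ + k * 4 → Q ⟪ r0 ∷ r1 ∷ r2 ∷ halved k x ∷ rest , arrs , τ′ ⟫) →
    Run (halve k) ⟪ r0 ∷ r1 ∷ r2 ∷ x ∷ rest , arrs , τ ⟫ Q
  halve-run 2<W zero    x cont = run-pass (cont _ (m≤m+n _ _))
  halve-run 2<W (suc k) x cont = run-seq $ run-← (_ , 2<W , _) (x / 2) refl _
    $ halve-run 2<W k (x / 2) (λ τ′ le → cont τ′ (loop-time k 4 4 _ le))

  -- Uninitialised registers and cells enter the abstract state with whatever values σ has there, so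
  -- nothing is assumed about them.
  initial-≈ : ∀ {m A} n → n * Z ≤ 2 ^ w → (σ : State w) → Holds m A σ →
    σ ≈ ⟪ m ∷ length A ∷ applyUpTo (λ r → toℕ (regs σ (2 + r))) 15
        , applyUpTo (λ q x → toℕ (mem σ (word w (q * Z + x)))) n , 0 ⟫
  initial-≈ n n*Z≤W σ holds = record
    { vars-length = refl
    ; vars-eq     = λ where
        zero          _               → Holds.m-in-r0 holds
        (suc zero)    _               → Holds.m′-in-r1 holds
        (suc (suc r)) (s≤s (s≤s r<)) → sym (nth-applyUpTo 0 (λ r → toℕ (regs σ (2 + r))) 15 r r<)
    ; space       = subst (λ k → k * Z ≤ 2 ^ w) (sym (length-applyUpTo _ n)) n*Z≤W
    ; cells-eq    = λ q x q< _ → cong (_$ x) (sym (nth-applyUpTo (const 0)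
        (λ q x → toℕ (mem σ (word w (q * Z + x)))) n q (subst (q <_) (length-applyUpTo _ n) q<)))
    }

  answers : ∀ {D A fixed arrs} → length A < 2 ^ w → length fixed ≡ 5 → Serves w Z answering D A fixed arrs →
    ∀ {σ r0 r1 junk τ} → length junk ≡ 10 → σ ≈ ⟪ r0 ∷ r1 ∷ fixed ++ junk , arrs , τ ⟫ →
    ∀ qs → Answers (code answering) D A σ qs
  answers length< fixed-length serves junk-length σ≈s [] = tt
  answers {D} {A} length< fixed-length serves {σ} {junk = junk} {τ} junk-length σ≈s ((j , v) ∷ qs)
    with reaches (serves (toℕ j) (toℕ v) junk τ junk-length (s≤s⁻¹ (toℕ<n j))) _
           (setVar-≈ 1 v (toℕ v) (≤ᵇ⇒≤ 2 numVars tt) refl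
             (setVar-≈ 0 (word w (toℕ j)) (toℕ j) (≤ᵇ⇒≤ 1 numVars tt)
               (toℕ-word (toℕ j) (≤-<-trans (s≤s⁻¹ (toℕ<n j)) length<)) σ≈s))
  ... | σ′ , t , _ , exec , rel , time , junk′ , τ′ , junk′-length , le , refl =
    σ′ , t , exec , +-cancelʳ-≤ τ t D (≤-trans time le) , vars-eq rel 0 (s≤s z≤n) ,
    answers length< fixed-length serves junk′-length rel qs

  serve-tables : ∀ {D A Z′ flag L NB U arrs} → 0 < 2 ^ w → 0 < flag → 503 ≤ D →
    Serves w Z tableQuery 500 A (Z′ ∷ flag ∷ L ∷ NB ∷ U ∷ []) arrs →
    Serves w Z answering D A (Z′ ∷ flag ∷ L ∷ NB ∷ U ∷ []) arrs
  serve-tables {D} 0<W 0<flag 503≤D serves j v junk τ junk-length j≤ =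
    run-if {e₁ = num 0} {var 3} 0<W _ 0 refl _ refl
      (λ _ → run-weaken (λ { _ (junk′ , τ′ , jl , le , eq) → junk′ , τ′ , jl ,
                ≤-trans le (+-monoˡ-≤ τ 503≤D) , eq }) (serves j v junk (3 + τ) junk-length j≤))
      (λ flag≤0 → contradiction (<-≤-trans 0<flag flag≤0) (<-irrefl refl))

module _ (w m : ℕ) (m<W : m < 2 ^ w) (1<W : 1 < 2 ^ w) (A : List ℕ) (length≤ : length A ≤ m)
         (a : ℕ → ℕ) (seg : Segment a 0 A) where
  open Simulation w m

  private
    hits : ℕ → ℕ → ℕ
    hits v = sumTo (λ i → ind (v ≤ᵇ a i))

    0<W : 0 < 2 ^ w
    0<W = <-trans ≤-refl 1<W

  countLoop-run : ∀ {v r3 r4 r5 r6 rest Q} j n x {τ} → j ≤ length A → n + x ≡ j →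
    (∀ τ′ → τ′ ≤ suc τ + n * 99 → Q ⟪ j ∷ v ∷ m ∷ r3 ∷ r4 ∷ r5 ∷ r6 ∷ j ∷ hits v j ∷ rest , a ∷ [] , τ′ ⟫) →
    Run countLoop ⟪ j ∷ v ∷ m ∷ r3 ∷ r4 ∷ r5 ∷ r6 ∷ x ∷ hits v x ∷ rest , a ∷ [] , τ ⟫ Q
  countLoop-run j zero    x j≤ refl cont = run-exit _ _ ≤-refl (cont _ (m≤m+n _ _))
  countLoop-run {v} {r3} {r4} {r5} {r6} {rest} {Q} j (suc n) x {τ} j≤ eq cont =
    run-loop _ _ x<j $ run-seq $ run-if {e₁ = 0 ⟦ var 7 ⟧} {var 1} (_ , refl , _ , x<m) _ (a x) refl v refl
      (λ lt → run-pass (next _ (trans (sym (+-identityʳ _)) (cong (λ b → hits v x + ind b) (sym (≤ᵇ-false lt)))) (ticks 10 20 _)))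
      (λ ge → run-← (_ , 1<W , ≤-<-trans (subst (_≤ m) (+-comm 1 (hits v x)) (≤-<-trans hits≤x x<m)) m<W)
        (hits v x + 1) refl _
        (next _ (cong (λ b → hits v x + ind b) (sym (≤ᵇ-true ge))) (ticks 13 20 _)))
    where
    x<j : x < j
    x<j = subst (x <_) eq (s≤s (m≤n+m x n))
    x<m : x < m
    x<m = <-≤-trans x<j (≤-trans j≤ length≤)
    hits≤x : hits v x ≤ x
    hits≤x = subst (hits v x ≤_) (*-identityʳ x) (sumTo-≤ _ x 1 (λ i → ind≤1 (v ≤ᵇ a i)))
    next : ∀ h {τ′} → h ≡ hits v (suc x) → τ′ ≤ 20 + τ →
      Run (7 ← var 7 ⊕ num 1) ⟪ j ∷ v ∷ m ∷ r3 ∷ r4 ∷ r5 ∷ r6 ∷ x ∷ h ∷ rest , a ∷ [] , τ′ ⟫ (λ s → Run countLoop s Q)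
    next h refl le = run-← (_ , 1<W , ≤-<-trans (subst (_≤ m) (+-comm 1 x) x<m) m<W) (suc x) (+-comm x 1) _
      $ countLoop-run j n (suc x) j≤ (trans (+-suc n x) eq)
          (λ τ″ le′ → cont τ″ (loop-time n 24 99 _ (≤-trans le′ (+-monoˡ-≤ (n * 99) (s≤s (+-monoʳ-≤ 4 le))))))

  serve-scan : ∀ {D flag L NB U} → flag ≡ 0 → m * 99 + 11 ≤ D → Serves w m answering D A (m ∷ flag ∷ L ∷ NB ∷ U ∷ []) (a ∷ [])
  serve-scan {D} flag≡0 bound j v (r7 ∷ r8 ∷ junk) τ junk-length j≤ =
    run-if {e₁ = num 0} {var 3} 0<W _ 0 refl 0 flag≡0 (λ ()) λ _ →
    run-seq $ run-← 0<W 0 refl _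
    $ run-seq $ run-← 0<W 0 refl _
    $ run-seq $ countLoop-run j j 0 j≤ (+-identityʳ j) λ τ′ le →
    run-← _ (rangeCount A j v) (trans (segment-sum (v ≤ᵇ_) 0 A seg j j≤) (sym (rangeCount-count A j v))) _
      (_ , _ , junk-length , time le , refl)
    where
    time : ∀ {τ′} → τ′ ≤ suc (7 + τ) + j * 99 → 2 + τ′ ≤ D + τ
    time {τ′} le = begin
      2 + τ′                      ≤⟨ +-monoʳ-≤ 2 le ⟩
      2 + (8 + τ + j * 99)        ≤⟨ +-monoʳ-≤ 2 (+-monoʳ-≤ (8 + τ) (*-monoˡ-≤ 99 (≤-trans j≤ length≤))) ⟩
      10 + τ + m * 99             ≤⟨ n≤1+n _ ⟩
      11 + τ + m * 99             ≡⟨ solve 2 (λ t q → con 11 :+ t :+ q := q :+ con 11 :+ t) refl τ (m * 99) ⟩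
      m * 99 + 11 + τ             ≤⟨ +-monoˡ-≤ τ bound ⟩
      D + τ                       ∎
      where
      open ≤-Reasoning
      open +-*-Solver using (solve; _:+_; _:*_; _:=_; con)

-- Step bounds, and the two cases together

buildFactor : ℕ → ℕ → ℕ
buildFactor k C = k * 4 + 20 + C * 999

-- The first term pays for a scan of fewer than 2 ^ k elements, and 600 alone covers a query by
-- table.
queryTime : ℕ → ℕ
queryTime k = 2 ^ k * 99 + 600

abstract

  build-time : ∀ k C m → 1 ≤ m → 4 + (k * 4 + 6) + C * m * 999 ≤ buildFactor k C * m
  build-time k C m 1≤m = begin
    4 + (k * 4 + 6) + C * m * 999       ≡⟨ cong₂ _+_ (trans (+-comm 4 (k * 4 + 6)) (+-assoc (k * 4) 6 4)) (swap C m 999) ⟩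
    k * 4 + 10 + C * 999 * m            ≤⟨ +-monoˡ-≤ (C * 999 * m) (≤-trans (+-monoʳ-≤ (k * 4) (≤ᵇ⇒≤ 10 20 tt))
                                             (m≤m*n (k * 4 + 20) m {{>-nonZero 1≤m}})) ⟩
    (k * 4 + 20) * m + C * 999 * m      ≡⟨ *-distribʳ-+ m (k * 4 + 20) (C * 999) ⟨
    (k * 4 + 20 + C * 999) * m          ∎
    where
    open ≤-Reasoning
    open +-*-Solver using (solve; _:*_; _:=_)
    swap : ∀ x y z → x * y * z ≡ x * z * y
    swap = solve 3 (λ x y z → x :* y :* z := x :* z :* y) refl

module Correctness (c₀ k C G κ : ℕ)
  (sizes : ∀ m w → 2 ≤ m → m ^ 2 ≤ 2 ^ w → 2 ^ k ≤ m → ∀ A → length A ≤ m → 2 ^ sum A ≤ m ^ (c₀ * m) →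
           ∀ l → lev m ≡ suc (suc l) → Sizes w (C * m) l κ G m A) where

  builder : Cmd
  builder = preprocessing k C G κ

  module _ (m w : ℕ) (2≤m : 2 ≤ m) (m²≤W : m ^ 2 ≤ 2 ^ w) (A : List ℕ) (length≤ : length A ≤ m)
           (sum≤ : 2 ^ sum A ≤ m ^ (c₀ * m)) (σ : State w) (holds : Holds m A σ) where

    Prepared : State w → Set
    Prepared σ′ = (qs : List (Query w A)) → Answers (code answering) (queryTime k) A σ′ qs

    private
      4≤W : 4 ≤ 2 ^ w
      4≤W = ≤-trans (^-monoˡ-≤ 2 2≤m) m²≤W

      m<W : m < 2 ^ w
      m<W = <-≤-trans (subst₂ _<_ (*-identityʳ m) (cong (m *_) (sym (*-identityʳ m)))
              (*-monoʳ-< m {{>-nonZero (<⇒≤ 2≤m)}} 2≤m)) m²≤W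

      lev-m : ∃[ l ] lev m ≡ suc (suc l)
      lev-m with lev m | <2^lev m
      ... | zero        | m<1 = contradiction (<-≤-trans m<1 (<⇒≤ 2≤m)) (<-irrefl refl)
      ... | suc zero    | m<2 = contradiction (<-≤-trans m<2 2≤m) (<-irrefl refl)
      ... | suc (suc l) | _   = l , refl

      prelude-time : ∀ {τ} → τ ≤ suc 2 + k * 4 → 3 + τ ≤ k * 4 + 6
      prelude-time {τ} le = ≤-trans (+-monoʳ-≤ 3 le) (≤-reflexive (+-comm 6 (k * 4)))

      ≤*m : ∀ x → x ≤ x * m
      ≤*m x = m≤m*n x m {{>-nonZero (<⇒≤ 2≤m)}}

      Done : ℕ → AState → Set
      Done Z s = AState.clock s ≤ buildFactor k C * m ×
        (∀ σ′ → Simulation._≈_ w Z σ′ s → Prepared σ′)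

      finish : ∀ Z s → Simulation._≈_ w Z σ s → AState.clock s ≡ 0 → Simulation.Run w Z builder s (Done Z) →
        Σ[ σ′ ∈ State w ] ∃[ t ] (⟨ code builder , σ ⟩⇓[ t ] σ′) × t ≤ buildFactor k C * m × Prepared σ′
      finish Z s σ≈s clock≡0 run =
        let σ′ , t , s′ , exec , rel , time , le , prepared = Simulation.Run.reaches run σ σ≈s
        in σ′ , t , exec , ≤-trans (m≤m+n t _) (≤-trans time le) , prepared σ′ rel

    prepare : Σ[ σ′ ∈ State w ] ∃[ t ] (⟨ code builder , σ ⟩⇓[ t ] σ′) × t ≤ buildFactor k C * m × Prepared σ′
    -- The stride is a parameter of the simulation and can be fixed according to the case before the
    -- program has computed it: the stride variable is consulted only at array accesses.
    prepare with halved k m in eq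
    ... | zero = finish m _ (initial-≈ w m 1 (≤-trans (≤-reflexive (*-identityˡ m)) (<⇒≤ m<W)) σ holds) refl
          $ run-seq $ run-← _ m refl _
          $ run-seq $ halve-run w m (<-≤-trans (≤ᵇ⇒≤ 3 4 tt) 4≤W) k m λ τ le →
            run-if {e₁ = num 0} {var 3} (≤-trans (s≤s z≤n) 4≤W) _ 0 refl 0 eq (λ ()) λ _ →
            run-← _ m refl _
              ( ≤-trans (+-monoʳ-≤ 2 (prelude-time le)) small-time
              , λ _ → answers w m (≤-<-trans length≤ m<W) refl
                  (serve-scan w m m<W (<-≤-trans (≤ᵇ⇒≤ 2 4 tt) 4≤W) A length≤ a seg eq scan-time) refl )
          where
          open Simulation w m
          a : ℕ → ℕ
          a x = toℕ (mem σ (word w x))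
          seg : Segment a 0 A
          seg = segment-lookup 0 A (Holds.A-in-mem holds)
          small-time : 2 + (k * 4 + 6) ≤ buildFactor k C * m
          small-time = ≤-trans (≤-trans (≤-reflexive (+-comm 2 (k * 4 + 6)))
            (≤-trans (≤-reflexive (+-assoc (k * 4) 6 2)) (≤-trans (+-monoʳ-≤ (k * 4) (≤ᵇ⇒≤ 8 20 tt)) (m≤m+n _ _)))) (≤*m (buildFactor k C))
          scan-time : m * 99 + 11 ≤ queryTime k
          scan-time = +-mono-≤ (*-monoˡ-≤ 99 (<⇒≤ (halved-zero k m eq))) (≤ᵇ⇒≤ 11 600 tt)
    ... | suc h = finish Z _ (initial-≈ w Z 9 (Sizes.space fit) σ holds) refl
          $ run-seq $ run-← _ m refl _
          $ run-seq $ halve-run w Z (<-≤-trans (≤ᵇ⇒≤ 3 4 tt) 4≤W) k m λ τ le →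
            run-if {e₁ = num 0} {var 3} (≤-trans (s≤s z≤n) 4≤W) _ 0 refl (suc h) eq
              (λ _ → run-seq $ run-← (≤-<-trans C≤Z Z<W , _ , Z<W) Z refl _
                   $ build-run fit seg λ NB arrs r0 r1 junk τ′ junk-length serves le′ →
                     ≤-trans le′ (≤-trans (+-monoˡ-≤ (Z * 999) (+-monoʳ-≤ 4 (prelude-time le))) (build-time k C m (<⇒≤ 2≤m)))
                     , λ _ → answers w Z (≤-<-trans length≤ m<W) refl
                         (serve-tables w Z (≤-trans (s≤s z≤n) 4≤W) (subst (0 <_) (sym eq) (s≤s z≤n))
                           (≤-trans (≤ᵇ⇒≤ 503 600 tt) (m≤n+m 600 _)) serves) junk-length)
              (λ ())
          where
          Z l : ℕ
          Z = C * m
          l = proj₁ lev-m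
          open Simulation w Z
          fit : Sizes w Z l κ G m A
          fit = sizes m w 2≤m m²≤W (halved-pos k m (subst (0 <_) (sym eq) (s≤s z≤n))) A length≤ sum≤ l (proj₂ lev-m)
          C≤Z : C ≤ Z
          C≤Z = ≤*m C
          Z<W : Z < 2 ^ w
          Z<W = ≤-<-trans (m≤m*n Z (suc l)) (Sizes.ZL<W fit)
          seg : Segment (λ x → toℕ (mem σ (word w x))) 0 A
          seg = segment-lookup 0 A (Holds.A-in-mem holds)

theorem4p2 : (c₀ : ℕ) →
    Σ[ preprocess ∈ Program ] Σ[ query ∈ Program ] ∃[ c ] ∃[ d ]
    ((m w : ℕ) → 2 ≤ m → w ≥ 2 ·log₂ m →
    (A : List ℕ) → length A ≤ m → All (0 <_) A →
    sum A ≤ c₀ * m ·log₂ m →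
    (σ : State w) → Holds m A σ →
    Σ[ σ′ ∈ State w ] ∃[ t ]
    (⟨ preprocess , σ ⟩⇓[ t ] σ′)
    × t ≤ c * m
    × ((qs : List (Query w A)) → Answers query d A σ′ qs))
theorem4p2 c₀ = code builder , code answering , buildFactor smallBits C , queryTime smallBits ,
  λ m w 2≤m w≥ A length≤ _ sum≤ σ holds → prepare m w 2≤m w≥ A length≤ sum≤ σ holds
  where
  open Constants c₀ using (G; κ; C; smallBits; sizes)
  open Correctness c₀ smallBits C G κ sizes
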